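{- For every integer $n\ge 0$: $$\dim(\mathbf{WQSym}^*_n)=\#\{\text{red-packed forests of weight } n\},\qquad \dim(\mathrm{Prim}^*_n)=\#\{\text{red-packed trees of weight } n\},$$ $$\dim(\mathrm{TPrim}^*_n)=\#\{\text{red-packed trees of weight } n \text{ whose root has empty left forest}\}.$$
   Context: Words are finite words over the positive integers; $|w|$ is the length, $\max(w)$ the largest letter ($\max(\varepsilon)=0$). A word $w$ is packed if every integer $1,\dots,\max(w)$ occurs in it ($\varepsilon$ is packed); $\mathrm{PW}_n$ is the set of packed words of length $n$. $\mathrm{pack}(w)$ replaces the $j$-th smallest distinct letter of $w$ by $j$. $\mathbf{WQSym}^*_n$ is the vector space (over a field $K$) with basis $(\mathbb{R}_w)_{w\in\mathrm{PW}_n}$, and $(\mathbf{WQSym}^*)_+=\bigoplus_{n\ge1}\mathbf{WQSym}^*_n$. For $u=u_1\cdots u_n\in\mathrm{PW}_n$, $n\ge1$, define $\Delta_\prec(\mathbb{R}_u)=\sum \mathbb{R}_{\mathrm{pack}(u_1\cdots u_i)}\otimes\mathbb{R}_{\mathrm{pack}(u_{i+1}\cdots u_n)}$ over those $1\le i\le n-1$ with $\{u_1,\dots,u_i\}\cap\{u_{i+1},\dots,u_n\}=\emptyset$ and $\max(u)\in\{u_1,\dots,u_i\}$, and $\Delta_\succ(\mathbb{R}_u)$ the same sum over those $1\le i\le n-1$ with $\{u_1,\dots,u_i\}\cap\{u_{i+1},\dots,u_n\}=\emptyset$ and $\max(u)\notin\{u_1,\dots,u_i\}$; extend linearly. $\mathrm{Prim}^*_n=\mathbf{WQSym}^*_n\cap\ker(\Delta_\prec+\Delta_\succ)$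 and $\mathrm{TPrim}^*_n=\mathbf{WQSym}^*_n\cap\ker\Delta_\prec\cap\ker\Delta_\succ$ for $n\ge1$ (both $0$ for $n=0$). A biplane tree with labels in a set $L$ is recursively $\mathrm{Node}(x,f_\ell,f_r)$ with $x\in L$ the root label and $f_\ell$, $f_r$ (left and right forests) finite ordered, possibly empty, lists of such trees; a forest is a finite ordered list of trees. Red-packed trees have labels that are nonempty finite sets $I=\{i_1<\dots<i_p\}$ of positive integers; the weight is $\omega(\mathrm{Node}(I,f_\ell,f_r))=|I|+$ (sum of weights of the trees of $f_\ell$ and $f_r$), and the weight of a forest is the sum of the weights of its trees. A tree $t=\mathrm{Node}(I,[\ell_1,\dots,\ell_g],[r_1,\dots,r_d])$ with $I=\{i_1<\dots<i_p\}$ is red-packed if all $\ell_j$ and $r_j$ are red-packed and either ($d=0$ and $I=\{1,\dots,p\}$) or ($d\ge1$, $1\le i_1\le\omega(r_1)$ and $1\le p+\omega(r_1)+\dots+\omega(r_d)+1-i_p\le\omega(r_d)$). A red-packed forest is a list of red-packed trees. -}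

module Defs where

open import Level using (Level; _⊔_) renaming (suc to lsuc)
open import Algebra.Bundles using (CommutativeRing)
open import Data.Nat using (ℕ; zero; suc; _+_; _∸_; _≤_; _<_; _≡ᵇ_) renaming (_⊔_ to _⊔ⁿ_)
open import Data.Nat.Properties using (_≟_)
open import Data.Bool using (Bool; true; false; _∧_; not; if_then_else_)
open import Data.List using (List; []; _∷_; length; map; upTo; take; drop; filterᵇ; foldr; concatMap)
import Data.List.Properties as LP
open import Data.List.Relation.Unary.All using (All)
open import Data.List.Relation.Unary.Linked using (Linked)
open import Data.List.Relation.Unary.Unique.Propositional using (Unique)
open import Data.List.Membership.Propositional using (_∈_)
open import Data.Fin using (Fin)
import Data.Fin as F
open import Data.Product using (Σ; _×_)
open import Relation.Nullary using (¬_; does)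
open import Relation.Binary.PropositionalEquality using (_≡_; _≢_)
open import Function.Bundles using (_⇔_)

record Field (c ℓ : Level) : Set (lsuc (c ⊔ ℓ)) where
  field
    commutativeRing : CommutativeRing c ℓ
  open CommutativeRing commutativeRing public
  field
    0≉1 : ¬ (0# ≈ 1#)
    inverse : ∀ x → ¬ (x ≈ 0#) → Σ Carrier λ y → (x * y) ≈ 1#

Word : Set
Word = List ℕ

maxW : Word → ℕ
maxW = foldr _⊔ⁿ_ 0

IsPW : ℕ → Word → Set
IsPW n w = length w ≡ n × All (λ x → 1 ≤ x) w × (∀ k → 1 ≤ k → k ≤ maxW w → k ∈ w)

anyᵇ allᵇ : (ℕ → Bool) → Word → Bool
anyᵇ p []       = false
anyᵇ p (x ∷ xs) = if p x then true else anyᵇ p xs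
allᵇ p []       = true
allᵇ p (x ∷ xs) = p x ∧ allᵇ p xs

elemᵇ : ℕ → Word → Bool
elemᵇ y w = anyᵇ (λ z → y ≡ᵇ z) w

rank : Word → ℕ → ℕ
rank w x = length (filterᵇ (λ y → elemᵇ y w) (upTo x))

pack : Word → Word
pack w = map (λ x → suc (rank w x)) w

eqWᵇ : Word → Word → Bool
eqWᵇ u v = does (LP.≡-dec _≟_ u v)

disjointᵇ : Word → Word → Bool
disjointᵇ u v = allᵇ (λ x → not (elemᵇ x v)) u

allWords : ℕ → ℕ → List Word
allWords zero    m = [] ∷ []
allWords (suc n) m = concatMap (λ a → map (a ∷_) (allWords n m)) (map suc (upTo m))

cuts : Word → List ℕ
cuts u = map suc (upTo (length u ∸ 1))

cut≺ᵇ : Word → Word → Word → ℕ → Bool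
cut≺ᵇ u a b i = disjointᵇ (take i u) (drop i u) ∧ elemᵇ (maxW u) (take i u)
                ∧ eqWᵇ (pack (take i u)) a ∧ eqWᵇ (pack (drop i u)) b

cut≻ᵇ : Word → Word → Word → ℕ → Bool
cut≻ᵇ u a b i = disjointᵇ (take i u) (drop i u) ∧ not (elemᵇ (maxW u) (take i u))
                ∧ eqWᵇ (pack (take i u)) a ∧ eqWᵇ (pack (drop i u)) b

-- Linear algebra over a field K.  An element of WQSym* (or of
-- WQSym* ⊗ WQSym*) is given by its coordinate function on words (resp.
-- pairs of words) w.r.t. the basis (R_w) (resp. (R_a ⊗ R_b)).

module Lin {c ℓ : Level} (K : Field c ℓ) where
  open Field K renaming (_+_ to _+ᴷ_; _*_ to _*ᴷ_)

  Vect : Set c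
  Vect = Word → Carrier

  sumL : List Carrier → Carrier
  sumL = foldr _+ᴷ_ 0#

  sumFin : ∀ {d} → (Fin d → Carrier) → Carrier
  sumFin {zero}  f = 0#
  sumFin {suc d} f = f F.zero +ᴷ sumFin (λ i → f (F.suc i))

  ind : Bool → Carrier
  ind b = if b then 1# else 0#

  -- coefficient of R_a ⊗ R_b in Δ≺(R_u), resp. Δ≻(R_u)
  coef≺ coef≻ : Word → Word → Word → Carrier
  coef≺ u a b = sumL (map (λ i → ind (cut≺ᵇ u a b i)) (cuts u))
  coef≻ u a b = sumL (map (λ i → ind (cut≻ᵇ u a b i)) (cuts u))

  -- Δ≺ , Δ≻ applied to x ∈ WQSym*_n (sum over all words of length n with
  -- letters ≤ n, a superset of PW_n; x vanishes off PW_n)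
  Δ≺ Δ≻ : ℕ → Vect → Word → Word → Carrier
  Δ≺ n x a b = sumL (map (λ u → x u *ᴷ coef≺ u a b) (allWords n n))
  Δ≻ n x a b = sumL (map (λ u → x u *ᴷ coef≻ u a b) (allWords n n))

  WQ : ℕ → Vect → Set ℓ
  WQ n x = ∀ w → ¬ IsPW n w → x w ≈ 0#

  IsZero : Vect → Set ℓ
  IsZero x = ∀ w → x w ≈ 0#

  Prim : ℕ → Vect → Set ℓ
  Prim zero    x = IsZero x
  Prim (suc m) x = WQ (suc m) x × (∀ a b → (Δ≺ (suc m) x a b +ᴷ Δ≻ (suc m) x a b) ≈ 0#)

  TPrim : ℕ → Vect → Set ℓ
  TPrim zero    x = IsZero x
  TPrim (suc m) x = WQ (suc m) x × (∀ a b → Δ≺ (suc m) x a b ≈ 0#) × (∀ a b → Δ≻ (suc m) x a b ≈ 0#)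

  lincomb : ∀ {d} → (Fin d → Carrier) → (Fin d → Vect) → Vect
  lincomb c v w = sumFin (λ i → c i *ᴷ v i w)

  HasDim : (Vect → Set ℓ) → ℕ → Set (c ⊔ ℓ)
  HasDim P d = Σ (Fin d → Vect) λ v →
      (∀ i → P (v i))
    × (∀ (cs : Fin d → Carrier) → (∀ w → lincomb cs v w ≈ 0#) → ∀ i → cs i ≈ 0#)
    × (∀ x → P x → Σ (Fin d → Carrier) λ cs → ∀ w → x w ≈ lincomb cs v w)

-- Biplane trees labelled by finite sets of positive integers; a set
-- {i1 < … < ip} is represented by the strictly increasing list.

data Tree : Set where
  node : List ℕ → List Tree → List Tree → Tree

Forest : Set
Forest = List Tree

mutual
  weightT : Tree → ℕ
  weightT (node I ls rs) = length I + weightF ls + weightF rs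

  weightF : Forest → ℕ
  weightF []       = 0
  weightF (t ∷ ts) = weightT t + weightF ts

ValidLabel : List ℕ → Set
ValidLabel I = I ≢ [] × Linked _<_ I × All (λ x → 1 ≤ x) I

firstN lastN : List ℕ → ℕ
firstN []      = 0
firstN (x ∷ _) = x
lastN []           = 0
lastN (x ∷ [])     = x
lastN (_ ∷ y ∷ ys) = lastN (y ∷ ys)

lastWeight : Tree → Forest → ℕ
lastWeight r []        = weightT r
lastWeight _ (r ∷ rs)  = lastWeight r rs

RootCond : List ℕ → Forest → Set
RootCond I []       = I ≡ map suc (upTo (length I))
RootCond I (r ∷ rs) =
    (1 ≤ firstN I × firstN I ≤ weightT r)
  × (1 ≤ (length I + weightF (r ∷ rs) + 1) ∸ lastN I
     × (length I + weightF (r ∷ rs) + 1) ∸ lastN I ≤ lastWeight r rs)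

mutual
  RedPackedT : Tree → Set
  RedPackedT (node I ls rs) = ValidLabel I × RedPackedF ls × RedPackedF rs × RootCond I rs

  RedPackedF : Forest → Set
  RedPackedF []       = Data.Unit.⊤
    where import Data.Unit
  RedPackedF (t ∷ ts) = RedPackedT t × RedPackedF ts

EmptyLeft : Tree → Set
EmptyLeft (node _ ls _) = ls ≡ []

HasCard : {A : Set} → (A → Set) → ℕ → Set
HasCard {A} P d = Σ (List A) λ L → Unique L × (∀ x → (x ∈ L) ⇔ P x) × length L ≡ d

{-# OPTIONS --safe #-}
-- Dually, WQSym* carries three products: R_a · R_b is the sum of the words u = p q with p, q on
-- disjoint letters, pack p = a and pack q = b, and it splits as R_a ≺ R_b + R_a ≻ R_b according to
-- whether max u lies in p or in q.  A vector is primitive iff, as a linear form, it kills all products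
-- a · b, and totally primitive iff it kills all a ≺ b and a ≻ b.
--
-- For the number of inversions, the leading word of a · b and of a ≺ b is the word p q with p ≫ q (all
-- letters of p above those of q), and that of a ≻ b is the word p q with p ▹ q (all letters of q except
-- the maximum below those of p).  Call a word irreducible if it has no cut p ≫ q.  Cuts with p
-- irreducible are unique, so the equations for a irreducible (and for b irreducible in the case of ≻)
-- are unitriangular, and the dendriform identities (a ≺ b) ≺ c = a ≺ (b · c), (a ≻ b) ≺ c = a ≻ (b ≺ c),
-- (a · b) ≻ c = a ≻ (b ≻ c) show that they imply all the others.  Hence Prim* has dimension the
-- number of irreducible packed words, and TPrim* that of irreducible words without a cut p ▹ q.
--
-- A forest encodes the factorisation of a word at its ≫-cuts.  In the tree of an irreducible word the
-- left forest lists the factors split off by ▹-cuts; in what remains, the root label records the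
-- positions of the maximum and the right forest encodes the word without its maximum.
module Submission where

open import Defs
open import Level using (Level)
open import Data.Nat using (ℕ)
open import Data.Product using (Σ; _×_)
open import Relation.Binary.PropositionalEquality using (_≡_)

open import Algebra.Properties.Group using (inverseˡ-unique)
open import Data.Bool using (Bool; true; false; if_then_else_; _∧_; not; T)
open import Data.Empty using (⊥; ⊥-elim)
open import Data.Fin using (Fin) renaming (zero to fzero; suc to fsuc)
import Data.Fin.Properties as FinP
open import Data.List using (List; []; _∷_; _++_; length; map; upTo; applyUpTo; filterᵇ; filter; take; drop; lookup)
import Data.List.Properties as LP
open import Data.List.Membership.DecPropositional using (_∈?_)
open import Data.List.Membership.Propositional using (_∈_; _∉_; find; lose)
open import Data.List.Membership.Propositional.Properties using (∈-map⁺; ∈-map⁻; ∈-++⁺ˡ; ∈-++⁺ʳ; ∈-++⁻; ∈-concatMap⁺; ∈-concatMap⁻; ∈-filter⁺; ∈-filter⁻; ∈-upTo⁺; ∈-upTo⁻; ∈-lookup)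
open import Data.List.Relation.Unary.All as All using (All; []; _∷_)
import Data.List.Relation.Unary.All.Properties as AllP
open import Data.List.Relation.Unary.AllPairs as AllPairs using (AllPairs; []; _∷_)
import Data.List.Relation.Unary.AllPairs.Properties as AllPairsP
open import Data.List.Relation.Unary.Any as Any using (here; there)
import Data.List.Relation.Unary.Linked.Properties as Linked
open import Data.List.Relation.Unary.Unique.Propositional using (Unique)
import Data.List.Relation.Unary.Unique.Propositional.Properties as Uniq
open import Data.Maybe using (Maybe; just; nothing)
open import Data.Nat using (zero; suc; _+_; _*_; _∸_; _≤_; _<_; z≤n; s≤s; s≤s⁻¹; _⊔_; _≡ᵇ_)
open import Data.Nat.Induction using (<-rec)
open import Data.Nat.Properties
open import Data.Nat.Solver using (module +-*-Solver)
open import Data.Product using (∃; ∃₂; _,_; proj₁; proj₂; swap)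
open import Data.Sum using (_⊎_; inj₁; inj₂; [_,_]′)
open import Data.Unit using (⊤; tt)
open import Function using (_∘_; id)
open import Function.Bundles using (mk⇔)
open import Relation.Binary.Definitions using (tri<; tri≈; tri>)
open import Relation.Binary.PropositionalEquality using (refl; _≢_; sym; trans; cong; cong₂; subst; subst₂; module ≡-Reasoning)
import Relation.Binary.Reasoning.Setoid
open import Relation.Nullary using (¬_; Dec; yes; no)
open import Relation.Nullary.Decidable using (map′; _×-dec_; _⊎-dec_; ¬?)

-- Membership and maxima

-- Different pairs `a`, `b` can give equations with the same leading word, so one equation has to be
-- chosen for each word. With `pack p` and `pack q` prescribed, the inversions inside p and q are
-- fixed and only those across the cut vary; they are most numerous for p ≫ q. For ≻ the maximum of
-- q lies above all of p and never contributes, whence p ▹ q. A word p q with p ▹ q and q reducible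
-- also has a ≫-cut and already leads a ≺-equation, which is why both arguments are taken
-- irreducible for ≻. All pivots are 1, so substitution parametrises the solutions by the words that
-- lead no chosen equation. To derive the remaining equations, a reducible argument is regarded as
-- the leading word of a product of its two parts. An identity turns the sum over that product into
-- known equations, and induction on inversions isolates the argument. On the side of trees, the
-- root condition bounds the first and the last position of the maximum. A first maximum beyond the
-- first factor of the remaining word would give a ▹-cut, a last maximum before its last factor a
-- ≫-cut.

elemᵇ⇒∈ : ∀ y w → elemᵇ y w ≡ true → y ∈ w
elemᵇ⇒∈ y (z ∷ w) e with y ≡ᵇ z in eq
... | true  = here (≡ᵇ⇒≡ y z (subst T (sym eq) _))
... | false = there (elemᵇ⇒∈ y w e)

∈⇒elemᵇ : ∀ {y w} → y ∈ w → elemᵇ y w ≡ true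
∈⇒elemᵇ {y} {z ∷ w} m with y ≡ᵇ z in eq
... | true = refl
∈⇒elemᵇ {y} {z ∷ w} (here refl) | false = ⊥-elim (subst T eq (≡⇒≡ᵇ y y refl))
∈⇒elemᵇ {y} {z ∷ w} (there m)   | false = ∈⇒elemᵇ m

∉⇒elemᵇ : ∀ {y w} → y ∉ w → elemᵇ y w ≡ false
∉⇒elemᵇ {y} {w} y∉w with elemᵇ y w in eq
... | true  = ⊥-elim (y∉w (elemᵇ⇒∈ y w eq))
... | false = refl

≤maxW : ∀ {x w} → x ∈ w → x ≤ maxW w
≤maxW {w = y ∷ w} (here refl) = m≤m⊔n y (maxW w)
≤maxW {w = y ∷ w} (there m)   = ≤-trans (≤maxW m) (m≤n⊔m y (maxW w))

maxW-lub : ∀ {w b} → (∀ {x} → x ∈ w → x ≤ b) → maxW w ≤ b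
maxW-lub {[]}    h = z≤n
maxW-lub {y ∷ w} h = ⊔-lub (h (here refl)) (maxW-lub {w} (h ∘ there))

maxW∈ : ∀ {w} → w ≢ [] → maxW w ∈ w
maxW∈ {[]}         ne = ⊥-elim (ne refl)
maxW∈ {y ∷ []}     ne rewrite ⊔-identityʳ y = here refl
maxW∈ {y ∷ z ∷ w}  ne = [ here , (λ e → there (subst (_∈ z ∷ w) (sym e) (maxW∈ λ ()))) ]′ (⊔-sel y (maxW (z ∷ w)))

maxW-++ : ∀ p q → maxW (p ++ q) ≡ maxW p ⊔ maxW q
maxW-++ []      q = refl
maxW-++ (x ∷ p) q = trans (cong (x ⊔_) (maxW-++ p q)) (sym (⊔-assoc x (maxW p) (maxW q)))

maxW-<-lub : ∀ {w b} → w ≢ [] → (∀ {x} → x ∈ w → x < b) → maxW w < b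
maxW-<-lub ne h = h (maxW∈ ne)

∈⇒≢[] : ∀ {A : Set} {x : A} {w} → x ∈ w → w ≢ []
∈⇒≢[] (here _) ()
∈⇒≢[] (there _) ()

≢[]⇒∃∈ : ∀ {A : Set} {w : List A} → w ≢ [] → ∃ λ x → x ∈ w
≢[]⇒∃∈ {w = []}    ne = ⊥-elim (ne refl)
≢[]⇒∃∈ {w = x ∷ w} ne = x , here refl

-- Packed words and order isomorphism

δ : ℕ → Word → ℕ
δ x w = if elemᵇ x w then 1 else 0

rank-suc : ∀ w x → rank w (suc x) ≡ rank w x + δ x w
rank-suc w x = begin
  length (filterᵇ f (upTo (suc x)))                ≡⟨ cong (length ∘ filterᵇ f) (sym (LP.upTo-∷ʳ x)) ⟩
  length (filterᵇ f (upTo x ++ x ∷ []))            ≡⟨ cong length (filterᵇ-++ (upTo x)) ⟩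
  length (filterᵇ f (upTo x) ++ filterᵇ f (x ∷ [])) ≡⟨ LP.length-++ (filterᵇ f (upTo x)) ⟩
  rank w x + length (filterᵇ f (x ∷ []))           ≡⟨ cong (rank w x +_) last ⟩
  rank w x + δ x w                                 ∎
  where
  open ≡-Reasoning
  f = λ y → elemᵇ y w
  filterᵇ-++ : ∀ us {vs} → filterᵇ f (us ++ vs) ≡ filterᵇ f us ++ filterᵇ f vs
  filterᵇ-++ []       = refl
  filterᵇ-++ (u ∷ us) with f u
  ... | true  = cong (u ∷_) (filterᵇ-++ us)
  ... | false = filterᵇ-++ us
  last : length (filterᵇ f (x ∷ [])) ≡ δ x w
  last with f x
  ... | true  = refl
  ... | false = refl

rank-suc-∈ : ∀ {w x} → x ∈ w → rank w (suc x) ≡ suc (rank w x)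
rank-suc-∈ {w} {x} m rewrite rank-suc w x | ∈⇒elemᵇ m = +-comm (rank w x) 1

rank-≤-suc : ∀ w x → rank w x ≤ rank w (suc x)
rank-≤-suc w x rewrite rank-suc w x = m≤m+n (rank w x) (δ x w)

rank-mono : ∀ w {x y} → x ≤ y → rank w x ≤ rank w y
rank-mono w {y = zero}  z≤n = z≤n
rank-mono w {y = suc y} x≤1+y with m≤n⇒m<n∨m≡n x≤1+y
... | inj₁ (s≤s x≤y) = ≤-trans (rank-mono w x≤y) (rank-≤-suc w y)
... | inj₂ refl      = ≤-refl

rank-< : ∀ {w x y} → x ∈ w → x < y → rank w x < rank w y
rank-< {w} m x<y = subst (_≤ _) (rank-suc-∈ m) (rank-mono w x<y)

rank-surj : ∀ w x {j} → j < rank w x → ∃ λ y → y ∈ w × rank w y ≡ j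
rank-surj w (suc x) {j} j< with j <? rank w x
... | yes j<′ = rank-surj w x j<′
... | no  j≮ with elemᵇ x w in eq | subst (j <_) (rank-suc w x) j<
...   | true  | h = x , elemᵇ⇒∈ x w eq , ≤-antisym (≮⇒≥ j≮) (s≤s⁻¹ (subst (j <_) (+-comm (rank w x) 1) h))
...   | false | h = ⊥-elim (j≮ (subst (j <_) (+-identityʳ (rank w x)) h))

-- Downward closure at each letter replaces the bound `maxW w` of `IsPW`, so that it can be used at
-- any letter; `packed⇔IsPW` relates the two forms.
Packed : Word → Set
Packed w = ∀ {x} → x ∈ w → 1 ≤ x × (∀ {k} → 1 ≤ k → k ≤ x → k ∈ w)

pack-packed : ∀ w → Packed (pack w)
pack-packed w m with ∈-map⁻ (λ x → suc (rank w x)) m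
... | x , x∈w , refl = s≤s z≤n , below
  where
  below : ∀ {k} → 1 ≤ k → k ≤ suc (rank w x) → k ∈ pack w
  below {suc k} _ (s≤s k≤) with m≤n⇒m<n∨m≡n k≤
  ... | inj₂ refl = ∈-map⁺ (λ x → suc (rank w x)) x∈w
  ... | inj₁ k< with rank-surj w x k<
  ...   | y , y∈w , refl = ∈-map⁺ (λ x → suc (rank w x)) y∈w

-- Two words are stored as the list of their letter pairs: their lengths agree by construction, and
-- splitting the list splits both words at the same place.
Letters² : Set
Letters² = List (ℕ × ℕ)

src tgt : Letters² → Word
src = map proj₁
tgt = map proj₂

-- Sim zs says that the two words src zs and tgt zs are order isomorphic.
Sim : Letters² → Set
Sim zs = ∀ {z z′} → z ∈ zs → z′ ∈ zs →
  (proj₁ z < proj₁ z′ → proj₂ z < proj₂ z′) × (proj₂ z < proj₂ z′ → proj₁ z < proj₁ z′)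

∈-src⁻ : ∀ {zs x} → x ∈ src zs → ∃ λ y → (x , y) ∈ zs
∈-src⁻ m with ∈-map⁻ proj₁ m
... | (x , y) , m′ , refl = y , m′

∈-tgt⁻ : ∀ {zs y} → y ∈ tgt zs → ∃ λ x → (x , y) ∈ zs
∈-tgt⁻ m with ∈-map⁻ proj₂ m
... | (x , y) , m′ , refl = x , m′

-- Strong induction on the source letter. If x < y for a pair (x , y), then x also occurs in the
-- target; its partner is smaller than x, hence equal to x by induction, which is absurd. The case y
-- < x is symmetric.
sim-packed⇒≡ : ∀ zs → Sim zs → Packed (src zs) → Packed (tgt zs) → src zs ≡ tgt zs
sim-packed⇒≡ zs S P Q = LP.map-cong-local (All.tabulate λ m → same _ m)
  where
  Same : ℕ → Set
  Same x = ∀ {y} → (x , y) ∈ zs → x ≡ y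
  same : ∀ x → Same x
  same = <-rec Same step
    where
    step : ∀ x → (∀ {x′} → x′ < x → Same x′) → Same x
    step x rec {y} m with <-cmp x y
    ... | tri≈ _ e _ = e
    ... | tri< x<y _ _ with ∈-tgt⁻ (proj₂ (Q (∈-map⁺ proj₂ m)) (proj₁ (P (∈-map⁺ proj₁ m))) (<⇒≤ x<y))
    ...   | x′ , m′ = ⊥-elim (<⇒≢ x′<x (rec x′<x m′))
      where x′<x = proj₂ (S m′ m) x<y
    step x rec {y} m | tri> _ _ y<x with ∈-src⁻ (proj₂ (P (∈-map⁺ proj₁ m)) (proj₁ (Q (∈-map⁺ proj₂ m))) (<⇒≤ y<x))
    ...   | y′ , m′ = ⊥-elim (<⇒≢ (proj₁ (S m′ m) y<x) (sym (rec y<x m′)))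

StrictMonoOn : Word → (ℕ → ℕ) → Set
StrictMonoOn w f = ∀ {x y} → x ∈ w → y ∈ w → x < y → f x < f y

mono-reflects : ∀ {w f} → StrictMonoOn w f → ∀ {x y} → x ∈ w → y ∈ w → f x < f y → x < y
mono-reflects {f = f} mono {x} {y} mx my h with <-cmp x y
... | tri< l _ _    = l
... | tri≈ _ refl _ = ⊥-elim (<-irrefl refl h)
... | tri> _ _ g    = ⊥-elim (<-asym h (mono my mx g))

packLetter-mono : ∀ w → StrictMonoOn w (λ x → suc (rank w x))
packLetter-mono w mx _ x<y = s≤s (rank-< mx x<y)

graph : (ℕ → ℕ) → Word → Letters²
graph f = map (λ x → x , f x)

src-graph : ∀ f w → src (graph f w) ≡ w
src-graph f w = trans (sym (LP.map-∘ w)) (LP.map-id w)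

tgt-graph : ∀ f w → tgt (graph f w) ≡ map f w
tgt-graph f w = sym (LP.map-∘ w)

graph-sim : ∀ {f w} → StrictMonoOn w f → Sim (graph f w)
graph-sim {f} mono m m′ with ∈-map⁻ (λ x → x , f x) m | ∈-map⁻ (λ x → x , f x) m′
... | x , mx , refl | y , my , refl = mono mx my , mono-reflects mono mx my

packed⇒pack≡ : ∀ {w} → Packed w → pack w ≡ w
packed⇒pack≡ {w} P = sym (trans (sym (src-graph r w)) (trans
    (sim-packed⇒≡ (graph r w) (graph-sim {r} {w} (packLetter-mono w))
      (subst Packed (sym (src-graph r w)) P)
      (subst Packed (sym (tgt-graph r w)) (pack-packed w)))
    (tgt-graph r w)))
  where r = λ x → suc (rank w x)

pack≡⇒packed : ∀ {w} → pack w ≡ w → Packed w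
pack≡⇒packed {w} e = subst Packed e (pack-packed w)

Sim-swap : ∀ {zs} → Sim zs → Sim (map swap zs)
Sim-swap S m m′ with ∈-map⁻ swap m | ∈-map⁻ swap m′
... | _ , n , refl | _ , n′ , refl = swap (S n n′)

src-swap : ∀ zs → src (map swap zs) ≡ tgt zs
src-swap zs = sym (LP.map-∘ zs)

tgt-swap : ∀ zs → tgt (map swap zs) ≡ src zs
tgt-swap zs = sym (LP.map-∘ zs)

-- Packing both components of every pair keeps the order isomorphism and makes both words packed, so
-- `sim-packed⇒≡` applies.
sim⇒pack≡ : ∀ zs → Sim zs → pack (src zs) ≡ pack (tgt zs)
sim⇒pack≡ zs S = trans (sym src≡) (trans (sim-packed⇒≡ zs′ S′ P Q) tgt≡)
  where
  r = λ x → suc (rank (src zs) x)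
  r′ = λ x → suc (rank (tgt zs) x)
  g : ℕ × ℕ → ℕ × ℕ
  g (x , y) = r x , r′ y
  zs′ = map g zs
  src≡ : src zs′ ≡ pack (src zs)
  src≡ = trans (sym (LP.map-∘ zs)) (LP.map-∘ zs)
  tgt≡ : tgt zs′ ≡ pack (tgt zs)
  tgt≡ = trans (sym (LP.map-∘ zs)) (LP.map-∘ zs)
  P = subst Packed (sym src≡) (pack-packed (src zs))
  Q = subst Packed (sym tgt≡) (pack-packed (tgt zs))
  S′ : Sim zs′
  S′ m m′ with ∈-map⁻ g m | ∈-map⁻ g m′
  ... | (x , y) , n , refl | (x₁ , y₁) , n₁ , refl =
    (λ h → packLetter-mono (tgt zs) (b n) (b n₁) (proj₁ (S n n₁) (mono-reflects (packLetter-mono (src zs)) (a n) (a n₁) h))) ,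
    (λ h → packLetter-mono (src zs) (a n) (a n₁) (proj₂ (S n n₁) (mono-reflects (packLetter-mono (tgt zs)) (b n) (b n₁) h)))
    where
    a : ∀ {z} → z ∈ zs → proj₁ z ∈ src zs
    a = ∈-map⁺ proj₁
    b : ∀ {z} → z ∈ zs → proj₂ z ∈ tgt zs
    b = ∈-map⁺ proj₂

map≡⇒zip : ∀ (f g : ℕ → ℕ) u v → map f u ≡ map g v →
  ∃ λ zs → src zs ≡ u × tgt zs ≡ v × (∀ {z} → z ∈ zs → f (proj₁ z) ≡ g (proj₂ z))
map≡⇒zip f g []      []      e = [] , refl , refl , λ ()
map≡⇒zip f g (x ∷ u) (y ∷ v) e with LP.∷-injective e
... | e₁ , e₂ with map≡⇒zip f g u v e₂
...   | zs , refl , refl , h = (x , y) ∷ zs , refl , refl , λ { (here refl) → e₁ ; (there m) → h m }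

pack≡⇒sim : ∀ u v → pack u ≡ pack v → ∃ λ zs → src zs ≡ u × tgt zs ≡ v × Sim zs
pack≡⇒sim u v e with map≡⇒zip (λ x → suc (rank u x)) (λ x → suc (rank v x)) u v e
... | zs , refl , refl , h = zs , refl , refl , λ {z} {z′} m m′ →
  (λ l → mono-reflects (packLetter-mono (tgt zs)) (∈-map⁺ proj₂ m) (∈-map⁺ proj₂ m′)
           (subst₂ _<_ (h m) (h m′) (packLetter-mono (src zs) (∈-map⁺ proj₁ m) (∈-map⁺ proj₁ m′) l))) ,
  (λ l → mono-reflects (packLetter-mono (src zs)) (∈-map⁺ proj₁ m) (∈-map⁺ proj₁ m′)
           (subst₂ _<_ (sym (h m)) (sym (h m′)) (packLetter-mono (tgt zs) (∈-map⁺ proj₂ m) (∈-map⁺ proj₂ m′) l)))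

pack-map : ∀ {f w} → StrictMonoOn w f → pack (map f w) ≡ pack w
pack-map {f} {w} mono = sym (subst₂ (λ a b → pack a ≡ pack b) (src-graph f w) (tgt-graph f w)
  (sim⇒pack≡ (graph f w) (graph-sim {f} {w} mono)))

length-pack : ∀ w → length (pack w) ≡ length w
length-pack w = LP.length-map _ w

pack≡⇒length≡ : ∀ {u v} → pack u ≡ pack v → length u ≡ length v
pack≡⇒length≡ {u} {v} e = trans (sym (length-pack u)) (trans (cong length e) (length-pack v))

-- The second part strengthens the induction: up to y the new letter has not been counted, so there
-- is room for it in the step at y.
rank-∷ : ∀ y w x → rank (y ∷ w) x ≤ suc (rank w x) × (x ≤ y → rank (y ∷ w) x ≤ rank w x)
rank-∷ y w zero = z≤n , λ _ → z≤n
rank-∷ y w (suc x) rewrite rank-suc (y ∷ w) x | rank-suc w x with rank-∷ y w x | x ≡ᵇ y in eq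
... | h₁ , h₂ | false = +-monoˡ-≤ (δ x w) h₁ , λ x<y → +-monoˡ-≤ (δ x w) (h₂ (<⇒≤ x<y))
... | h₁ , h₂ | true with ≡ᵇ⇒≡ x y (subst T (sym eq) _)
...   | refl = subst (_≤ suc (rank w x + δ x w)) (+-comm 1 (rank (x ∷ w) x)) (s≤s (≤-trans (h₂ ≤-refl) (m≤m+n (rank w x) (δ x w))))
             , λ x<x → ⊥-elim (<-irrefl refl x<x)

rank-≤-length : ∀ w x → rank w x ≤ length w
rank-≤-length []      zero    = z≤n
rank-≤-length []      (suc x) = subst (_≤ 0) (sym (rank-suc [] x)) (subst (_≤ 0) (sym (+-identityʳ _)) (rank-≤-length [] x))
rank-≤-length (y ∷ w) x       = ≤-trans (proj₁ (rank-∷ y w x)) (s≤s (rank-≤-length w x))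

-- This is why `allWords n n` contains all packed words of length n.
packed-≤-length : ∀ {w x} → Packed w → x ∈ w → x ≤ length w
packed-≤-length {w} {x} P m with ∈-map⁻ (λ x → suc (rank w x)) (subst (x ∈_) (sym (packed⇒pack≡ P)) m)
... | y , my , refl = subst (_≤ length w) (rank-suc-∈ my) (rank-≤-length w (suc y))

packed⇔IsPW : ∀ {w} → (Packed w → IsPW (length w) w) × (∀ {n} → IsPW n w → Packed w)
packed⇔IsPW {w} = to , from
  where
  to : Packed w → IsPW (length w) w
  to P = refl , All.tabulate (proj₁ ∘ P) , λ k 1≤k k≤ → proj₂ (P (maxW∈ (ne 1≤k k≤))) 1≤k k≤
    where
    ne : ∀ {k} → 1 ≤ k → k ≤ maxW w → w ≢ []
    ne l l′ refl with ≤-trans l l′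
    ... | ()
  from : ∀ {n} → IsPW n w → Packed w
  from (_ , ps , h) m = All.lookup ps m , λ 1≤k k≤x → h _ 1≤k (≤-trans k≤x (≤maxW m))

-- Cutting words in two

WordRel : Set₁
WordRel = Word → Word → Set

infix 4 _≫_
_≫_ : WordRel
p ≫ q = ∀ {x y} → x ∈ p → y ∈ q → y < x

-- p ▹ q holds when max (p q) lies in q and all other letters of q are below those of p.
infix 4 _▹_
_▹_ : WordRel
p ▹ q = maxW p < maxW q × (∀ {x y} → x ∈ p → y ∈ q → y ≡ maxW q ⊎ y < x)

Cut : WordRel → Word → Set
Cut R w = ∃₂ λ p q → w ≡ p ++ q × p ≢ [] × q ≢ [] × R p q

Irr : Word → Set
Irr w = w ≢ [] × ¬ Cut _≫_ w

-- Levi's lemma for the free monoid.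
++-overlap : ∀ {A : Set} (p q p′ q′ : List A) → p ++ q ≡ p′ ++ q′ →
  (∃ λ r → p′ ≡ p ++ r × q ≡ r ++ q′) ⊎ (∃ λ r → p ≡ p′ ++ r × q′ ≡ r ++ q)
++-overlap []      q p′       q′ e = inj₁ (p′ , refl , e)
++-overlap (x ∷ p) q []       q′ e = inj₂ (x ∷ p , refl , sym e)
++-overlap (x ∷ p) q (y ∷ p′) q′ e with LP.∷-injective e
... | refl , e′ with ++-overlap p q p′ q′ e′
...   | inj₁ (r , refl , e₂) = inj₁ (r , refl , e₂)
...   | inj₂ (r , refl , e₂) = inj₂ (r , refl , e₂)

++-cancel-length : ∀ {A : Set} (p q p′ q′ : List A) → p ++ q ≡ p′ ++ q′ → length p ≡ length p′ → p ≡ p′ × q ≡ q′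
++-cancel-length []      q []       q′ e l = refl , e
++-cancel-length (x ∷ p) q (y ∷ p′) q′ e l with LP.∷-injective e
... | refl , e′ with ++-cancel-length p q p′ q′ e′ (suc-injective l)
...   | refl , e″ = refl , e″

[]? : ∀ {A : Set} (w : List A) → Dec (w ≡ [])
[]? []      = yes refl
[]? (_ ∷ _) = no λ ()

++≢[]ˡ : ∀ {A : Set} {p q : List A} → p ≢ [] → p ++ q ≢ []
++≢[]ˡ {p = []}    ne = ⊥-elim (ne refl)
++≢[]ˡ {p = _ ∷ _} ne = λ ()

++≢[]ʳ : ∀ {A : Set} (p : List A) {q} → q ≢ [] → p ++ q ≢ []
++≢[]ʳ []      ne = ne
++≢[]ʳ (_ ∷ _) ne = λ ()

0<length : ∀ {A : Set} {w : List A} → w ≢ [] → 0 < length w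
0<length {w = []}    ne = ⊥-elim (ne refl)
0<length {w = _ ∷ _} ne = s≤s z≤n

-- The relation varies in the recursion: the first letter is absorbed into `R`, so that the later
-- cuts become cuts of the tail.
cut? : ∀ {R : WordRel} → (∀ p q → Dec (R p q)) → ∀ w → Dec (Cut R w)
cut? R? [] = no λ { ([] , _ , _ , ne , _) → ne refl ; (_ ∷ _ , _ , () , _) }
cut? {R} R? (x ∷ w) with []? w
... | yes refl = no λ { ([] , _ , _ , ne , _) → ne refl
                      ; (_ ∷ [] , [] , _ , _ , ne , _) → ne refl
                      ; (_ ∷ [] , _ ∷ _ , () , _)
                      ; (_ ∷ _ ∷ _ , _ , () , _) }
... | no w≢[] = map′ to from (R? (x ∷ []) w ⊎-dec cut? {λ p q → R (x ∷ p) q} (λ p → R? (x ∷ p)) w)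
  where
  to : R (x ∷ []) w ⊎ Cut (λ p q → R (x ∷ p) q) w → Cut R (x ∷ w)
  to (inj₁ r) = x ∷ [] , w , refl , (λ ()) , w≢[] , r
  to (inj₂ (p , q , refl , _ , q≢[] , r)) = x ∷ p , q , refl , (λ ()) , q≢[] , r
  from : Cut R (x ∷ w) → R (x ∷ []) w ⊎ Cut (λ p q → R (x ∷ p) q) w
  from ([] , _ , _ , ne , _) = ⊥-elim (ne refl)
  from (_ ∷ [] , q , refl , _ , _ , r) = inj₁ r
  from (_ ∷ p₁ ∷ p , q , refl , _ , q≢[] , r) = inj₂ (p₁ ∷ p , q , refl , (λ ()) , q≢[] , r)

_≫?_ : ∀ p q → Dec (p ≫ q)
p ≫? q = map′ (λ h {x} {y} mx my → All.lookup (All.lookup h mx) my)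
              (λ h → All.tabulate λ mx → All.tabulate λ my → h mx my)
              (All.all? (λ x → All.all? (_<? x) q) p)

_▹?_ : ∀ p q → Dec (p ▹ q)
p ▹? q = (maxW p <? maxW q) ×-dec
  map′ (λ h {x} {y} mx my → All.lookup (All.lookup h mx) my)
       (λ h → All.tabulate λ mx → All.tabulate λ my → h mx my)
       (All.all? (λ x → All.all? (λ y → (y ≟ maxW q) ⊎-dec (y <? x)) q) p)

-- Cutting the left part again and again ends at an irreducible prefix, and everything split off
-- stays below it.
firstIrr : ∀ w → w ≢ [] → ∃₂ λ p q → w ≡ p ++ q × Irr p × p ≫ q
firstIrr w = go (length w) w ≤-refl
  where
  go : ∀ n w → length w ≤ n → w ≢ [] → ∃₂ λ p q → w ≡ p ++ q × Irr p × p ≫ q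
  go zero    []      l ne = ⊥-elim (ne refl)
  go (suc n) w       l ne with cut? _≫?_ w
  ... | no ¬c = w , [] , sym (LP.++-identityʳ w) , (ne , ¬c) , λ _ ()
  ... | yes (p , q , refl , p≢[] , q≢[] , p≫q)
      with go n p (s≤s⁻¹ (≤-trans (subst (length p <_) (sym (LP.length-++ p)) (m<m+n (length p) (0<length q≢[]))) l)) p≢[]
  ...   | p₁ , p₂ , refl , irr , p₁≫p₂ = p₁ , p₂ ++ q , LP.++-assoc p₁ p₂ q , irr ,
            λ {x} {y} mx my → [ p₁≫p₂ mx , p≫q (∈-++⁺ˡ mx) ]′ (∈-++⁻ p₂ my)

-- What ≫ and ▹ have in common: `restrict` yields a cut with irreducible left part from any cut,
-- `separate` yields its uniqueness.
record CutRel (R : WordRel) : Set where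
  field
    restrict : ∀ {p₁ p₂ q} → R (p₁ ++ p₂) q → p₁ ≫ p₂ → R p₁ (p₂ ++ q)
    separate : ∀ {p r q} → R p (r ++ q) → R (p ++ r) q → p ≫ r

open CutRel

≫-cutRel : CutRel _≫_
restrict ≫-cutRel {p₂ = p₂} h h′ mx my = [ h′ mx , h (∈-++⁺ˡ mx) ]′ (∈-++⁻ p₂ my)
separate ≫-cutRel h _ mx my = h mx (∈-++⁺ˡ my)

▹-cutRel : CutRel _▹_
restrict ▹-cutRel {p₁} {p₂} {q} (l , h) p₁≫p₂ = subst (maxW p₁ <_) (sym e) (m⊔n<o⇒m<o (maxW p₁) (maxW p₂) l′) ,
  λ {x} {y} mx my → [ inj₂ ∘ p₁≫p₂ mx , (λ m → [ (λ eq → inj₁ (trans eq (sym e))) , inj₂ ]′ (h (∈-++⁺ˡ mx) m)) ]′ (∈-++⁻ p₂ my)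
  where
  l′ = subst (_< maxW q) (maxW-++ p₁ p₂) l
  e : maxW (p₂ ++ q) ≡ maxW q
  e = trans (maxW-++ p₂ q) (m≤n⇒m⊔n≡n (<⇒≤ (m⊔n<o⇒n<o (maxW p₁) (maxW p₂) l′)))
-- The second cut puts the letters of r below the maximum of q, so none of them is the exceptional
-- maximum of the first cut.
separate ▹-cutRel {p} {r} {q} (_ , h) (l , _) {y = y} mx my = [ (λ e → ⊥-elim (<⇒≢ lt e)) , id ]′ (h mx (∈-++⁺ˡ my))
  where
  lt : y < maxW (r ++ q)
  lt = <-≤-trans (≤-<-trans (≤maxW (∈-++⁺ʳ p my)) l) (subst (maxW q ≤_) (sym (maxW-++ r q)) (m≤n⊔m (maxW r) (maxW q)))

cut⇒irrCut : ∀ {R w} → CutRel R → Cut R w → Cut (λ p q → R p q × Irr p) w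
cut⇒irrCut C (p , q , refl , p≢[] , q≢[] , r) with firstIrr p p≢[]
... | p₁ , p₂ , refl , irr , p₁≫p₂ = p₁ , p₂ ++ q , LP.++-assoc p₁ p₂ q , proj₁ irr , ++≢[]ʳ p₂ q≢[] , restrict C r p₁≫p₂ , irr

-- If one left part properly extended the other, `separate` would give it a ≫-cut.
irrCut-unique : ∀ {R} → CutRel R → ∀ {p q p′ q′} → p ++ q ≡ p′ ++ q′ → Irr p → Irr p′ → R p q → R p′ q′ → p ≡ p′ × q ≡ q′
irrCut-unique C {p} {q} {p′} {q′} e irr irr′ r r′ with ++-overlap p q p′ q′ e
... | inj₁ ([] , refl , refl) = sym (LP.++-identityʳ p) , refl
... | inj₁ (x ∷ s , refl , refl) = ⊥-elim (proj₂ irr′ (p , x ∷ s , refl , proj₁ irr , (λ ()) , separate C r r′))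
... | inj₂ ([] , refl , refl) = LP.++-identityʳ p′ , refl
... | inj₂ (x ∷ s , refl , refl) = ⊥-elim (proj₂ irr (p′ , x ∷ s , refl , proj₁ irr′ , (λ ()) , separate C r′ r))

-- Relations between the two parts of a cut, up to order isomorphism

-- The isomorphism is joint, so comparisons across the cut are preserved; equal packings of the two
-- parts alone would not ensure this.
Iso : Word → Word → Word → Word → Set
Iso p q p′ q′ = ∃₂ λ ps qs → (src ps ≡ p × src qs ≡ q) × (tgt ps ≡ p′ × tgt qs ≡ q′) × Sim (ps ++ qs)

-- An empty left part has maximum 0, which an order isomorphism need not keep below the letters on
-- the right; hence the nonemptiness assumptions.
Invariant : WordRel → Set
Invariant R = ∀ {p q p′ q′} → Iso p q p′ q′ → p ≢ [] → q ≢ [] → R p q → R p′ q′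

map-++⁻ : ∀ {A B : Set} (f : A → B) zs {p q} → map f zs ≡ p ++ q → ∃₂ λ ps qs → zs ≡ ps ++ qs × map f ps ≡ p × map f qs ≡ q
map-++⁻ f zs       {[]}    e = [] , zs , refl , refl , e
map-++⁻ f (z ∷ zs) {x ∷ p} e with LP.∷-injective e
... | refl , e′ with map-++⁻ f zs {p} {_} e′
...   | ps , qs , refl , refl , e″ = z ∷ ps , qs , refl , refl , e″

splitIso : ∀ p q {v} → pack (p ++ q) ≡ pack v → ∃₂ λ p′ q′ → v ≡ p′ ++ q′ × Iso p q p′ q′
splitIso p q {v} e with pack≡⇒sim (p ++ q) v e
... | zs , s , refl , S with map-++⁻ proj₁ zs {p} {q} s
...   | ps , qs , refl , refl , refl = tgt ps , tgt qs , LP.map-++ proj₂ ps qs , ps , qs , (refl , refl) , (refl , refl) , S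

Iso-packˡ : ∀ {p q p′ q′} → Iso p q p′ q′ → pack p ≡ pack p′
Iso-packˡ (ps , qs , (refl , refl) , (refl , refl) , S) = sim⇒pack≡ ps λ m m′ → S (∈-++⁺ˡ m) (∈-++⁺ˡ m′)

Iso-packʳ : ∀ {p q p′ q′} → Iso p q p′ q′ → pack q ≡ pack q′
Iso-packʳ (ps , qs , (refl , refl) , (refl , refl) , S) = sim⇒pack≡ qs λ m m′ → S (∈-++⁺ʳ ps m) (∈-++⁺ʳ ps m′)

pack≡[]⁻ : ∀ {p p′} → pack p ≡ pack p′ → p ≢ [] → p′ ≢ []
pack≡[]⁻ {[]}    e ne = λ _ → ne refl
pack≡[]⁻ {_ ∷ _} e ne refl with () ← e

≫-invariant : Invariant _≫_
≫-invariant (ps , qs , (refl , refl) , (refl , refl) , S) _ _ h mx my with ∈-tgt⁻ mx | ∈-tgt⁻ my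
... | x , m | y , m′ = proj₁ (S (∈-++⁺ʳ ps m′) (∈-++⁺ˡ m)) (h (∈-map⁺ proj₁ m) (∈-map⁺ proj₁ m′))

sim-maxW : ∀ {zs z} → Sim zs → z ∈ zs → proj₁ z ≡ maxW (src zs) → proj₂ z ≡ maxW (tgt zs)
sim-maxW {zs} {z} S m e = ≤-antisym (≤maxW (∈-map⁺ proj₂ m)) (maxW-lub {tgt zs} bound)
  where
  bound : ∀ {y} → y ∈ tgt zs → y ≤ proj₂ z
  bound my with ∈-tgt⁻ my
  ... | x′ , m′ = ≮⇒≥ λ l → <-irrefl refl (<-≤-trans (subst (_< x′) e (proj₂ (S m m′) l)) (≤maxW (∈-map⁺ proj₁ m′)))

Max< : WordRel
Max< p q = maxW p < maxW q

Max<-invariant : Invariant Max<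
Max<-invariant (ps , qs , (refl , refl) , (refl , refl) , S) ne _ l with ∈-src⁻ {qs} (maxW∈ (λ e → <⇒≱ l (subst (λ w → maxW w ≤ maxW (src ps)) (sym e) z≤n)))
... | y′ , m = maxW-<-lub (λ e → ne (src≡[] ps e)) below
  where
  src≡[] : ∀ zs → tgt zs ≡ [] → src zs ≡ []
  src≡[] [] _ = refl
  below : ∀ {x} → x ∈ tgt ps → x < maxW (tgt qs)
  below mx with ∈-tgt⁻ mx
  ... | x , m′ = <-≤-trans (proj₁ (S (∈-++⁺ˡ m′) (∈-++⁺ʳ ps m)) (≤-<-trans (≤maxW (∈-map⁺ proj₁ m′)) l)) (≤maxW (∈-map⁺ proj₂ m))

▹-invariant : Invariant _▹_
▹-invariant i@(ps , qs , (refl , refl) , (refl , refl) , S) p≢[] q≢[] (l , h) = Max<-invariant i p≢[] q≢[] l , h′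
  where
  h′ : ∀ {x y} → x ∈ tgt ps → y ∈ tgt qs → y ≡ maxW (tgt qs) ⊎ y < x
  h′ mx my with ∈-tgt⁻ mx | ∈-tgt⁻ my
  ... | x , m | y , m′ with h (∈-map⁺ proj₁ m) (∈-map⁺ proj₁ m′)
  ...   | inj₁ e = inj₁ (sim-maxW (λ n n′ → S (∈-++⁺ʳ ps n) (∈-++⁺ʳ ps n′)) m′ e)
  ...   | inj₂ l = inj₂ (proj₁ (S (∈-++⁺ʳ ps m′) (∈-++⁺ˡ m)) l)

Disj : WordRel
Disj p q = ∀ {x} → x ∈ p → x ∈ q → ⊥

Disj-invariant : Invariant Disj
Disj-invariant (ps , qs , (refl , refl) , (refl , refl) , S) _ _ d mx my with ∈-tgt⁻ mx | ∈-tgt⁻ my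
... | x , m | y , m′ with <-cmp x y
...   | tri< l _ _ = <-irrefl refl (proj₁ (S (∈-++⁺ˡ m) (∈-++⁺ʳ ps m′)) l)
...   | tri≈ _ refl _ = d (∈-map⁺ proj₁ m) (∈-map⁺ proj₁ m′)
...   | tri> _ _ l = <-irrefl refl (proj₁ (S (∈-++⁺ʳ ps m′) (∈-++⁺ˡ m)) l)

Cut-pack≡ : ∀ {R u v} → Invariant R → pack u ≡ pack v → Cut R u → Cut R v
Cut-pack≡ I e (p , q , refl , p≢[] , q≢[] , r) with splitIso p q e
... | p′ , q′ , refl , i = p′ , q′ , refl , pack≡[]⁻ (Iso-packˡ i) p≢[] , pack≡[]⁻ (Iso-packʳ i) q≢[] , I i p≢[] q≢[] r

Irr-pack≡ : ∀ {u v} → pack u ≡ pack v → Irr u → Irr v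
Irr-pack≡ e (ne , ¬c) = pack≡[]⁻ e ne , ¬c ∘ Cut-pack≡ ≫-invariant (sym e)

pack-idem : ∀ w → pack (pack w) ≡ pack w
pack-idem w = packed⇒pack≡ (pack-packed w)

Irr-pack : ∀ {w} → Irr w → Irr (pack w)
Irr-pack {w} = Irr-pack≡ (sym (pack-idem w))

-- Inversions

lt : ℕ → ℕ → ℕ
lt y x with y <? x
... | yes _ = 1
... | no _  = 0

cnt : ℕ → Word → ℕ
cnt x []      = 0
cnt x (y ∷ q) = lt y x + cnt x q

inv : Word → ℕ
inv []      = 0
inv (x ∷ w) = cnt x w + inv w

cross : Word → Word → ℕ
cross []      q = 0
cross (x ∷ p) q = cnt x q + cross p q

lt-mono : ∀ {y x y′ x′} → (y < x → y′ < x′) → lt y x ≤ lt y′ x′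
lt-mono {y} {x} {y′} {x′} h with y <? x | y′ <? x′
... | no _  | _      = z≤n
... | yes _ | yes _  = ≤-refl
... | yes l | no ¬l  = ⊥-elim (¬l (h l))

lt-≥⇒ : ∀ {y x y′ x′} → lt y′ x′ ≤ lt y x → y′ < x′ → y < x
lt-≥⇒ {y} {x} {y′} {x′} h l with y <? x | y′ <? x′ | h
... | yes m | _ | _ = m
... | no _ | yes _ | ()
... | no _ | no ¬l | _ = ⊥-elim (¬l l)

cnt-++ : ∀ x p q → cnt x (p ++ q) ≡ cnt x p + cnt x q
cnt-++ x []      q = refl
cnt-++ x (y ∷ p) q = trans (cong (lt y x +_) (cnt-++ x p q)) (sym (+-assoc (lt y x) _ _))

inv-++ : ∀ p q → inv (p ++ q) ≡ inv p + inv q + cross p q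
inv-++ []      q = sym (+-identityʳ _)
inv-++ (x ∷ p) q = begin
  cnt x (p ++ q) + inv (p ++ q)                         ≡⟨ cong₂ _+_ (cnt-++ x p q) (inv-++ p q) ⟩
  (cnt x p + cnt x q) + (inv p + inv q + cross p q)     ≡⟨ solve 5 (λ a b c d e → (a :+ b) :+ (c :+ d :+ e) := (a :+ c) :+ d :+ (b :+ e)) refl (cnt x p) (cnt x q) (inv p) (inv q) (cross p q) ⟩
  (cnt x p + inv p) + inv q + (cnt x q + cross p q)     ∎
  where
  open ≡-Reasoning
  open +-*-Solver

cnt-sim : ∀ zs {x x′} → (∀ {z} → z ∈ zs → (proj₁ z < x → proj₂ z < x′) × (proj₂ z < x′ → proj₁ z < x)) → cnt x (src zs) ≡ cnt x′ (tgt zs)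
cnt-sim []       h = refl
cnt-sim (z ∷ zs) h = cong₂ _+_ (≤-antisym (lt-mono (proj₁ (h (here refl)))) (lt-mono (proj₂ (h (here refl))))) (cnt-sim zs (h ∘ there))

inv-sim : ∀ zs → Sim zs → inv (src zs) ≡ inv (tgt zs)
inv-sim []       S = refl
inv-sim (z ∷ zs) S = cong₂ _+_ (cnt-sim zs λ m → S (there m) (here refl)) (inv-sim zs λ m m′ → S (there m) (there m′))

cnt-mono : ∀ q {x x′} → (∀ {y} → y ∈ q → y < x → y < x′) → cnt x q ≤ cnt x′ q
cnt-mono []      h = z≤n
cnt-mono (y ∷ q) h = +-mono-≤ (lt-mono (h (here refl))) (cnt-mono q (h ∘ there))

≤-+-≡⇒≡ : ∀ a a′ b b′ → a ≤ a′ → b ≤ b′ → a + b ≡ a′ + b′ → a ≡ a′ × b ≡ b′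
≤-+-≡⇒≡ a a′ b b′ l l′ e with m≤n⇒m<n∨m≡n l
... | inj₁ l″   = ⊥-elim (<⇒≢ (+-mono-<-≤ l″ l′) e)
... | inj₂ refl = refl , +-cancelˡ-≡ a b b′ e

cnt-≡⇒ : ∀ q {x x′} → (∀ {y} → y ∈ q → y < x → y < x′) → cnt x q ≡ cnt x′ q → ∀ {y} → y ∈ q → y < x′ → y < x
cnt-≡⇒ (y ∷ q) {x} {x′} h e m with ≤-+-≡⇒≡ (lt y x) (lt y x′) (cnt x q) (cnt x′ q) (lt-mono (h (here refl))) (cnt-mono q (h ∘ there)) e
cnt-≡⇒ (y ∷ q) h e (here refl) | e₁ , e₂ = lt-≥⇒ (≤-reflexive (sym e₁))
cnt-≡⇒ (y ∷ q) h e (there m)   | e₁ , e₂ = cnt-≡⇒ q (h ∘ there) e₂ m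

cross-const : ∀ p q {b} → (∀ {x} → x ∈ p → cnt x q ≡ b) → cross p q ≡ length p * b
cross-const []      q h = refl
cross-const (x ∷ p) q h = cong₂ _+_ (h (here refl)) (cross-const p q (h ∘ there))

cross-≤ : ∀ p q {b} → (∀ {x} → x ∈ p → cnt x q ≤ b) → cross p q ≤ length p * b
cross-≤ []      q h = z≤n
cross-≤ (x ∷ p) q h = +-mono-≤ (h (here refl)) (cross-≤ p q (h ∘ there))

-- The equality case of `cross-≤`: the total reaches the bound only if every letter does.
cross-dichotomy : ∀ p q {b} → (∀ {x} → x ∈ p → cnt x q ≤ b) → (∀ {x} → x ∈ p → cnt x q ≡ b) ⊎ cross p q < length p * b
cross-dichotomy []      q h = inj₁ λ ()
cross-dichotomy (x ∷ p) q h with m≤n⇒m<n∨m≡n (h (here refl)) | cross-dichotomy p q (h ∘ there)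
... | inj₁ l | _      = inj₂ (+-mono-<-≤ l (cross-≤ p q (h ∘ there)))
... | inj₂ e | inj₂ l = inj₂ (+-mono-≤-< (≤-reflexive e) l)
... | inj₂ e | inj₁ k = inj₁ λ { (here refl) → e ; (there m) → k m }

-- The word in which all letters of q below M are smaller than those of p
-- has the most inversions among the words with given pack p and pack q.
inv-maximal : ∀ ps qs {M M′} → Sim ps → Sim qs →
  (∀ {z} → z ∈ qs → (proj₁ z < M → proj₂ z < M′) × (proj₂ z < M′ → proj₁ z < M)) →
  (∀ {x y} → x ∈ src ps → y ∈ src qs → (y < x → y < M) × (y < M → y < x)) →
  (∀ {x y} → x ∈ tgt ps → y ∈ tgt qs → y < x → y < M′) →
  (∀ {x y} → x ∈ tgt ps → y ∈ tgt qs → y < M′ → y < x) ⊎ inv (tgt ps ++ tgt qs) < inv (src ps ++ src qs)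
-- Inversions inside the parts depend only on the packings, so the cross inversions decide. Each
-- letter of `tgt ps` contributes at most the number of letters of `tgt qs` below M′, and on the
-- source side this bound is attained.
inv-maximal ps qs {M} {M′} S S′ hM h h′ with cross-dichotomy (tgt ps) (tgt qs) (λ mx → cnt-mono (tgt qs) (h′ mx))
... | inj₁ k = inj₁ λ mx → cnt-≡⇒ (tgt qs) (h′ mx) (k mx)
... | inj₂ l = inj₂ (subst₂ _<_ (sym (inv-++ (tgt ps) (tgt qs))) (sym (inv-++ (src ps) (src qs)))
      (+-mono-≤-< (≤-reflexive (sym (cong₂ _+_ (inv-sim ps S) (inv-sim qs S′))))
        (subst (cross (tgt ps) (tgt qs) <_) (sym e) l)))
  where
  e : cross (src ps) (src qs) ≡ length (tgt ps) * cnt M′ (tgt qs)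
  e = trans (cross-const (src ps) (src qs) λ mx → ≤-antisym (cnt-mono (src qs) λ my → proj₁ (h mx my)) (cnt-mono (src qs) λ my → proj₂ (h mx my)))
        (cong₂ _*_ (trans (LP.length-map proj₁ ps) (sym (LP.length-map proj₂ ps))) (cnt-sim qs hM))

sim-++ : ∀ {ps qs} → Sim ps → Sim qs →
  (∀ {z z′} → z ∈ ps → z′ ∈ qs → ((proj₁ z < proj₁ z′ × proj₂ z < proj₂ z′) ⊎ (proj₁ z′ < proj₁ z × proj₂ z′ < proj₂ z))) →
  Sim (ps ++ qs)
sim-++ {ps} S S′ h m m′ with ∈-++⁻ ps m | ∈-++⁻ ps m′
... | inj₁ n | inj₁ n′ = S n n′
... | inj₂ n | inj₂ n′ = S′ n n′
... | inj₁ n | inj₂ n′ with h n n′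
...   | inj₁ (l , l′) = (λ _ → l′) , λ _ → l
...   | inj₂ (l , l′) = (λ k → ⊥-elim (<-asym k l)) , λ k → ⊥-elim (<-asym k l′)
sim-++ {ps} S S′ h m m′ | inj₂ n | inj₁ n′ with h n′ n
...   | inj₁ (l , l′) = (λ k → ⊥-elim (<-asym k l)) , λ k → ⊥-elim (<-asym k l′)
...   | inj₂ (l , l′) = (λ _ → l′) , λ _ → l

-- Such a relation determines all comparisons across the cut, so a packed word is recovered from the
-- packings of its two parts (`glue-unique`).
Glue : WordRel → Set
Glue R = ∀ {ps qs} → Sim ps → Sim qs → R (src ps) (src qs) → R (tgt ps) (tgt qs) → Sim (ps ++ qs)

≫-glue : Glue _≫_
≫-glue S S′ h h′ = sim-++ S S′ λ m m′ → inj₂ (h (∈-map⁺ proj₁ m) (∈-map⁺ proj₁ m′) , h′ (∈-map⁺ proj₂ m) (∈-map⁺ proj₂ m′))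

▹-glue : Glue _▹_
▹-glue {ps} {qs} S S′ (l , h) (l′ , h′) = sim-++ S S′ cmp
  where
  cmp : ∀ {z z′} → z ∈ ps → z′ ∈ qs → ((proj₁ z < proj₁ z′ × proj₂ z < proj₂ z′) ⊎ (proj₁ z′ < proj₁ z × proj₂ z′ < proj₂ z))
  cmp {x , x′} {y , y′} m m′ with y ≟ maxW (src qs)
  ... | yes e = inj₁ (subst (x <_) (sym e) (≤-<-trans (≤maxW (∈-map⁺ proj₁ m)) l)
                    , subst (x′ <_) (sym (sim-maxW S′ m′ e)) (≤-<-trans (≤maxW (∈-map⁺ proj₂ m)) l′))
  ... | no ne with h (∈-map⁺ proj₁ m) (∈-map⁺ proj₁ m′) | h′ (∈-map⁺ proj₂ m) (∈-map⁺ proj₂ m′)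
  ...   | inj₁ e  | _ = ⊥-elim (ne e)
  ...   | inj₂ k  | inj₂ k′ = inj₂ (k , k′)
  -- Swapping the pairs reverses `sim-maxW`: a maximum of the target can only come from a maximum of
  -- the source.
  ...   | inj₂ k  | inj₁ e′ = ⊥-elim (ne (subst₂ _≡_ refl (cong maxW (tgt-swap qs)) (sim-maxW (Sim-swap S′) (∈-map⁺ swap m′) (trans e′ (cong maxW (sym (src-swap qs)))))))

glue-unique : ∀ {R} → Glue R → ∀ {p q p′ q′} → Packed (p ++ q) → Packed (p′ ++ q′) →
  pack p′ ≡ pack p → pack q′ ≡ pack q → R p q → R p′ q′ → p′ ++ q′ ≡ p ++ q
glue-unique G {p} {q} {p′} {q′} P P′ e e′ r r′ with pack≡⇒sim p p′ (sym e) | pack≡⇒sim q q′ (sym e′)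
... | ps , refl , refl , S | qs , refl , refl , S′ =
  trans (sym (LP.map-++ proj₂ ps qs)) (trans (sym (sim-packed⇒≡ (ps ++ qs) (G S S′ r r′)
      (subst Packed (sym (LP.map-++ proj₁ ps qs)) P) (subst Packed (sym (LP.map-++ proj₂ ps qs)) P′)))
    (LP.map-++ proj₁ ps qs))

-- Leading R T: among the words u cut by T with prescribed packings, the one cut by R is the largest for inv.
Leading : WordRel → WordRel → Set
Leading R T = ∀ {p q p′ q′} → Packed (p ++ q) → Packed (p′ ++ q′) →
  pack p′ ≡ pack p → pack q′ ≡ pack q → R p q → T p′ q′ → p′ ++ q′ ≡ p ++ q ⊎ inv (p′ ++ q′) < inv (p ++ q)

-- With thresholds one above the maxima all letters on the right count as small, so a word attaining
-- the maximal number of inversions satisfies p′ ≫ q′ and is determined.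
≫-leading : ∀ {T} → Leading _≫_ T
≫-leading {p = p} {q} {p′} {q′} P P′ e e′ r _ with pack≡⇒sim p p′ (sym e) | pack≡⇒sim q q′ (sym e′)
... | ps , refl , refl , S | qs , refl , refl , S′
    with inv-maximal ps qs {suc (maxW (src qs))} {suc (maxW (tgt qs))} S S′
           (λ m → (λ _ → s≤s (≤maxW (∈-map⁺ proj₂ m))) , λ _ → s≤s (≤maxW (∈-map⁺ proj₁ m)))
           (λ mx my → (λ _ → s≤s (≤maxW my)) , λ _ → r mx my)
           (λ mx my _ → s≤s (≤maxW my))
...   | inj₂ l = inj₂ l
...   | inj₁ h = inj₁ (glue-unique {_≫_} ≫-glue P P′ e e′ r λ mx my → h mx my (s≤s (≤maxW my)))

-- Now the thresholds are the maxima of the right parts themselves: `T` keeps the maximum on the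
-- right above all letters on the left, so it never takes part in a cross inversion.
▹-leading : ∀ {T} → (∀ {p q} → T p q → Max< p q) → Leading _▹_ T
▹-leading f {p} {q} {p′} {q′} P P′ e e′ r t with pack≡⇒sim p p′ (sym e) | pack≡⇒sim q q′ (sym e′)
... | ps , refl , refl , S | qs , refl , refl , S′
    with inv-maximal ps qs {maxW (src qs)} {maxW (tgt qs)} S S′
           (λ m → (λ l → ≤∧≢⇒< (≤maxW (∈-map⁺ proj₂ m)) λ eq → <⇒≢ l
                     (subst₂ _≡_ refl (cong maxW (tgt-swap qs)) (sim-maxW (Sim-swap S′) (∈-map⁺ swap m) (trans eq (cong maxW (sym (src-swap qs))))))) ,
                   λ l → ≤∧≢⇒< (≤maxW (∈-map⁺ proj₁ m)) λ eq → <⇒≢ l (sim-maxW S′ m eq))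
           (λ mx my → (λ l → <-≤-trans l (≤-trans (≤maxW mx) (<⇒≤ (proj₁ r)))) , λ l → [ (λ eq → ⊥-elim (<⇒≢ l eq)) , id ]′ (proj₂ r mx my))
           (λ mx my l → <-≤-trans l (≤-trans (≤maxW mx) (<⇒≤ (f t))))
...   | inj₂ l = inj₂ l
...   | inj₁ h = inj₁ (glue-unique {_▹_} ▹-glue P P′ e e′ r (f t , λ {x} {y} mx my → D mx my))
  where
  D : ∀ {x y} → x ∈ tgt ps → y ∈ tgt qs → y ≡ maxW (tgt qs) ⊎ y < x
  D {x} {y} mx my with m≤n⇒m<n∨m≡n (≤maxW my)
  ... | inj₁ l = inj₂ (h mx my l)
  ... | inj₂ eq = inj₁ eq

-- Enumeration of the packed words of length n

Enumerates : ∀ {A : Set} → List A → (A → Set) → Set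
Enumerates L P = Unique L × (∀ {x} → x ∈ L → P x) × (∀ {x} → P x → x ∈ L)

letters : ℕ → List ℕ
letters m = map suc (upTo m)

∈-letters⁺ : ∀ {m x} → 1 ≤ x → x ≤ m → x ∈ letters m
∈-letters⁺ {x = suc x} _ l = ∈-map⁺ suc (∈-upTo⁺ l)

∈-letters⁻ : ∀ {m x} → x ∈ letters m → 1 ≤ x × x ≤ m
∈-letters⁻ mem with ∈-map⁻ suc mem
... | _ , m′ , refl = s≤s z≤n , ∈-upTo⁻ m′

letters-unique : ∀ m → Unique (letters m)
letters-unique m = Uniq.map⁺ suc-injective (Uniq.upTo⁺ m)

∈-allWords⁺ : ∀ {m} w → (∀ {x} → x ∈ w → 1 ≤ x × x ≤ m) → w ∈ allWords (length w) m
∈-allWords⁺ []      h = here refl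
∈-allWords⁺ {m} (x ∷ w) h = ∈-concatMap⁺ (λ a → map (a ∷_) (allWords (length w) m))
  (Any.map (λ { refl → ∈-map⁺ (x ∷_) (∈-allWords⁺ w (h ∘ there)) }) (∈-letters⁺ (proj₁ (h (here refl))) (proj₂ (h (here refl)))))

∈-allWords⇒length : ∀ n {m w} → w ∈ allWords n m → length w ≡ n
∈-allWords⇒length zero    (here refl) = refl
∈-allWords⇒length (suc n) {m} mem with Any.satisfied (∈-concatMap⁻ (λ a → map (a ∷_) (allWords n m)) {xs = letters m} mem)
... | a , mem′ with ∈-map⁻ (a ∷_) mem′
...   | w , mw , refl = cong suc (∈-allWords⇒length n mw)

allWords-unique : ∀ n m → Unique (allWords n m)
allWords-unique zero    m = [] ∷ []
allWords-unique (suc n) m = Uniq.concat⁺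
  (AllP.map⁺ (All.tabulate λ _ → Uniq.map⁺ LP.∷-injectiveʳ (allWords-unique n m)))
  (AllPairsP.map⁺ (AllPairs.map disjoint (letters-unique m)))
  where
  disjoint : ∀ {a b} → a ≢ b → ∀ {w} → ¬ (w ∈ map (a ∷_) (allWords n m) × w ∈ map (b ∷_) (allWords n m))
  disjoint a≢b (mem , mem′) with ∈-map⁻ (_ ∷_) mem | ∈-map⁻ (_ ∷_) mem′
  ... | _ , _ , refl | _ , _ , e = a≢b (LP.∷-injectiveˡ e)

PW : ℕ → List Word
PW n = filter (λ w → LP.≡-dec _≟_ (pack w) w) (allWords n n)

PW-unique : ∀ n → Unique (PW n)
PW-unique n = Uniq.filter⁺ _ (allWords-unique n n)

∈-PW⁻ : ∀ n {w} → w ∈ PW n → length w ≡ n × Packed w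
∈-PW⁻ n mem with ∈-filter⁻ (λ w → LP.≡-dec _≟_ (pack w) w) {xs = allWords n n} mem
... | mem′ , e = ∈-allWords⇒length n mem′ , λ {x} → pack≡⇒packed e

∈-PW⁺ : ∀ n {w} → length w ≡ n → Packed w → w ∈ PW n
∈-PW⁺ n {w} refl P = ∈-filter⁺ (λ w → LP.≡-dec _≟_ (pack w) w)
  (∈-allWords⁺ w (λ m → proj₁ (P m) , packed-≤-length P m)) (packed⇒pack≡ P)

-- The three products

Disj? : ∀ p q → Dec (Disj p q)
Disj? p q = map′ (λ h {x} mx my → All.lookup h mx my) (λ h → All.tabulate λ mx my → h mx my) (All.all? (λ x → ¬? (_∈?_ _≟_ x q)) p)

_≺_ _≻_ : WordRel
p ≺ q = Disj p q × Max< q p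
p ≻ q = Disj p q × Max< p q

_≺?_ : ∀ p q → Dec (p ≺ q)
p ≺? q = Disj? p q ×-dec (maxW q <? maxW p)

_≻?_ : ∀ p q → Dec (p ≻ q)
p ≻? q = Disj? p q ×-dec (maxW p <? maxW q)

Iso-swap : ∀ {p q p′ q′} → Iso p q p′ q′ → Iso q p q′ p′
Iso-swap (ps , qs , (refl , refl) , (refl , refl) , S) = qs , ps , (refl , refl) , (refl , refl) ,
  λ m m′ → S (flip m) (flip m′)
  where
  flip : ∀ {z} → z ∈ qs ++ ps → z ∈ ps ++ qs
  flip m = [ ∈-++⁺ʳ ps , ∈-++⁺ˡ ]′ (∈-++⁻ qs m)

≺-invariant : Invariant _≺_
≺-invariant i ne ne′ (d , l) = Disj-invariant i ne ne′ (λ {x} → d {x}) , Max<-invariant (Iso-swap i) ne′ ne l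

≻-invariant : Invariant _≻_
≻-invariant i ne ne′ (d , l) = Disj-invariant i ne ne′ (λ {x} → d {x}) , Max<-invariant i ne ne′ l

≫⇒≺ : ∀ {p q} → p ≢ [] → q ≢ [] → p ≫ q → p ≺ q
≫⇒≺ {p} {q} ne ne′ h = (λ m m′ → <-irrefl refl (h m m′)) , h (maxW∈ ne) (maxW∈ ne′)

▹⇒≻ : ∀ {p q} → p ▹ q → p ≻ q
▹⇒≻ (l , h) = (λ m m′ → [ (λ e → <⇒≢ (≤-<-trans (≤maxW m) l) e) , <-irrefl refl ]′ (h m m′)) , l

-- In R u a b: the word u occurs in the product, defined by the relation R, of a and b.
In : WordRel → Word → Word → Word → Set
In R u a b = Cut (λ p q → R p q × pack p ≡ a × pack q ≡ b) u

in? : ∀ {R} → (∀ p q → Dec (R p q)) → ∀ u a b → Dec (In R u a b)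
in? R? u a b = cut? (λ p q → R? p q ×-dec (LP.≡-dec _≟_ (pack p) a ×-dec LP.≡-dec _≟_ (pack q) b)) u

In-lengths : ∀ {R u a b} → In R u a b → length a + length b ≡ length u
In-lengths (p , q , refl , _ , _ , _ , refl , refl) = trans (cong₂ _+_ (length-pack p) (length-pack q)) (sym (LP.length-++ p))

In-packed : ∀ {R u a b} → In R u a b → (Packed a × Packed b) × (a ≢ [] × b ≢ [])
In-packed (p , q , refl , p≢[] , q≢[] , _ , refl , refl) =
  ((λ {x} → pack-packed p {x}) , (λ {x} → pack-packed q {x})) , pack≡[]⁻ (sym (pack-idem p)) p≢[] , pack≡[]⁻ (sym (pack-idem q)) q≢[]

In-unique : ∀ {R u a b a′ b′} → In R u a b → In R u a′ b′ → length a ≡ length a′ → a ≡ a′ × b ≡ b′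
In-unique (p , q , refl , _ , _ , _ , refl , refl) (p′ , q′ , e , _ , _ , _ , refl , refl) l
  with ++-cancel-length p q p′ q′ e (trans (sym (length-pack p)) (trans l (length-pack p′)))
... | refl , refl = refl , refl

In-uniqueˡ : ∀ {R u a a′ b} → In R u a b → In R u a′ b → a ≡ a′
In-uniqueˡ {b = b} i i′ = proj₁ (In-unique i i′ (+-cancelʳ-≡ (length b) _ _ (trans (In-lengths i) (sym (In-lengths i′)))))

In-uniqueʳ : ∀ {R u a b b′} → In R u a b → In R u a b′ → b ≡ b′
In-uniqueʳ i i′ = proj₂ (In-unique i i′ refl)

-- The identity `(a₁ R₁ a₂) R₂ a₃ = a₁ R₄ (a₂ R₃ a₃)`, expressed on a word cut into three.
record Assoc (R₁ R₂ R₃ R₄ : WordRel) : Set where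
  field
    right : ∀ p₁ p₂ p₃ → R₁ p₁ p₂ → R₂ (p₁ ++ p₂) p₃ → R₃ p₂ p₃ × R₄ p₁ (p₂ ++ p₃)
    left  : ∀ p₁ p₂ p₃ → R₃ p₂ p₃ → R₄ p₁ (p₂ ++ p₃) → R₁ p₁ p₂ × R₂ (p₁ ++ p₂) p₃

open Assoc

-- The cut of the packed word `a` is carried over to the prefix of `u` that packs to `a`; then `d`
-- is the packing of all that follows the first piece.
In-assocʳ : ∀ {R₁ R₂ R₃ R₄} → Assoc R₁ R₂ R₃ R₄ → Invariant R₁ → Invariant R₃ →
  ∀ {u a₁ a₂ a b} → In R₁ a a₁ a₂ → In R₂ u a b → ∃ λ d → In R₃ d a₂ b × In R₄ u a₁ d
In-assocʳ A I₁ I₃ (α₁ , α₂ , eq , α₁≢ , α₂≢ , r₁ , refl , refl) (p , q , refl , p≢ , q≢ , r₂ , refl , refl)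
  with splitIso α₁ α₂ {p} (trans (cong pack (sym eq)) (pack-idem p))
... | p₁ , p₂ , refl , i with right A p₁ p₂ q (I₁ i α₁≢ α₂≢ r₁) r₂
...   | r₃ , r₄ with splitIso p₂ q {pack (p₂ ++ q)} (sym (pack-idem (p₂ ++ q)))
...     | δ₁ , δ₂ , eqδ , j = pack (p₂ ++ q)
          , (δ₁ , δ₂ , eqδ , pack≡[]⁻ (Iso-packˡ j) p₂≢ , pack≡[]⁻ (Iso-packʳ j) q≢ , I₃ j p₂≢ q≢ r₃ , trans (sym (Iso-packˡ j)) (sym (Iso-packʳ i)) , sym (Iso-packʳ j))
          , (p₁ , p₂ ++ q , LP.++-assoc p₁ p₂ q , pack≡[]⁻ (Iso-packˡ i) α₁≢ , ++≢[]ʳ p₂ q≢ , r₄ , sym (Iso-packˡ i) , refl)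
  where p₂≢ = pack≡[]⁻ (Iso-packʳ i) α₂≢

In-assocˡ : ∀ {R₁ R₂ R₃ R₄} → Assoc R₁ R₂ R₃ R₄ → Invariant R₁ → Invariant R₃ →
  ∀ {u a₁ a₂ d b} → In R₃ d a₂ b → In R₄ u a₁ d → ∃ λ a → In R₁ a a₁ a₂ × In R₂ u a b
In-assocˡ A I₁ I₃ (α₁ , α₂ , eq , α₁≢ , α₂≢ , r₁ , refl , refl) (p , q , refl , p≢ , q≢ , r₂ , refl , refl)
  with splitIso α₁ α₂ {q} (trans (cong pack (sym eq)) (pack-idem q))
... | q₁ , q₂ , refl , i with left A p q₁ q₂ (I₃ i α₁≢ α₂≢ r₁) r₂
...   | r₃ , r₄ with splitIso p q₁ {pack (p ++ q₁)} (sym (pack-idem (p ++ q₁)))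
...     | δ₁ , δ₂ , eqδ , j = pack (p ++ q₁)
          , (δ₁ , δ₂ , eqδ , pack≡[]⁻ (Iso-packˡ j) p≢ , pack≡[]⁻ (Iso-packʳ j) q₁≢ , I₁ j p≢ q₁≢ r₃ , sym (Iso-packˡ j) , trans (sym (Iso-packʳ j)) (sym (Iso-packˡ i)))
          , (p ++ q₁ , q₂ , sym (LP.++-assoc p q₁ q₂) , ++≢[]ˡ p≢ , pack≡[]⁻ (Iso-packʳ i) α₂≢ , r₄ , refl , sym (Iso-packʳ i))
  where q₁≢ = pack≡[]⁻ (Iso-packˡ i) α₁≢

Disj-++ʳ : ∀ p₁ p₂ p₃ → Disj p₁ p₂ → Disj (p₁ ++ p₂) p₃ → Disj p₂ p₃ × Disj p₁ (p₂ ++ p₃)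
Disj-++ʳ p₁ p₂ p₃ d d′ = (λ m m′ → d′ (∈-++⁺ʳ p₁ m) m′) , λ m m′ → [ d m , d′ (∈-++⁺ˡ m) ]′ (∈-++⁻ p₂ m′)

Disj-++ˡ : ∀ p₁ p₂ p₃ → Disj p₂ p₃ → Disj p₁ (p₂ ++ p₃) → Disj p₁ p₂ × Disj (p₁ ++ p₂) p₃
Disj-++ˡ p₁ p₂ p₃ d d′ = (λ m m′ → d′ m (∈-++⁺ˡ m′)) , λ m m′ → [ (λ n → d′ n (∈-++⁺ʳ p₂ m′)) , (λ n → d n m′) ]′ (∈-++⁻ p₁ m)

assoc-•••• : Assoc Disj Disj Disj Disj
right assoc-•••• = Disj-++ʳ
left  assoc-•••• = Disj-++ˡ

assoc-≺≺•≺ : Assoc _≺_ _≺_ Disj _≺_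
right assoc-≺≺•≺ p₁ p₂ p₃ (d , l) (d′ , l′) with Disj-++ʳ p₁ p₂ p₃ d d′
... | e , e′ = e , e′ , subst (_< maxW p₁) (sym (maxW-++ p₂ p₃)) (⊔-pres-<m l (subst (maxW p₃ <_) (trans (maxW-++ p₁ p₂) (m≥n⇒m⊔n≡m (<⇒≤ l))) l′))
left  assoc-≺≺•≺ p₁ p₂ p₃ d (d′ , l′) with Disj-++ˡ p₁ p₂ p₃ d d′ | subst (_< maxW p₁) (maxW-++ p₂ p₃) l′
... | e , e′ | l = (e , m⊔n<o⇒m<o (maxW p₂) (maxW p₃) l) , e′ , subst (maxW p₃ <_) (sym (maxW-++ p₁ p₂)) (m<n⇒m<n⊔o (maxW p₂) (m⊔n<o⇒n<o (maxW p₂) (maxW p₃) l))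

assoc-≻≺≺≻ : Assoc _≻_ _≺_ _≺_ _≻_
right assoc-≻≺≺≻ p₁ p₂ p₃ (d , l) (d′ , l′) with Disj-++ʳ p₁ p₂ p₃ d d′
... | e , e′ = (e , subst (maxW p₃ <_) (trans (maxW-++ p₁ p₂) (m≤n⇒m⊔n≡n (<⇒≤ l))) l′) , e′ , subst (maxW p₁ <_) (sym (maxW-++ p₂ p₃)) (m<n⇒m<n⊔o (maxW p₃) l)
left  assoc-≻≺≺≻ p₁ p₂ p₃ (d , l) (d′ , l′) with Disj-++ˡ p₁ p₂ p₃ d d′
... | e , e′ = (e , subst (maxW p₁ <_) (trans (maxW-++ p₂ p₃) (m≥n⇒m⊔n≡m (<⇒≤ l))) l′) , e′ , subst (maxW p₃ <_) (sym (maxW-++ p₁ p₂)) (m<n⇒m<o⊔n (maxW p₁) l)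

assoc-•≻≻≻ : Assoc Disj _≻_ _≻_ _≻_
right assoc-•≻≻≻ p₁ p₂ p₃ d (d′ , l′) with Disj-++ʳ p₁ p₂ p₃ d d′ | subst (_< maxW p₃) (maxW-++ p₁ p₂) l′
... | e , e′ | l = (e , m⊔n<o⇒n<o (maxW p₁) (maxW p₂) l) , e′ , subst (maxW p₁ <_) (sym (maxW-++ p₂ p₃)) (m<n⇒m<o⊔n (maxW p₂) (m⊔n<o⇒m<o (maxW p₁) (maxW p₂) l))
left  assoc-•≻≻≻ p₁ p₂ p₃ (d , l) (d′ , l′) with Disj-++ˡ p₁ p₂ p₃ d d′
... | e , e′ = e , e′ , subst (_< maxW p₃) (sym (maxW-++ p₁ p₂)) (⊔-pres-<m (subst (maxW p₁ <_) (trans (maxW-++ p₂ p₃) (m≤n⇒m⊔n≡n (<⇒≤ l))) l′) l)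

-- Gluing packed words

-- In contrast to `In`, a part may be empty: the last tree of a forest is followed by the empty
-- word.
Joined : WordRel → Word → Word → Word → Set
Joined R a b w = ∃₂ λ p q → w ≡ p ++ q × R p q × pack p ≡ a × pack q ≡ b

pack-joined : ∀ {R} p q → (∀ {p′ q′} → Iso p q p′ q′ → R p′ q′) → Joined R (pack p) (pack q) (pack (p ++ q))
pack-joined p q h with splitIso p q {pack (p ++ q)} (sym (pack-idem (p ++ q)))
... | p′ , q′ , e , i = p′ , q′ , e , h i , sym (Iso-packˡ i) , sym (Iso-packʳ i)

map≢[] : ∀ {f : ℕ → ℕ} {w} → w ≢ [] → map f w ≢ []
map≢[] {w = []}    ne = λ _ → ne refl
map≢[] {w = _ ∷ _} ne = λ ()

shift : ℕ → Word → Word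
shift k = map (_+ k)

pack-shift : ∀ k {a} → Packed a → pack (shift k a) ≡ a
pack-shift k {a} P = trans (pack-map {_+ k} {a} λ _ _ l → +-monoˡ-< k l) (packed⇒pack≡ P)

shift-≫ : ∀ a b → shift (suc (maxW b)) a ≫ b
shift-≫ a b mx my with ∈-map⁻ (_+ suc (maxW b)) mx
... | x , _ , refl = ≤-trans (s≤s (≤maxW my)) (m≤n+m (suc (maxW b)) x)

-- Used with k = `maxW a` and m = `maxW b`: the maximum of b moves to one above the largest letter
-- of a shifted by `maxW b`, while the other letters of b stay below that shifted word.
raise : ℕ → ℕ → ℕ → ℕ
raise k m y with y ≟ m
... | yes _ = k + suc m
... | no _  = y

raiseMax : Word → Word → Word
raiseMax a b = map (raise (maxW a) (maxW b)) b

raise-mono : ∀ k b → StrictMonoOn b (raise k (maxW b))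
raise-mono k b {x} {y} mx my l with x ≟ maxW b | y ≟ maxW b
... | yes refl | _        = ⊥-elim (<⇒≱ l (≤maxW my))
... | no _     | yes refl = ≤-trans l (≤-trans (n≤1+n y) (m≤n+m (suc y) k))
... | no _     | no _     = l

raise-max : ∀ k m → raise k m m ≡ k + suc m
raise-max k m with m ≟ m
... | yes _ = refl
... | no ne = ⊥-elim (ne refl)

raise-cases : ∀ k m {y} → y ≤ m → raise k m y ≡ k + suc m ⊎ raise k m y < m
raise-cases k m {y} l with y ≟ m
... | yes _ = inj₁ refl
... | no ne = inj₂ (≤∧≢⇒< l ne)

pack-raiseMax : ∀ a {b} → Packed b → pack (raiseMax a b) ≡ b
pack-raiseMax a {b} P = trans (pack-map {raise (maxW a) (maxW b)} {b} (raise-mono (maxW a) b)) (packed⇒pack≡ P)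

maxW-raiseMax : ∀ a {b} → b ≢ [] → maxW (raiseMax a b) ≡ maxW a + suc (maxW b)
maxW-raiseMax a {b} b≢ = ≤-antisym (maxW-lub {raiseMax a b} bound)
    (subst (_≤ maxW (raiseMax a b)) (raise-max (maxW a) (maxW b)) (≤maxW (∈-map⁺ (raise (maxW a) (maxW b)) (maxW∈ b≢))))
  where
  bound : ∀ {y} → y ∈ raiseMax a b → y ≤ maxW a + suc (maxW b)
  bound my with ∈-map⁻ (raise (maxW a) (maxW b)) my
  ... | y , m , refl = [ ≤-reflexive , (λ l → ≤-trans (<⇒≤ l) (≤-trans (n≤1+n (maxW b)) (m≤n+m (suc (maxW b)) (maxW a)))) ]′
                         (raise-cases (maxW a) (maxW b) (≤maxW m))

shift-▹ : ∀ {a b} → a ≢ [] → b ≢ [] → shift (maxW b) a ▹ raiseMax a b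
shift-▹ {a} {b} a≢ b≢ = subst (maxW (shift (maxW b) a) <_) (sym (maxW-raiseMax a b≢)) (maxW-<-lub (map≢[] a≢) below) , other
  where
  below : ∀ {x} → x ∈ shift (maxW b) a → x < maxW a + suc (maxW b)
  below mx with ∈-map⁻ (_+ maxW b) mx
  ... | x , m , refl = subst (x + maxW b <_) (sym (+-suc (maxW a) (maxW b))) (s≤s (+-monoˡ-≤ (maxW b) (≤maxW m)))
  other : ∀ {x y} → x ∈ shift (maxW b) a → y ∈ raiseMax a b → y ≡ maxW (raiseMax a b) ⊎ y < x
  other mx my with ∈-map⁻ (_+ maxW b) mx | ∈-map⁻ (raise (maxW a) (maxW b)) my
  ... | x , m , refl | y , m′ , refl = [ (λ e → inj₁ (trans e (sym (maxW-raiseMax a b≢)))) , (λ l → inj₂ (<-≤-trans l (m≤n+m (maxW b) x))) ]′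
                                         (raise-cases (maxW a) (maxW b) (≤maxW m′))

opaque
  -- The packed words with a ≫-cut and a ▹-cut into copies of a and b. They are sealed: later only
  -- their length, packedness and factorisation are visible.
  _⊘_ _▷_ : Word → Word → Word
  a ⊘ b = pack (shift (suc (maxW b)) a ++ b)
  a ▷ b = pack (shift (maxW b) a ++ raiseMax a b)

  ⊘-packed : ∀ a b → Packed (a ⊘ b)
  ⊘-packed a b = pack-packed (shift (suc (maxW b)) a ++ b)

  ▷-packed : ∀ a b → Packed (a ▷ b)
  ▷-packed a b = pack-packed (shift (maxW b) a ++ raiseMax a b)

  length-⊘ : ∀ a b → length (a ⊘ b) ≡ length a + length b
  length-⊘ a b = trans (length-pack (shift (suc (maxW b)) a ++ b))
    (trans (LP.length-++ (shift (suc (maxW b)) a)) (cong (_+ length b) (LP.length-map _ a)))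

  length-▷ : ∀ a b → length (a ▷ b) ≡ length a + length b
  length-▷ a b = trans (length-pack (shift (maxW b) a ++ raiseMax a b))
    (trans (LP.length-++ (shift (maxW b) a)) (cong₂ _+_ (LP.length-map _ a) (LP.length-map _ b)))

  ⊘-joined : ∀ {a b} → a ≢ [] → Packed a → Packed b → Joined _≫_ a b (a ⊘ b)
  ⊘-joined {a} {b} a≢ P Q = subst₂ (λ c d → Joined _≫_ c d (a ⊘ b)) (pack-shift (suc (maxW b)) P) (packed⇒pack≡ Q)
    (pack-joined (shift (suc (maxW b)) a) b joined)
    where
    joined : ∀ {p q} → Iso (shift (suc (maxW b)) a) b p q → p ≫ q
    joined i mx my = ≫-invariant i (map≢[] a≢) (pack≡[]⁻ (sym (Iso-packʳ i)) (∈⇒≢[] my)) (shift-≫ a b) mx my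

  ▷-joined : ∀ {a b} → a ≢ [] → b ≢ [] → Packed a → Packed b → Joined _▹_ a b (a ▷ b)
  ▷-joined {a} {b} a≢ b≢ P Q = subst₂ (λ c d → Joined _▹_ c d (a ▷ b)) (pack-shift (maxW b) P) (pack-raiseMax a Q)
    (pack-joined (shift (maxW b) a) (raiseMax a b) λ i → ▹-invariant i (map≢[] a≢) (map≢[] b≢) (shift-▹ a≢ b≢))

-- Classification of words

-- Every cut stored here has an irreducible left part and is therefore the only one of its kind.
-- Testing ▹-cuts only on irreducible words keeps a word from leading two equations.
data Shape (w : Word) : Set where
  empty         : w ≡ [] → Shape w
  reducible     : Cut (λ p q → p ≫ q × Irr p) w → Shape w
  ▹-reducible   : Irr w → Cut (λ p q → p ▹ q × Irr p) w → Shape w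
  ▹-irreducible : Irr w → ¬ Cut _▹_ w → Shape w

shape : ∀ w → Shape w
shape w with []? w
... | yes e = empty e
... | no ne with cut? _≫?_ w
...   | yes c = reducible (cut⇒irrCut ≫-cutRel c)
...   | no ¬c with cut? _▹?_ w
...     | yes c  = ▹-reducible (ne , ¬c) (cut⇒irrCut ▹-cutRel c)
...     | no ¬c′ = ▹-irreducible (ne , ¬c) ¬c′

-- A ≫-cut at or before the end of p would put the maximum of q, which exceeds all of p, below
-- letters of p; a later one would cut q.
▹-irr : ∀ {p q} → p ≢ [] → p ▹ q → Irr q → Irr (p ++ q)
▹-irr {p} {q} p≢ r (q≢ , ¬c) = ++≢[]ˡ p≢ , ¬cut
  where
  ¬cut : ¬ Cut _≫_ (p ++ q)
  ¬cut (p′ , q′ , e , p′≢ , q′≢ , h) with ++-overlap p q p′ q′ e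
  ... | inj₁ ([] , refl , refl) with ≢[]⇒∃∈ p≢
  ...   | x , m = <-asym (proj₁ r) (<-≤-trans (h (∈-++⁺ˡ m) (maxW∈ q≢)) (≤maxW m))
  ¬cut (p′ , q′ , e , p′≢ , q′≢ , h) | inj₁ (y ∷ s , refl , refl) = ¬c (y ∷ s , q′ , refl , (λ ()) , q′≢ , λ mx my → h (∈-++⁺ʳ p mx) my)
  ¬cut (p′ , q′ , e , p′≢ , q′≢ , h) | inj₂ (s , refl , refl) with ≢[]⇒∃∈ p′≢
  ...   | x , m = <-asym (proj₁ r) (<-≤-trans (h m (∈-++⁺ʳ s (maxW∈ q≢))) (≤maxW (∈-++⁺ˡ m)))

-- A cut q₁ ≫ q₂ of q extends to p q₁ ≫ q₂, because q₂ does not contain the maximum of q.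
▹-irrʳ : ∀ {p q} → q ≢ [] → p ▹ q → Irr (p ++ q) → Irr q
▹-irrʳ {p} {q} q≢ (l , h) (_ , ¬c) = q≢ , λ { (q₁ , q₂ , refl , q₁≢ , q₂≢ , k) →
  ¬c (p ++ q₁ , q₂ , sym (LP.++-assoc p q₁ q₂) , ++≢[]ʳ p q₁≢ , q₂≢ , λ mx my →
    [ (λ m → [ (λ e → ⊥-elim (contra q₁≢ k my e)) , id ]′ (h m (∈-++⁺ʳ q₁ my))) , (λ m → k m my) ]′ (∈-++⁻ p mx)) }
  where
  contra : ∀ {q₁ q₂ y} → q₁ ≢ [] → q₁ ≫ q₂ → y ∈ q₂ → y ≢ maxW (q₁ ++ q₂)
  contra q₁≢ k my e with ≢[]⇒∃∈ q₁≢
  ... | x , m = <⇒≢ (<-≤-trans (k m my) (≤maxW (∈-++⁺ˡ m))) e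

-- Positions and removal of a letter

positions : ℕ → ℕ → Word → List ℕ
positions M k []      = []
positions M k (x ∷ u) with x ≟ M
... | yes _ = k ∷ positions M (suc k) u
... | no _  = positions M (suc k) u

remove : ℕ → Word → Word
remove M []      = []
remove M (x ∷ u) with x ≟ M
... | yes _ = remove M u
... | no _  = x ∷ remove M u

-- Inverse to the pair `positions`, `remove`: the entries of `I` are positions in the resulting
-- word, counted from k. Once the word is used up, each remaining entry yields one more M.
insert : ℕ → ℕ → List ℕ → Word → Word
insert M k []      w       = w
insert M k (i ∷ I) []      = M ∷ insert M (suc k) I []
insert M k (i ∷ I) (x ∷ w) = if i ≡ᵇ k then M ∷ insert M (suc k) I (x ∷ w) else x ∷ insert M (suc k) (i ∷ I) w

∈-remove⁻ : ∀ M u {x} → x ∈ remove M u → x ∈ u × x ≢ M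
∈-remove⁻ M (y ∷ u) m with y ≟ M
... | yes _ = there (proj₁ (∈-remove⁻ M u m)) , proj₂ (∈-remove⁻ M u m)
∈-remove⁻ M (y ∷ u) (here refl) | no ne = here refl , ne
∈-remove⁻ M (y ∷ u) (there m)   | no _  = there (proj₁ (∈-remove⁻ M u m)) , proj₂ (∈-remove⁻ M u m)

∈-remove⁺ : ∀ M {u x} → x ∈ u → x ≢ M → x ∈ remove M u
∈-remove⁺ M {y ∷ u} m ne with y ≟ M
∈-remove⁺ M {y ∷ u} (here refl) ne | yes e = ⊥-elim (ne e)
∈-remove⁺ M {y ∷ u} (there m)   ne | yes e = ∈-remove⁺ M m ne
∈-remove⁺ M {y ∷ u} (here refl) ne | no _  = here refl
∈-remove⁺ M {y ∷ u} (there m)   ne | no _  = there (∈-remove⁺ M m ne)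

remove-++ : ∀ M u {v} → remove M (u ++ v) ≡ remove M u ++ remove M v
remove-++ M []      = refl
remove-++ M (x ∷ u) with x ≟ M
... | yes _ = remove-++ M u
... | no _  = cong (x ∷_) (remove-++ M u)

remove-∉ : ∀ M u → M ∉ u → remove M u ≡ u
remove-∉ M []      h = refl
remove-∉ M (x ∷ u) h with x ≟ M
... | yes refl = ⊥-elim (h (here refl))
... | no _     = cong (x ∷_) (remove-∉ M u (h ∘ there))

remove-∷ : ∀ M u → remove M (M ∷ u) ≡ remove M u
remove-∷ M u with M ≟ M
... | yes _ = refl
... | no ne = ⊥-elim (ne refl)

positions-≥ : ∀ M k u {i} → i ∈ positions M k u → k ≤ i
positions-≥ M k (x ∷ u) m with x ≟ M
positions-≥ M k (x ∷ u) (here refl) | yes _ = ≤-refl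
positions-≥ M k (x ∷ u) (there m)   | yes _ = <⇒≤ (positions-≥ M (suc k) u m)
positions-≥ M k (x ∷ u) m           | no _  = <⇒≤ (positions-≥ M (suc k) u m)

positions-sorted : ∀ M k u → AllPairs _<_ (positions M k u)
positions-sorted M k []      = []
positions-sorted M k (x ∷ u) with x ≟ M
... | yes _ = All.tabulate (positions-≥ M (suc k) u) ∷ positions-sorted M (suc k) u
... | no _  = positions-sorted M (suc k) u

length-positions : ∀ M k u → length (positions M k u) + length (remove M u) ≡ length u
length-positions M k []      = refl
length-positions M k (x ∷ u) with x ≟ M
... | yes _ = cong suc (length-positions M (suc k) u)
... | no _  = trans (+-suc _ _) (cong suc (length-positions M (suc k) u))

positions-∉ : ∀ M k u → M ∉ u → positions M k u ≡ []
positions-∉ M k []      h = refl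
positions-∉ M k (x ∷ u) h with x ≟ M
... | yes refl = ⊥-elim (h (here refl))
... | no _     = positions-∉ M (suc k) u (h ∘ there)

positions≢[] : ∀ M k u → M ∈ u → positions M k u ≢ []
positions≢[] M k (x ∷ u) m with x ≟ M
positions≢[] M k (x ∷ u) m           | yes _ = λ ()
positions≢[] M k (x ∷ u) (here refl) | no ne = ⊥-elim (ne refl)
positions≢[] M k (x ∷ u) (there m)   | no _  = positions≢[] M (suc k) u m

positions-remove-injective : ∀ M k u u′ → positions M k u ≡ positions M k u′ → remove M u ≡ remove M u′ → u ≡ u′
positions-remove-injective M k []      []        e e′ = refl
positions-remove-injective M k []      (y ∷ u′)  e e′ with y ≟ M
positions-remove-injective M k []      (y ∷ u′)  () e′ | yes _
positions-remove-injective M k []      (y ∷ u′)  e () | no _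
positions-remove-injective M k (x ∷ u) []        e e′ with x ≟ M
positions-remove-injective M k (x ∷ u) []        () e′ | yes _
positions-remove-injective M k (x ∷ u) []        e () | no _
positions-remove-injective M k (x ∷ u) (y ∷ u′)  e e′ with x ≟ M | y ≟ M
... | yes refl | yes refl = cong (M ∷_) (positions-remove-injective M (suc k) u u′ (LP.∷-injectiveʳ e) e′)
... | yes refl | no _     = ⊥-elim (<-irrefl refl (positions-≥ M (suc k) u′ (subst (k ∈_) e (here refl))))
... | no _     | yes refl = ⊥-elim (<-irrefl refl (positions-≥ M (suc k) u (subst (k ∈_) (sym e) (here refl))))
... | no _     | no _     = cong₂ _∷_ (LP.∷-injectiveˡ e′) (positions-remove-injective M (suc k) u u′ e (LP.∷-injectiveʳ e′))

-- A strictly increasing list climbs by at least one at each entry. In `insert-spec` this forces the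
-- remaining positions to be consecutive when the word is used up.
sorted-head : ∀ {i I B} → AllPairs _<_ (i ∷ I) → (∀ {j} → j ∈ i ∷ I → j < B) → i + length I < B
sorted-head {i} {[]}    _ h = subst (_< _) (sym (+-identityʳ i)) (h (here refl))
sorted-head {i} {j ∷ I} ((i<j ∷ _) ∷ S) h = ≤-<-trans
  (subst (_≤ j + length I) (sym (+-suc i (length I))) (+-monoˡ-≤ (length I) i<j)) (sorted-head S (h ∘ there))

insert-spec : ∀ M k I w → AllPairs _<_ I → (∀ {i} → i ∈ I → k ≤ i) → (∀ {i} → i ∈ I → i < k + (length I + length w)) → M ∉ w →
  positions M k (insert M k I w) ≡ I × remove M (insert M k I w) ≡ w
insert-spec M k []      w       S lo hi M∉ = positions-∉ M k w M∉ , remove-∉ M w M∉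
insert-spec M k (i ∷ I) []      (i< ∷ S) lo hi M∉ with M ≟ M
... | no ne = ⊥-elim (ne refl)
... | yes _ with i≡k
  where
  i≡k : i ≡ k
  i≡k = ≤-antisym (+-cancelʳ-≤ (length I) i k (s≤s⁻¹ (subst (i + length I <_) (trans (cong (k +_) (+-identityʳ (suc (length I)))) (+-suc k (length I)))
          (sorted-head (i< ∷ S) hi)))) (lo (here refl))
...   | refl with insert-spec M (suc k) I [] S (All.lookup i<) (λ m → <-≤-trans (hi (there m)) (≤-reflexive (+-suc k _))) (λ ())
...     | e , e′ = cong (k ∷_) e , e′
insert-spec M k (i ∷ I) (x ∷ w) (i< ∷ S) lo hi M∉ with i ≡ᵇ k in eq | insert-spec M (suc k) I (x ∷ w) | insert-spec M (suc k) (i ∷ I) w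
... | true | ih | _ with M ≟ M | ≡ᵇ⇒≡ i k (subst T (sym eq) _)
...   | no ne | _ = ⊥-elim (ne refl)
...   | yes _ | refl with ih S (All.lookup i<) (λ m → <-≤-trans (hi (there m)) (≤-reflexive (+-suc k _))) M∉
...     | e , e′ = cong (k ∷_) e , e′
insert-spec M k (i ∷ I) (x ∷ w) (i< ∷ S) lo hi M∉ | false | _ | ih with x ≟ M
...   | yes refl = ⊥-elim (M∉ (here refl))
...   | no _ with ih (i< ∷ S) lo′ (λ m → <-≤-trans (hi m) (≤-reflexive hi≡)) (M∉ ∘ there)
  where
  hi≡ : k + suc (length I + suc (length w)) ≡ suc k + suc (length I + length w)
  hi≡ = trans (cong (λ t → k + suc t) (+-suc (length I) (length w))) (+-suc k _)
  k<i : k < i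
  k<i = ≤∧≢⇒< (lo (here refl)) λ e → subst T eq (≡⇒≡ᵇ i k (sym e))
  lo′ : ∀ {j} → j ∈ i ∷ I → suc k ≤ j
  lo′ (here refl) = k<i
  lo′ (there m)   = <-trans k<i (All.lookup i< m)
...     | e , e′ = e , cong (x ∷_) e′

sorted-≤-lastN : ∀ {I i} → AllPairs _<_ I → i ∈ I → i ≤ lastN I
sorted-≤-lastN {_ ∷ []}    _ (here refl) = ≤-refl
sorted-≤-lastN {_ ∷ _ ∷ _} ((l ∷ _) ∷ S) (here refl) = ≤-trans (<⇒≤ l) (sorted-≤-lastN S (here refl))
sorted-≤-lastN {_ ∷ _ ∷ _} (_ ∷ S) (there m) = sorted-≤-lastN S m

firstOccurrence : ∀ M k u → M ∈ u → ∃₂ λ p s → u ≡ p ++ M ∷ s × M ∉ p × firstN (positions M k u) ≡ k + length p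
firstOccurrence M k (x ∷ u) m with x ≟ M
... | yes refl = [] , u , refl , (λ ()) , sym (+-identityʳ k)
firstOccurrence M k (x ∷ u) (here refl) | no ne = ⊥-elim (ne refl)
firstOccurrence M k (x ∷ u) (there m) | no ne with firstOccurrence M (suc k) u m
... | p , s , refl , M∉ , e = x ∷ p , s , refl , (λ { (here e′) → ne (sym e′) ; (there n) → M∉ n }) , trans e (sym (+-suc k (length p)))

lastN-∷ : ∀ k {I} → I ≢ [] → lastN (k ∷ I) ≡ lastN I
lastN-∷ k {[]}    ne = ⊥-elim (ne refl)
lastN-∷ k {_ ∷ _} ne = refl

lastOccurrence : ∀ M k u → M ∈ u → ∃₂ λ s q → u ≡ s ++ M ∷ q × M ∉ q × lastN (positions M k u) ≡ k + length s
lastOccurrence M k (x ∷ u) m with _∈?_ _≟_ M u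
lastOccurrence M k (x ∷ u) m | yes m′ with lastOccurrence M (suc k) u m′ | x ≟ M
... | s , q , refl , M∉ , e | yes refl = M ∷ s , q , refl , M∉ , trans (lastN-∷ k (positions≢[] M (suc k) u m′)) (trans e (sym (+-suc k (length s))))
... | s , q , refl , M∉ , e | no _     = x ∷ s , q , refl , M∉ , trans e (sym (+-suc k (length s)))
lastOccurrence M k (x ∷ u) m | no M∉ with x ≟ M
... | yes refl = [] , u , refl , M∉ , trans (cong (λ I → lastN (k ∷ I)) (positions-∉ M (suc k) u M∉)) (sym (+-identityʳ k))
lastOccurrence M k (x ∷ u) (here refl) | no M∉ | no ne = ⊥-elim (ne refl)
lastOccurrence M k (x ∷ u) (there m)   | no M∉ | no _  = ⊥-elim (M∉ m)

positions-const : ∀ M k u (f : ℕ → ℕ) → (∀ i → f i ≡ k + i) → remove M u ≡ [] → positions M k u ≡ applyUpTo f (length u)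
positions-const M k []      f h e = refl
positions-const M k (x ∷ u) f h e with x ≟ M
... | yes _ = cong₂ _∷_ (sym (trans (h 0) (+-identityʳ k))) (positions-const M (suc k) u (f ∘ suc) (λ i → trans (h (suc i)) (+-suc k i)) e)
positions-const M k (x ∷ u) f h () | no _

-- Packed words and removal of the largest letter

remove-max-packed : ∀ {u} → Packed u → Packed (remove (maxW u) u)
remove-max-packed {u} P m with ∈-remove⁻ (maxW u) u m
... | m′ , ne = proj₁ (P m′) , λ 1≤k k≤x → ∈-remove⁺ (maxW u) (proj₂ (P m′) 1≤k k≤x)
                  λ { refl → ne (≤-antisym (≤maxW m′) k≤x) }

suc-max-remove : ∀ {u} → u ≢ [] → Packed u → suc (maxW (remove (maxW u) u)) ≡ maxW u
suc-max-remove {u} ne P with maxW u | maxW∈ ne | (λ {x} → ≤maxW {x} {u})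
... | zero  | m | _ with () ← proj₁ (P m)
... | suc j | m | ub = cong suc (≤-antisym (maxW-lub {remove (suc j) u} below) (above j refl))
  where
  below : ∀ {x} → x ∈ remove (suc j) u → x ≤ j
  below mx with ∈-remove⁻ (suc j) u mx
  ... | m′ , ne′ = s≤s⁻¹ (≤∧≢⇒< (ub m′) ne′)
  -- If the maximum is 1, the bound 0 is trivial; otherwise j is itself a letter and survives the
  -- removal.
  above : ∀ i → i ≡ j → i ≤ maxW (remove (suc j) u)
  above zero    _    = z≤n
  above (suc i) refl = ≤maxW (∈-remove⁺ (suc j) (proj₂ (P m) (s≤s z≤n) (n≤1+n j)) (<⇒≢ (n<1+n j)))

add-max-packed : ∀ {u M} → Packed (remove M u) → M ≡ suc (maxW (remove M u)) → M ∈ u → Packed u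
add-max-packed {u} {M} P e M∈ {x} m with x ≟ M
... | no ne = proj₁ (P (∈-remove⁺ M m ne)) , λ 1≤k k≤ → proj₁ (∈-remove⁻ M u (proj₂ (P (∈-remove⁺ M m ne)) 1≤k k≤))
... | yes refl = subst (1 ≤_) (sym e) (s≤s z≤n) , below
  where
  below : ∀ {k} → 1 ≤ k → k ≤ x → k ∈ u
  below 1≤k k≤ with m≤n⇒m<n∨m≡n k≤
  ... | inj₂ refl = m
  ... | inj₁ l = proj₁ (∈-remove⁻ x u (proj₂ (P (maxW∈ ne)) 1≤k k≤′))
    where
    k≤′ = s≤s⁻¹ (subst (_ <_) e l)
    ne : remove x u ≢ []
    ne eq = <⇒≱ 1≤k (subst (_ ≤_) (cong maxW eq) k≤′)

++-prefix : ∀ {A : Set} (p q p′ q′ : List A) → p ++ q ≡ p′ ++ q′ → length p ≤ length p′ → ∃ λ r → p′ ≡ p ++ r × q ≡ r ++ q′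
++-prefix p q p′ q′ e l with ++-overlap p q p′ q′ e
... | inj₁ x = x
... | inj₂ ([] , refl , refl) = [] , sym (trans (LP.++-identityʳ (p′ ++ [])) (LP.++-identityʳ p′)) , refl
... | inj₂ (y ∷ r , refl , _) = ⊥-elim (<⇒≱ (m<m+n (length p′) (s≤s z≤n)) (subst (_≤ length p′) (LP.length-++ p′) l))

++-suffix : ∀ {A : Set} (p q p′ q′ : List A) → p ++ q ≡ p′ ++ q′ → length q ≤ length q′ → ∃ λ r → p ≡ p′ ++ r × q′ ≡ r ++ q
++-suffix p q p′ q′ e l with ++-overlap p q p′ q′ e
... | inj₂ x = x
... | inj₁ ([] , refl , refl) = [] , sym (trans (LP.++-identityʳ (p ++ [])) (LP.++-identityʳ p)) , refl
... | inj₁ (y ∷ r , _ , refl) = ⊥-elim (<⇒≱ (s≤s (m≤n+m (length q′) (length r))) (subst (λ t → suc t ≤ length q′) (LP.length-++ r) l))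

prefix-≤ : ∀ {A : Set} {M : A} p′ q′ p s → p′ ++ q′ ≡ p ++ M ∷ s → M ∉ p′ → length p′ ≤ length p
prefix-≤ p′ q′ p s e M∉ with ++-overlap p′ q′ p (_ ∷ s) e
... | inj₁ (r , refl , _) = LP.length-++-≤ˡ p′
... | inj₂ ([] , refl , _) = ≤-reflexive (cong length (LP.++-identityʳ p))
... | inj₂ (_ ∷ r , refl , refl) = ⊥-elim (M∉ (∈-++⁺ʳ p (here refl)))

suffix-≤ : ∀ {A : Set} {M : A} p′ q′ s q → p′ ++ q′ ≡ s ++ M ∷ q → M ∉ q′ → length q′ ≤ length q
suffix-≤ p′ q′ s q e M∉ with ++-overlap p′ q′ s (_ ∷ q) e
... | inj₁ (r , _ , refl) = ⊥-elim (M∉ (∈-++⁺ʳ r (here refl)))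
... | inj₂ ([] , _ , refl) = ⊥-elim (M∉ (here refl))
... | inj₂ (_ ∷ r , _ , refl) = LP.length-++-≤ʳ q′ {r}

-- Irreducibility of a word in terms of the factors of the word without its largest letter M

module _ {M : ℕ} {u : Word} (M∈ : M ∈ u) (ub : ∀ {x} → x ∈ u → x ≤ M) where

  maxW≡ : maxW u ≡ M
  maxW≡ = ≤-antisym (maxW-lub {u} ub) (≤maxW M∈)

  const-irr : remove M u ≡ [] → Irr u × ¬ Cut _▹_ u
  const-irr e = (∈⇒≢[] M∈ , ¬c) , ¬c′
    where
    const : ∀ {x} → x ∈ u → x ≡ M
    const {x} m with x ≟ M
    ... | yes eq = eq
    ... | no ne  = ⊥-elim (∈⇒≢[] (∈-remove⁺ M m ne) e)
    ¬c : ¬ Cut _≫_ u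
    ¬c (p , q , refl , p≢ , q≢ , h) with ≢[]⇒∃∈ p≢ | ≢[]⇒∃∈ q≢
    ... | x , m | y , m′ = <⇒≢ (h m m′) (trans (const (∈-++⁺ʳ p m′)) (sym (const (∈-++⁺ˡ m))))
    ¬c′ : ¬ Cut _▹_ u
    ¬c′ (p , q , refl , p≢ , q≢ , l , _) = <⇒≢ l (trans (const (∈-++⁺ˡ (maxW∈ p≢))) (sym (const (∈-++⁺ʳ p (maxW∈ q≢)))))

  strict : ∀ {w} → remove M u ≡ w → ∀ {x} → x ∈ w → x < M
  strict e m with ∈-remove⁻ M u (subst (_ ∈_) (sym e) m)
  ... | m′ , ne = ≤∧≢⇒< (ub m′) ne

  module _ {p s w₁ w₂} (u≡ : u ≡ p ++ M ∷ s) (M∉ : M ∉ p) (w≡ : remove M u ≡ w₁ ++ w₂) (irr : Irr w₁) where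

    -- If all of w₁ preceded the first M, then u could be cut after w₁: apart from M, the right part
    -- consists of letters of w₂, which lie below w₁.
    ¬▹⇒first : w₁ ≫ w₂ → ¬ Cut _▹_ u → length p < length w₁
    ¬▹⇒first w₁≫w₂ ¬c with length p <? length w₁
    ... | yes l = l
    ... | no ≮ with ++-prefix w₁ w₂ p (remove M s) e (≮⇒≥ ≮)
      where
      e : w₁ ++ w₂ ≡ p ++ remove M s
      e = trans (sym w≡) (trans (cong (remove M) u≡) (trans (remove-++ M p) (cong₂ _++_ (remove-∉ M p M∉) (remove-∷ M s))))
    ...   | r , refl , refl = ⊥-elim (¬c (w₁ , r ++ M ∷ s , trans u≡ (LP.++-assoc w₁ r (M ∷ s)) , proj₁ irr , ++≢[]ʳ r (λ ()) , cut))
      where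
      max≡ : maxW (r ++ M ∷ s) ≡ M
      max≡ = ≤-antisym (maxW-lub {r ++ M ∷ s} λ m → ub (subst (_ ∈_) (sym (trans u≡ (LP.++-assoc w₁ r (M ∷ s)))) (∈-++⁺ʳ w₁ m)))
                       (≤maxW (∈-++⁺ʳ r (here refl)))
      rest : remove M (r ++ M ∷ s) ≡ r ++ remove M s
      rest = trans (remove-++ M r) (cong₂ _++_ (remove-∉ M r (M∉ ∘ ∈-++⁺ʳ w₁)) (remove-∷ M s))
      cut : w₁ ▹ (r ++ M ∷ s)
      proj₁ cut = subst (maxW w₁ <_) (sym max≡) (maxW-<-lub (proj₁ irr) λ m → strict w≡ (∈-++⁺ˡ m))
      proj₂ cut {y = y} mx my with y ≟ M
      ... | yes e = inj₁ (trans e (sym max≡))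
      ... | no ne = inj₂ (w₁≫w₂ mx (subst (y ∈_) rest (∈-remove⁺ M my ne)))

    -- The left part of a ▹-cut avoids M, so it ends before the first M and is a proper prefix of
    -- w₁. The rest of w₁ lies in the right part without being M, hence below it: a ≫-cut of w₁.
    first⇒¬▹ : length p < length w₁ → ¬ Cut _▹_ u
    first⇒¬▹ l (p′ , q′ , e , p′≢ , q′≢ , lt′ , h) = proj₂ irr (p′ , proj₁ split , proj₁ (proj₂ split) , p′≢ , r≢ (proj₁ split) (proj₁ (proj₂ split)) , sep)
      where
      q′≤M : maxW q′ ≤ M
      q′≤M = maxW-lub {q′} λ n → ub (subst (_ ∈_) (sym e) (∈-++⁺ʳ p′ n))
      M∉p′ : M ∉ p′
      M∉p′ m = <⇒≱ (≤-<-trans (≤maxW m) lt′) q′≤M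
      M≤q′ : M ≤ maxW q′
      M≤q′ = [ (λ n → ⊥-elim (M∉p′ n)) , ≤maxW ]′ (∈-++⁻ p′ (subst (M ∈_) e M∈))
      e′ : remove M u ≡ p′ ++ remove M q′
      e′ = trans (cong (remove M) e) (trans (remove-++ M p′) (cong (_++ remove M q′) (remove-∉ M p′ M∉p′)))
      l′ : length p′ < length w₁
      l′ = ≤-<-trans (prefix-≤ p′ q′ p s (trans (sym e) u≡) M∉p′) l
      split : ∃ λ r → w₁ ≡ p′ ++ r × remove M q′ ≡ r ++ w₂
      split = ++-prefix p′ (remove M q′) w₁ w₂ (trans (sym e′) w≡) (<⇒≤ l′)
      r≢ : ∀ r → w₁ ≡ p′ ++ r → r ≢ []
      r≢ _ eq refl = <⇒≢ l′ (sym (trans (cong length eq) (cong length (LP.++-identityʳ p′))))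
      sep : p′ ≫ proj₁ split
      sep {x} {y} mx my with ∈-remove⁻ M q′ (subst (y ∈_) (sym (proj₂ (proj₂ split))) (∈-++⁺ˡ my))
      ... | my′ , ne = [ (λ y≡ → ⊥-elim (ne (trans y≡ (≤-antisym q′≤M M≤q′)))) , id ]′ (h mx my′)

  module _ {s q w₁ w₂} (u≡ : u ≡ s ++ M ∷ q) (M∉ : M ∉ q) (w≡ : remove M u ≡ w₁ ++ w₂) (irr : Irr w₂) where

    -- If all of w₂ followed the last M, then u could be cut before w₂, with M on the left above
    -- everything.
    irr⇒last : w₁ ≫ w₂ → Irr u → length q < length w₂
    irr⇒last w₁≫w₂ (_ , ¬c) with length q <? length w₂
    ... | yes l = l
    ... | no ≮ with ++-suffix w₁ w₂ (remove M s) q e (≮⇒≥ ≮)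
      where
      e : w₁ ++ w₂ ≡ remove M s ++ q
      e = trans (sym w≡) (trans (cong (remove M) u≡) (trans (remove-++ M s) (cong (remove M s ++_) (trans (remove-∷ M q) (remove-∉ M q M∉)))))
    ...   | r , refl , refl = ⊥-elim (¬c (s ++ M ∷ r , w₂ , trans u≡ (sym (LP.++-assoc s (M ∷ r) w₂)) , ++≢[]ʳ s (λ ()) , proj₁ irr , sep))
      where
      rest : remove M (s ++ M ∷ r) ≡ remove M s ++ r
      rest = trans (remove-++ M s) (cong (remove M s ++_) (trans (remove-∷ M r) (remove-∉ M r (M∉ ∘ ∈-++⁺ˡ))))
      sep : s ++ M ∷ r ≫ w₂
      sep {x} mx my with x ≟ M
      ... | yes refl = strict w≡ (∈-++⁺ʳ (remove M s ++ r) my)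
      ... | no ne    = w₁≫w₂ (subst (x ∈_) rest (∈-remove⁺ M mx ne)) my

    -- The right part of a ≫-cut avoids M, so it follows the last M and is a proper suffix of w₂;
    -- this cuts w₂.
    last⇒irr : length q < length w₂ → Irr u
    last⇒irr l = ∈⇒≢[] M∈ , ¬c
      where
      ¬c : ¬ Cut _≫_ u
      ¬c (p′ , q′ , e , p′≢ , q′≢ , h) = proj₂ irr (proj₁ split , q′ , proj₂ (proj₂ split) , r≢ (proj₁ split) (proj₂ (proj₂ split)) , q′≢ , sep)
        where
        M∉q′ : M ∉ q′
        M∉q′ m with ≢[]⇒∃∈ p′≢
        ... | x , mx = <⇒≱ (h mx m) (ub (subst (x ∈_) (sym e) (∈-++⁺ˡ mx)))
        l′ : length q′ < length w₂
        l′ = ≤-<-trans (suffix-≤ p′ q′ s q (trans (sym e) u≡) M∉q′) l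
        e′ : remove M u ≡ remove M p′ ++ q′
        e′ = trans (cong (remove M) e) (trans (remove-++ M p′) (cong (remove M p′ ++_) (remove-∉ M q′ M∉q′)))
        split : ∃ λ r → remove M p′ ≡ w₁ ++ r × w₂ ≡ r ++ q′
        split = ++-suffix (remove M p′) q′ w₁ w₂ (trans (sym e′) w≡) (<⇒≤ l′)
        r≢ : ∀ r → w₂ ≡ r ++ q′ → r ≢ []
        r≢ _ eq refl = <⇒≢ l′ (sym (cong length eq))
        sep : proj₁ split ≫ q′
        sep {x} mx my = h (proj₁ (∈-remove⁻ M p′ (subst (x ∈_) (sym (proj₁ (proj₂ split))) (∈-++⁺ʳ w₁ mx)))) my

-- The packed word of a forest

rootWord : List ℕ → Word → Word
rootWord I w = insert (suc (maxW w)) 1 I w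

mutual
  wordT : Tree → Word
  wordT (node I ls rs) = graft ls (rootWord I (wordF rs))

  graft : Forest → Word → Word
  graft []       v = v
  graft (l ∷ ls) v = wordT l ▷ graft ls v

  wordF : Forest → Word
  wordF []       = []
  wordF (t ∷ ts) = wordT t ⊘ wordF ts

record IsIrr (w : Word) (n : ℕ) : Set where
  field
    isPacked : Packed w
    isIrreducible    : Irr w
    hasLength    : length w ≡ n

open IsIrr

Good : Tree → Set
Good t = IsIrr (wordT t) (weightT t)

wordF-packed : ∀ f → Packed (wordF f)
wordF-packed []       ()
wordF-packed (t ∷ ts) = ⊘-packed (wordT t) (wordF ts)

length-wordF : ∀ f → All Good f → length (wordF f) ≡ weightF f
length-wordF [] [] = refl
length-wordF (t ∷ ts) (g ∷ gs) = trans (length-⊘ (wordT t) (wordF ts)) (cong₂ _+_ (hasLength g) (length-wordF ts gs))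

wordF-factors : ∀ t ts → Good t → Joined (λ p q → p ≫ q × Irr p) (wordT t) (wordF ts) (wordF (t ∷ ts))
wordF-factors t ts g with ⊘-joined (proj₁ (isIrreducible g)) (isPacked g) (wordF-packed ts)
... | p , q , e , h , e₁ , e₂ = p , q , e , ((λ {x} {y} → h {x} {y}) , Irr-pack≡ (trans (packed⇒pack≡ (isPacked g)) (sym e₁)) (isIrreducible g)) , e₁ , e₂

wordF≢[] : ∀ t ts → Good t → wordF (t ∷ ts) ≢ []
wordF≢[] t ts g e with wordF-factors t ts g
... | p , q , e′ , (_ , i) , _ = ++≢[]ˡ (proj₁ i) (trans (sym e′) e)

firstFactor : ∀ r rs → Good r → ∃₂ λ w₁ w₂ → wordF (r ∷ rs) ≡ w₁ ++ w₂ × Irr w₁ × (length w₁ ≡ weightT r) × w₁ ≫ w₂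
firstFactor r rs g with wordF-factors r rs g
... | p , q , e , (h , i) , e₁ , _ = p , q , e , i , trans (sym (length-pack p)) (trans (cong length e₁) (hasLength g)) , h

pack≡[] : ∀ {w} → pack w ≡ [] → w ≡ []
pack≡[] {[]} _ = refl

-- The suffix after the first factor equals the word of the remaining forest only up to packing, so
-- the last factor is transported along `splitIso`.
lastFactor : ∀ r rs → All Good (r ∷ rs) → ∃₂ λ w₁ w₂ → wordF (r ∷ rs) ≡ w₁ ++ w₂ × Irr w₂ × (length w₂ ≡ lastWeight r rs) × w₁ ≫ w₂
lastFactor r [] (g ∷ []) with wordF-factors r [] g
... | p , q , e , (h , i) , e₁ , e₂ = [] , p , trans e (trans (cong (p ++_) (pack≡[] {q} e₂)) (LP.++-identityʳ p)) , i
    , trans (sym (length-pack p)) (trans (cong length e₁) (hasLength g)) , λ ()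
lastFactor r (r′ ∷ rs) (g ∷ gs) with wordF-factors r (r′ ∷ rs) g | lastFactor r′ rs gs
... | p , q , e , (h , i) , e₁ , e₂ | v₁ , v₂ , ev , i₂ , lv , hv
    with splitIso v₁ v₂ {q} (trans (cong pack (sym ev)) (trans (packed⇒pack≡ (wordF-packed (r′ ∷ rs))) (sym e₂)))
...   | q₁ , q₂ , refl , iso = p ++ q₁ , q₂ , trans e (sym (LP.++-assoc p q₁ q₂)) , Irr-pack≡ (Iso-packʳ iso) i₂
      , trans (pack≡⇒length≡ (sym (Iso-packʳ iso))) lv , sep
  where
  hq : q₁ ≫ q₂
  hq mx with []? v₁
  ... | yes refl = ⊥-elim (pack≡[]⁻ (sym (Iso-packˡ iso)) (∈⇒≢[] mx) refl)
  ... | no v₁≢ = ≫-invariant iso v₁≢ (proj₁ i₂) hv mx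
  sep : p ++ q₁ ≫ q₂
  sep mx my = [ (λ m → h m (∈-++⁺ʳ q₁ my)) , (λ m → hq m my) ]′ (∈-++⁻ p mx)

-- With s letters before the last maximum and q after it, the difference in the root condition is q
-- + 1: the position of the last maximum counted from the right.
+-∸-last : ∀ s q → (s + suc q + 1) ∸ (1 + s) ≡ suc q
+-∸-last s q = trans (cong (_∸ (1 + s)) (trans (+-comm (s + suc q) 1) (sym (+-assoc 1 s (suc q))))) (m+n∸m≡n (1 + s) (suc q))

-- The root condition says exactly that the word of the node with empty left forest is irreducible for ≫ and ▹.
module _ {M : ℕ} {u : Word} (M∈ : M ∈ u) (ub : ∀ {x} → x ∈ u → x ≤ M) where

  private I = positions M 1 u

  last-complement : ∀ rs → All Good rs → remove M u ≡ wordF rs → ∀ s q → u ≡ s ++ M ∷ q → lastN I ≡ 1 + length s →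
    (length I + weightF rs + 1) ∸ lastN I ≡ suc (length q)
  last-complement rs G e s q u≡ eL = trans (cong₂ (λ a b → a + 1 ∸ b) total eL) (+-∸-last (length s) (length q))
    where
    total : length I + weightF rs ≡ length s + suc (length q)
    total = trans (cong (length I +_) (trans (sym (length-wordF rs G)) (cong length (sym e))))
              (trans (length-positions M 1 u) (trans (cong length u≡) (LP.length-++ s)))

  irr⇒RootCond : ∀ rs → All Good rs → remove M u ≡ wordF rs → Irr u → ¬ Cut _▹_ u → RootCond I rs
  irr⇒RootCond [] _ e _ _ = begin
    I                      ≡⟨ positions-const M 1 u suc (λ _ → refl) e ⟩
    applyUpTo suc (length u) ≡⟨ cong (applyUpTo suc) (sym l) ⟩
    applyUpTo suc (length I) ≡⟨ sym (LP.map-upTo suc (length I)) ⟩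
    map suc (upTo (length I)) ∎
    where
    open ≡-Reasoning
    l : length I ≡ length u
    l = trans (sym (trans (cong (λ w → length I + length w) e) (+-identityʳ (length I)))) (length-positions M 1 u)
  irr⇒RootCond (r ∷ rs) (g ∷ gs) e i ¬c
    with firstOccurrence M 1 u M∈ | lastOccurrence M 1 u M∈ | firstFactor r rs g | lastFactor r rs (g ∷ gs)
  ... | p , s , u≡ , M∉p , eF | s′ , q , u≡′ , M∉q , eL | _ , _ , w≡ , irr₁ , l₁ , h₁ | _ , _ , w≡′ , irr₂ , l₂ , h₂ =
      -- Positions start at 1, so the first maximum sits at `1 + length p`, and the strict
      -- inequalities between lengths become the bounds of the root condition.
      (subst (1 ≤_) (sym eF) (s≤s z≤n) , subst₂ _≤_ (sym eF) l₁ (¬▹⇒first M∈ ub u≡ M∉p (trans e w≡) irr₁ h₁ ¬c))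
    , (subst (1 ≤_) (sym eq) (s≤s z≤n) , subst₂ _≤_ (sym eq) l₂ (irr⇒last M∈ ub u≡′ M∉q (trans e w≡′) irr₂ h₂ i))
    where eq = last-complement (r ∷ rs) (g ∷ gs) e s′ q u≡′ eL

  RootCond⇒irr : ∀ rs → All Good rs → remove M u ≡ wordF rs → RootCond I rs → Irr u × ¬ Cut _▹_ u
  RootCond⇒irr [] _ e _ = const-irr M∈ ub e
  RootCond⇒irr (r ∷ rs) (g ∷ gs) e ((_ , c₁) , (_ , c₂))
    with firstOccurrence M 1 u M∈ | lastOccurrence M 1 u M∈ | firstFactor r rs g | lastFactor r rs (g ∷ gs)
  ... | p , s , u≡ , M∉p , eF | s′ , q , u≡′ , M∉q , eL | _ , _ , w≡ , irr₁ , l₁ , h₁ | _ , _ , w≡′ , irr₂ , l₂ , h₂ =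
      last⇒irr M∈ ub u≡′ M∉q (trans e w≡′) irr₂ (subst₂ _≤_ eq (sym l₂) c₂)
    , first⇒¬▹ M∈ ub u≡ M∉p (trans e w≡) irr₁ (subst₂ _≤_ eF (sym l₁) c₁)
    where eq = last-complement (r ∷ rs) (g ∷ gs) e s′ q u≡′ eL

sorted : ∀ {I} → ValidLabel I → AllPairs _<_ I
sorted (_ , L , _) = Linked.Linked⇒AllPairs <-trans L

-- Positivity of the truncated difference says that the last position lies within the word, which is
-- what `insert-spec` requires.
RootCond⇒≤ : ∀ {I rs} → AllPairs _<_ I → RootCond I rs → ∀ {i} → i ∈ I → i ≤ length I + weightF rs
RootCond⇒≤ {I} {[]} _ e m = ≤-trans (proj₂ (∈-letters⁻ (subst (_ ∈_) e m))) (m≤m+n (length I) 0)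
RootCond⇒≤ {I} {r ∷ rs} S (_ , c , _) {i} m = ≤-trans (sorted-≤-lastN S m) (s≤s⁻¹ (subst (suc (lastN I) ≤_) (+-comm _ 1)
  (m∸n≢0⇒n<m λ e → <⇒≢ c (sym e))))

module RootWord {I rs} (V : ValidLabel I) (C : RootCond I rs) (G : All Good rs) where

  w = wordF rs
  M = suc (maxW w)
  u = rootWord I w

  spec : positions M 1 u ≡ I × remove M u ≡ w
  spec = insert-spec M 1 I w (sorted V) (All.lookup (proj₂ (proj₂ V)))
    (λ m → s≤s (≤-trans (RootCond⇒≤ (sorted V) C m) (≤-reflexive (cong (length I +_) (sym (length-wordF rs G))))))
    (λ m → <⇒≱ (n<1+n (maxW w)) (≤maxW m))

  M∈ : M ∈ u
  M∈ with _∈?_ _≟_ M u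
  ... | yes m = m
  ... | no M∉ = ⊥-elim (proj₁ V (trans (sym (proj₁ spec)) (positions-∉ M 1 u M∉)))

  ub : ∀ {x} → x ∈ u → x ≤ M
  ub {x} m with x ≟ M
  ... | yes refl = ≤-refl
  ... | no ne    = ≤-trans (≤maxW (subst (x ∈_) (proj₂ spec) (∈-remove⁺ M m ne))) (n≤1+n (maxW w))

  irreducible : Irr u × ¬ Cut _▹_ u
  irreducible = RootCond⇒irr M∈ ub rs G (proj₂ spec) (subst (λ J → RootCond J rs) (sym (proj₁ spec)) C)

  isIrr : IsIrr u (length I + weightF rs)
  isPacked isIrr = add-max-packed {u} {M} (subst Packed (sym (proj₂ spec)) (wordF-packed rs)) (cong (suc ∘ maxW) (sym (proj₂ spec))) M∈
  isIrreducible    isIrr = proj₁ irreducible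
  hasLength    isIrr = trans (sym (length-positions M 1 u)) (cong₂ _+_ (cong length (proj₁ spec)) (trans (cong length (proj₂ spec)) (length-wordF rs G)))

▷-factors : ∀ {a b m n} → IsIrr a m → IsIrr b n → Joined (λ p q → p ▹ q × Irr p) a b (a ▷ b)
▷-factors g g′ with ▷-joined (proj₁ (isIrreducible g)) (proj₁ (isIrreducible g′)) (isPacked g) (isPacked g′)
... | p , q , e , h , e₁ , e₂ = p , q , e , (h , Irr-pack≡ (trans (packed⇒pack≡ (isPacked g)) (sym e₁)) (isIrreducible g)) , e₁ , e₂

▷-isIrr : ∀ {a b m n} → IsIrr a m → IsIrr b n → IsIrr (a ▷ b) (m + n)
isPacked (▷-isIrr {a} {b} g g′) = ▷-packed a b
isIrreducible (▷-isIrr {a} {b} g g′) with ▷-factors g g′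
... | p , q , e , (h , i) , e₁ , e₂ = subst Irr (sym e) (▹-irr (proj₁ i) h (Irr-pack≡ (trans (packed⇒pack≡ (isPacked g′)) (sym e₂)) (isIrreducible g′)))
hasLength (▷-isIrr {a} {b} g g′) = trans (length-▷ a b) (cong₂ _+_ (hasLength g) (hasLength g′))

graft-isIrr : ∀ {ls v n} → All Good ls → IsIrr v n → IsIrr (graft ls v) (weightF ls + n)
graft-isIrr []       g = g
graft-isIrr {l ∷ ls} {v} {n} (h ∷ hs) g = subst (IsIrr (graft (l ∷ ls) v)) (sym (+-assoc (weightT l) (weightF ls) n)) (▷-isIrr h (graft-isIrr hs g))

mutual
  goodT : ∀ t → RedPackedT t → Good t
  goodT (node I ls rs) (V , Rl , Rr , C) = subst (IsIrr (wordT (node I ls rs))) eq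
      (graft-isIrr (goodF ls Rl) (RootWord.isIrr V C (goodF rs Rr)))
    where
    eq : weightF ls + (length I + weightF rs) ≡ length I + weightF ls + weightF rs
    eq = trans (sym (+-assoc (weightF ls) (length I) (weightF rs))) (cong (_+ weightF rs) (+-comm (weightF ls) (length I)))

  goodF : ∀ f → RedPackedF f → All Good f
  goodF []       _        = []
  goodF (t ∷ ts) (R , Rs) = goodT t R ∷ goodF ts Rs

-- Bijectivity of the encoding by trees and forests

joined-injective : ∀ {R a b a′ b′ w w′} → CutRel R → w ≡ w′ →
  Joined (λ p q → R p q × Irr p) a b w → Joined (λ p q → R p q × Irr p) a′ b′ w′ → a ≡ a′ × b ≡ b′
joined-injective C refl (p , q , refl , (r , i) , refl , refl) (p′ , q′ , e , (r′ , i′) , refl , refl)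
  with irrCut-unique C e i i′ r r′
... | refl , refl = refl , refl

¬graft≡ : ∀ {l ls u v n} → All Good (l ∷ ls) → IsIrr v n → ¬ Cut _▹_ u → u ≢ graft (l ∷ ls) v
¬graft≡ (h ∷ hs) g ¬c e with ▷-factors h (graft-isIrr hs g)
... | p , q , e′ , (r , i) , e₁ , e₂ = ¬c (p , q , trans e e′ , proj₁ i
    , pack≡[]⁻ (trans (packed⇒pack≡ (isPacked (graft-isIrr hs g))) (sym e₂)) (proj₁ (isIrreducible (graft-isIrr hs g))) , r)

mutual
  wordT-injective : ∀ t t′ → RedPackedT t → RedPackedT t′ → wordT t ≡ wordT t′ → t ≡ t′
  wordT-injective (node I ls rs) (node I′ ls′ rs′) (V , Rl , Rr , C) (V′ , Rl′ , Rr′ , C′) e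
    with graft-injective ls ls′ Rl Rl′ (RootWord.isIrr V C (goodF rs Rr)) (RootWord.isIrr V′ C′ (goodF rs′ Rr′))
           (proj₂ (RootWord.irreducible V C (goodF rs Rr))) (proj₂ (RootWord.irreducible V′ C′ (goodF rs′ Rr′))) e
  ... | refl , u≡ = cong₂ (λ J r → node J ls r) I≡ (wordF-injective rs rs′ Rr Rr′ w≡)
    where
    module X = RootWord V C (goodF rs Rr)
    module X′ = RootWord V′ C′ (goodF rs′ Rr′)
    M≡ : X.M ≡ X′.M
    M≡ = trans (sym (maxW≡ X.M∈ X.ub)) (trans (cong maxW u≡) (maxW≡ X′.M∈ X′.ub))
    I≡ : I ≡ I′
    I≡ = trans (sym (proj₁ X.spec)) (trans (cong₂ (λ M u → positions M 1 u) M≡ u≡) (proj₁ X′.spec))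
    w≡ : wordF rs ≡ wordF rs′
    w≡ = trans (sym (proj₂ X.spec)) (trans (cong₂ remove M≡ u≡) (proj₂ X′.spec))

  -- Unique ▹-cuts with irreducible left part peel off the left forest tree by tree; it is exhausted
  -- exactly when a word without ▹-cut remains.
  graft-injective : ∀ ls ls′ {u u′ n n′} → RedPackedF ls → RedPackedF ls′ → IsIrr u n → IsIrr u′ n′ → ¬ Cut _▹_ u → ¬ Cut _▹_ u′ →
    graft ls u ≡ graft ls′ u′ → ls ≡ ls′ × u ≡ u′
  graft-injective []       []         _ _ _ _ _ _ e = refl , e
  graft-injective []       (l′ ∷ ls′) _ R′ _ g′ ¬c _ e = ⊥-elim (¬graft≡ (goodF (l′ ∷ ls′) R′) g′ ¬c e)
  graft-injective (l ∷ ls) []         R _ g _ _ ¬c e = ⊥-elim (¬graft≡ (goodF (l ∷ ls) R) g ¬c (sym e))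
  graft-injective (l ∷ ls) (l′ ∷ ls′) (R , Rs) (R′ , Rs′) g g′ ¬c ¬c′ e
    with joined-injective ▹-cutRel e (▷-factors (goodT l R) (graft-isIrr (goodF ls Rs) g)) (▷-factors (goodT l′ R′) (graft-isIrr (goodF ls′ Rs′) g′))
  ... | e₁ , e₂ with wordT-injective l l′ R R′ e₁ | graft-injective ls ls′ Rs Rs′ g g′ ¬c ¬c′ e₂
  ...   | refl | refl , e₃ = refl , e₃

  wordF-injective : ∀ f f′ → RedPackedF f → RedPackedF f′ → wordF f ≡ wordF f′ → f ≡ f′
  wordF-injective []       []         _ _ _ = refl
  wordF-injective []       (t′ ∷ ts′) _ R′ e = ⊥-elim (wordF≢[] t′ ts′ (goodT t′ (proj₁ R′)) (sym e))
  wordF-injective (t ∷ ts) []         R _ e = ⊥-elim (wordF≢[] t ts (goodT t (proj₁ R)) e)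
  wordF-injective (t ∷ ts) (t′ ∷ ts′) (R , Rs) (R′ , Rs′) e
    with joined-injective ≫-cutRel e (wordF-factors t ts (goodT t R)) (wordF-factors t′ ts′ (goodT t′ R′))
  ... | e₁ , e₂ = cong₂ _∷_ (wordT-injective t t′ R R′ e₁) (wordF-injective ts ts′ Rs Rs′ e₂)

glued : ∀ {R p q w} → Glue R → Packed (p ++ q) → Packed w → R p q → Joined R (pack p) (pack q) w → w ≡ p ++ q
glued G P Q r (p′ , q′ , refl , r′ , e₁ , e₂) = glue-unique G P Q e₁ e₂ r r′

mutual
  -- Without a ▹-cut, the positions of the maximum give the root and the rest gives the right
  -- forest. With one, the tree of the left part is put in front of the left forest of the tree of
  -- the right part. The last component serves the count for `TPrim`.
  wordT-surjective : ∀ n w → length w ≤ n → Packed w → Irr w →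
    ∃ λ t → RedPackedT t × wordT t ≡ w × (¬ Cut _▹_ w → EmptyLeft t)
  wordT-surjective zero    []      _ _ i = ⊥-elim (proj₁ i refl)
  wordT-surjective (suc n) w l P i with cut? _▹?_ w
  ... | no ¬c with wordF-surjective n (remove M w) l′ (remove-max-packed {w} P)
    where
    M = maxW w
    M∈ = maxW∈ (proj₁ i)
    l′ : length (remove M w) ≤ n
    l′ = s≤s⁻¹ (≤-trans (subst (length (remove M w) <_) (length-positions M 1 w)
           (m<n+m (length (remove M w)) (0<length (positions≢[] M 1 w M∈)))) l)
  ...   | rs , Rr , e = node I [] rs , (V , tt , Rr , C) , eq , λ _ → refl
    where
    M = maxW w
    M∈ = maxW∈ (proj₁ i)
    I = positions M 1 w
    V : ValidLabel I
    V = positions≢[] M 1 w M∈ , Linked.AllPairs⇒Linked (positions-sorted M 1 w) , All.tabulate (positions-≥ M 1 w)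
    C : RootCond I rs
    C = irr⇒RootCond M∈ ≤maxW rs (goodF rs Rr) (sym e) i ¬c
    module X = RootWord V C (goodF rs Rr)
    M≡ : X.M ≡ M
    M≡ = trans (cong (suc ∘ maxW) e) (suc-max-remove (proj₁ i) P)
    eq : rootWord I (wordF rs) ≡ w
    eq = positions-remove-injective M 1 X.u w (trans (cong (λ N → positions N 1 X.u) (sym M≡)) (proj₁ X.spec))
           (trans (cong (λ N → remove N X.u) (sym M≡)) (trans (proj₂ X.spec) e))
  wordT-surjective (suc n) w l P i | yes c with cut⇒irrCut ▹-cutRel c
  ... | p , q , refl , p≢ , q≢ , r , i′
      with wordT-surjective n (pack p) (subst (_≤ n) (sym (length-pack p)) (s≤s⁻¹ (≤-trans lp l))) (pack-packed p) (Irr-pack i′)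
         | wordT-surjective n (pack q) (subst (_≤ n) (sym (length-pack q)) (s≤s⁻¹ (≤-trans lq l))) (pack-packed q) (Irr-pack (▹-irrʳ q≢ r i))
    where
    lp : length p < length (p ++ q)
    lp = subst (length p <_) (sym (LP.length-++ p)) (m<m+n (length p) (0<length q≢))
    lq : length q < length (p ++ q)
    lq = subst (length q <_) (sym (LP.length-++ p)) (m<n+m (length q) (0<length p≢))
  ...   | t , R , e , _ | node I ls rs , (V , Rl , Rr , C) , e′ , _ =
          -- The root condition concerns only `I` and the right forest, so it survives the extension
          -- of the left forest.
          node I (t ∷ ls) rs , (V , (R , Rl) , Rr , C) , eq , λ ¬c → ⊥-elim (¬c c)
    where
    eq : wordT t ▷ wordT (node I ls rs) ≡ p ++ q
    eq = glued {_▹_} ▹-glue P (isPacked (▷-isIrr (goodT t R) (goodT (node I ls rs) (V , Rl , Rr , C)))) r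
      (subst₂ (λ a b → Joined _▹_ a b (wordT t ▷ wordT (node I ls rs))) e e′
        (▷-joined (proj₁ (isIrreducible (goodT t R))) (proj₁ (isIrreducible (goodT (node I ls rs) (V , Rl , Rr , C)))) (isPacked (goodT t R)) (isPacked (goodT (node I ls rs) (V , Rl , Rr , C)))))

  wordF-surjective : ∀ n w → length w ≤ n → Packed w → ∃ λ f → RedPackedF f × wordF f ≡ w
  wordF-surjective n       []         _ _ = [] , tt , refl
  wordF-surjective (suc n) w@(_ ∷ _)  l P with firstIrr w (λ ())
  ... | p , q , w≡ , i , r
      -- The first factor may be the whole word, so the bound does not drop here; it drops at the
      -- next step inside `wordT-surjective`.
      with wordT-surjective (suc n) (pack p) (≤-trans (subst (_≤ length w) (sym (length-pack p)) lp) l) (pack-packed p) (Irr-pack i)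
         | wordF-surjective n (pack q) (subst (_≤ n) (sym (length-pack q)) (s≤s⁻¹ (≤-trans lq l))) (pack-packed q)
    where
    l≡ : length w ≡ length p + length q
    l≡ = trans (cong length w≡) (LP.length-++ p)
    lp : length p ≤ length w
    lp = subst (length p ≤_) (sym l≡) (m≤m+n (length p) (length q))
    lq : length q < length w
    lq = subst (length q <_) (sym l≡) (m<n+m (length q) (0<length (proj₁ i)))
  ...   | t , R , e , _ | f , Rs , e′ = t ∷ f , (R , Rs) , trans eq (sym w≡)
    where
    eq : wordT t ⊘ wordF f ≡ p ++ q
    eq = glued {_≫_} ≫-glue (subst Packed w≡ P) (wordF-packed (t ∷ f)) r
      (subst₂ (λ a b → Joined _≫_ a b (wordT t ⊘ wordF f)) e e′ (⊘-joined (proj₁ (isIrreducible (goodT t R))) (isPacked (goodT t R)) (wordF-packed f)))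

-- From enumerated words to counted trees and forests

module _ {A : Set} {P : A → Set} {Q : Word → Set} (g : A → Word)
  (g-Q : ∀ {x} → P x → Q (g x))
  (g-injective : ∀ {x y} → P x → P y → g x ≡ g y → x ≡ y)
  (g-surjective : ∀ {w} → Q w → ∃ λ x → P x × g x ≡ w) where

  preimages : ∀ L → (∀ {w} → w ∈ L → Q w) → ∃ λ X → map g X ≡ L × (∀ {x} → x ∈ X → P x)
  preimages []      h = [] , refl , λ ()
  preimages (w ∷ L) h with g-surjective (h (here refl)) | preimages L (h ∘ there)
  ... | x , px , refl | X , refl , k = x ∷ X , refl , λ { (here refl) → px ; (there m) → k m }

  enumerates⇒hasCard : ∀ {L} → Enumerates L Q → HasCard P (length L)
  enumerates⇒hasCard {L} (U , to , from) with preimages L to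
  ... | X , refl , k = X , Uniq.map⁻ U , (λ x → mk⇔ k λ px → back px) , sym (LP.length-map g X)
    where
    back : ∀ {x} → P x → x ∈ X
    back px with ∈-map⁻ g (from (g-Q px))
    ... | y , m , e = subst (_∈ X) (sym (g-injective px (k m) e)) m

forests-hasCard : ∀ {n L} → Enumerates L (λ w → length w ≡ n × Packed w) →
  HasCard (λ f → RedPackedF f × weightF f ≡ n) (length L)
forests-hasCard = enumerates⇒hasCard wordF
  (λ { {f} (R , refl) → length-wordF f (goodF f R) , λ {x} → wordF-packed f {x} })
  (λ { {f} {f′} (R , _) (R′ , _) → wordF-injective f f′ R R′ })
  λ { {w} (refl , P) → let f , R , e = wordF-surjective (length w) w ≤-refl P in
      f , (R , trans (sym (length-wordF f (goodF f R))) (cong length e)) , e }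

trees-hasCard : ∀ {n L} → Enumerates L (λ w → (length w ≡ n × Packed w) × Irr w) →
  HasCard (λ t → RedPackedT t × weightT t ≡ n) (length L)
trees-hasCard = enumerates⇒hasCard wordT
  (λ { {t} (R , refl) → (hasLength (goodT t R) , λ {x} → isPacked (goodT t R) {x}) , isIrreducible (goodT t R) })
  (λ { {t} {t′} (R , _) (R′ , _) → wordT-injective t t′ R R′ })
  λ { {w} ((refl , P) , i) → let t , R , e , _ = wordT-surjective (length w) w ≤-refl P i in
      t , (R , trans (sym (hasLength (goodT t R))) (cong length e)) , e }

emptyLeft⇒¬▹ : ∀ t → RedPackedT t → EmptyLeft t → ¬ Cut _▹_ (wordT t)
emptyLeft⇒¬▹ (node I .[] rs) (V , _ , Rr , C) refl = proj₂ (RootWord.irreducible V C (goodF rs Rr))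

emptyLeftTrees-hasCard : ∀ {n L} → Enumerates L (λ w → (length w ≡ n × Packed w) × Irr w × ¬ Cut _▹_ w) →
  HasCard (λ t → RedPackedT t × weightT t ≡ n × EmptyLeft t) (length L)
emptyLeftTrees-hasCard = enumerates⇒hasCard wordT
  (λ { {t} (R , refl , E) → (hasLength (goodT t R) , λ {x} → isPacked (goodT t R) {x}) , isIrreducible (goodT t R) , emptyLeft⇒¬▹ t R E })
  (λ { {t} {t′} (R , _) (R′ , _) → wordT-injective t t′ R R′ })
  λ { {w} ((refl , P) , i , ¬c) → let t , R , e , E = wordT-surjective (length w) w ≤-refl P i in
      t , (R , trans (sym (hasLength (goodT t R))) (cong length e) , E ¬c) , e }

-- Linear algebra

_≟W_ : (u v : Word) → Dec (u ≡ v)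
_≟W_ = LP.≡-dec _≟_

lookup-injective : ∀ {A : Set} {L : List A} → Unique L → ∀ i j → lookup L i ≡ lookup L j → i ≡ j
lookup-injective (_ ∷ U) fzero    fzero    e = refl
lookup-injective (h ∷ U) fzero    (fsuc j) e = ⊥-elim (All.lookup h (∈-lookup j) e)
lookup-injective (h ∷ U) (fsuc i) fzero    e = ⊥-elim (All.lookup h (∈-lookup i) (sym e))
lookup-injective (_ ∷ U) (fsuc i) (fsuc j) e = cong fsuc (lookup-injective U i j e)

∈⇒lookup : ∀ {A : Set} {L : List A} {x} → x ∈ L → ∃ λ i → lookup L i ≡ x
∈⇒lookup (here e)  = fzero , sym e
∈⇒lookup (there m) with ∈⇒lookup m
... | i , e = fsuc i , e

module Sums {c ℓ : Level} (K : Field c ℓ) where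

  module K = Field K
  open Field K public using (Carrier; _≈_; 0#; 1#) renaming (_+_ to _⊕_; _*_ to _⊛_; -_ to ⊖_)
  open Lin K public
  module ≈-Reasoning = Relation.Binary.Reasoning.Setoid K.setoid

  ∑ : ∀ {A : Set} → (A → Carrier) → List A → Carrier
  ∑ f L = sumL (map f L)

  χ : ∀ {P : Set} → Dec P → Carrier
  χ (yes _) = 1#
  χ (no _)  = 0#

  χ-yes : ∀ {P : Set} (d : Dec P) → P → χ d ≈ 1#
  χ-yes (yes _) _ = K.refl
  χ-yes (no ¬p) p = ⊥-elim (¬p p)

  χ-no : ∀ {P : Set} (d : Dec P) → ¬ P → χ d ≈ 0#
  χ-no (yes p) ¬p = ⊥-elim (¬p p)
  χ-no (no _)  _  = K.refl

  ⊕-cong-0 : ∀ {a b} → a ≈ 0# → b ≈ 0# → a ⊕ b ≈ 0#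
  ⊕-cong-0 e e′ = K.trans (K.+-cong e e′) (K.+-identityˡ 0#)

  ⊛-0ʳ : ∀ {a b} → b ≈ 0# → a ⊛ b ≈ 0#
  ⊛-0ʳ {a} e = K.trans (K.*-congˡ e) (K.zeroʳ a)

  ⊛-0ˡ : ∀ {a b} → a ≈ 0# → a ⊛ b ≈ 0#
  ⊛-0ˡ {_} {b} e = K.trans (K.*-congʳ e) (K.zeroˡ b)

  ⊕-interchange : ∀ a b c d → (a ⊕ b) ⊕ (c ⊕ d) ≈ (a ⊕ c) ⊕ (b ⊕ d)
  ⊕-interchange a b c d = begin
    (a ⊕ b) ⊕ (c ⊕ d) ≈⟨ K.+-assoc a b (c ⊕ d) ⟩
    a ⊕ (b ⊕ (c ⊕ d)) ≈⟨ K.+-congˡ (K.sym (K.+-assoc b c d)) ⟩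
    a ⊕ ((b ⊕ c) ⊕ d) ≈⟨ K.+-congˡ (K.+-congʳ (K.+-comm b c)) ⟩
    a ⊕ ((c ⊕ b) ⊕ d) ≈⟨ K.+-congˡ (K.+-assoc c b d) ⟩
    a ⊕ (c ⊕ (b ⊕ d)) ≈⟨ K.sym (K.+-assoc a c (b ⊕ d)) ⟩
    (a ⊕ c) ⊕ (b ⊕ d) ∎
    where open ≈-Reasoning

  ∑-cong : ∀ {A : Set} {f g : A → Carrier} L → (∀ {u} → u ∈ L → f u ≈ g u) → ∑ f L ≈ ∑ g L
  ∑-cong []      h = K.refl
  ∑-cong (u ∷ L) h = K.+-cong (h (here refl)) (∑-cong L (h ∘ there))

  ∑-0 : ∀ {A : Set} {f : A → Carrier} L → (∀ {u} → u ∈ L → f u ≈ 0#) → ∑ f L ≈ 0#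
  ∑-0 []      h = K.refl
  ∑-0 (u ∷ L) h = ⊕-cong-0 (h (here refl)) (∑-0 L (h ∘ there))

  ∑-⊕ : ∀ {A : Set} {f g : A → Carrier} L → ∑ (λ u → f u ⊕ g u) L ≈ ∑ f L ⊕ ∑ g L
  ∑-⊕ []      = K.sym (K.+-identityˡ 0#)
  ∑-⊕ {f = f} {g} (u ∷ L) = K.trans (K.+-congˡ (∑-⊕ L)) (⊕-interchange (f u) (g u) (∑ f L) (∑ g L))

  ∑-⊛ˡ : ∀ {A : Set} {f : A → Carrier} a L → a ⊛ ∑ f L ≈ ∑ (λ u → a ⊛ f u) L
  ∑-⊛ˡ a []      = K.zeroʳ a
  ∑-⊛ˡ {f = f} a (u ∷ L) = K.trans (K.distribˡ a (f u) (∑ f L)) (K.+-congˡ (∑-⊛ˡ a L))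

  ∑-swap : ∀ {A B : Set} (f : A → B → Carrier) L M → ∑ (λ a → ∑ (f a) M) L ≈ ∑ (λ b → ∑ (λ a → f a b) L) M
  ∑-swap f []      M = K.sym (∑-0 M λ _ → K.refl)
  ∑-swap f (a ∷ L) M = K.trans (K.+-congˡ (∑-swap f L M)) (K.sym (∑-⊕ M))

  ∑-single : ∀ {A : Set} {f : A → Carrier} {L w} → Unique L → w ∈ L → (∀ {u} → u ∈ L → u ≢ w → f u ≈ 0#) → ∑ f L ≈ f w
  ∑-single {f = f} {_ ∷ L} {w} (h ∷ U) (here refl) z = K.trans (K.+-congˡ (∑-0 L λ m → z (there m) (All.lookup h m ∘ sym))) (K.+-identityʳ (f w))
  ∑-single {f = f} {_ ∷ L} {w} (h ∷ U) (there m)   z = K.trans (K.+-cong (z (here refl) (All.lookup h m)) (∑-single U m (z ∘ there))) (K.+-identityˡ (f w))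

  ∑-filter : ∀ {A : Set} {P : A → Set} (P? : ∀ x → Dec (P x)) {f : A → Carrier} L → (∀ {u} → u ∈ L → ¬ P u → f u ≈ 0#) → ∑ f L ≈ ∑ f (filter P? L)
  ∑-filter P? []      h = K.refl
  ∑-filter P? {f} (u ∷ L) h with P? u
  ... | yes p = K.+-congˡ (∑-filter P? L (h ∘ there))
  ... | no ¬p = K.trans (K.+-cong (h (here refl) ¬p) (∑-filter P? L (h ∘ there))) (K.+-identityˡ _)

  off : Word → (Word → Carrier) → Word → Carrier
  off w g u with u ≟W w
  ... | yes _ = 0#
  ... | no _  = g u

  off-cong : ∀ {w f g} {u} → (u ≢ w → f u ≈ g u) → off w f u ≈ off w g u
  off-cong {w} {u = u} h with u ≟W w
  ... | yes _ = K.refl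
  ... | no ne = h ne

  ∑-split : ∀ {g L w} → Unique L → w ∈ L → ∑ g L ≈ g w ⊕ ∑ (off w g) L
  ∑-split {g} {L} {w} U m = begin
    ∑ g L                               ≈⟨ ∑-cong L (λ _ → split _) ⟩
    ∑ (λ u → on u ⊕ off w g u) L        ≈⟨ ∑-⊕ L ⟩
    ∑ on L ⊕ ∑ (off w g) L              ≈⟨ K.+-congʳ (∑-single U m λ _ → on-≢) ⟩
    on w ⊕ ∑ (off w g) L                ≈⟨ K.+-congʳ on-w ⟩
    g w ⊕ ∑ (off w g) L                 ∎
    where
    open ≈-Reasoning
    on : Word → Carrier
    on u with u ≟W w
    ... | yes _ = g u
    ... | no _  = 0#
    split : ∀ u → g u ≈ on u ⊕ off w g u
    split u with u ≟W w
    ... | yes _ = K.sym (K.+-identityʳ (g u))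
    ... | no _  = K.sym (K.+-identityˡ (g u))
    on-≢ : ∀ {u} → u ≢ w → on u ≈ 0#
    on-≢ {u} ne with u ≟W w
    ... | yes e = ⊥-elim (ne e)
    ... | no _  = K.refl
    on-w : on w ≈ g w
    on-w with w ≟W w
    ... | yes _ = K.refl
    ... | no ne = ⊥-elim (ne refl)

  sumFin-0 : ∀ {d} {f : Fin d → Carrier} → (∀ i → f i ≈ 0#) → sumFin f ≈ 0#
  sumFin-0 {zero}  h = K.refl
  sumFin-0 {suc d} h = ⊕-cong-0 (h fzero) (sumFin-0 (h ∘ fsuc))

  sumFin-single : ∀ {d} {f : Fin d → Carrier} j → (∀ i → i ≢ j → f i ≈ 0#) → sumFin f ≈ f j
  sumFin-single {suc d} {f} fzero    h = K.trans (K.+-congˡ (sumFin-0 λ i → h (fsuc i) λ ())) (K.+-identityʳ (f fzero))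
  sumFin-single {suc d} {f} (fsuc j) h = K.trans (K.+-cong (h fzero λ ()) (sumFin-single j λ i ne → h (fsuc i) (ne ∘ FinP.suc-injective)))
    (K.+-identityˡ (f (fsuc j)))

  HasDim-⇔ : ∀ {P Q : Vect → Set ℓ} {d} → (∀ {x} → P x → Q x) → (∀ {x} → Q x → P x) → HasDim P d → HasDim Q d
  HasDim-⇔ to from (v , p , indep , span) = v , to ∘ p , indep , λ x → span x ∘ from

  -- A system of linear equations, one for each word w ∈ L with row w ≡ just i, whose
  -- coefficients coef i are unitriangular with respect to μ: the words without an equation
  -- are free coordinates on the space of solutions.
  module Triangular (L : List Word) (U : Unique L) (μ : Word → ℕ) {I : Set} (row : Word → Maybe I) (coef : I → Word → Carrier)
    (monic : ∀ {w i} → w ∈ L → row w ≡ just i → coef i w ≈ 1#)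
    (lower : ∀ {w i u} → w ∈ L → row w ≡ just i → u ∈ L → u ≢ w → coef i u ≈ 0# ⊎ μ u < μ w) where

    Solution : Vect → Set ℓ
    Solution x = (∀ w → w ∉ L → x w ≈ 0#) × (∀ {w i} → w ∈ L → row w ≡ just i → ∑ (λ u → x u ⊛ coef i u) L ≈ 0#)

    solve-row : ∀ {x : Vect} {w i} → Solution x → w ∈ L → row w ≡ just i → x w ≈ ⊖ ∑ (off w (λ u → x u ⊛ coef i u)) L
    solve-row {x} {w} {i} (_ , eqs) m e = inverseˡ-unique K.+-group (x w) _ (begin
      x w ⊕ ∑ (off w (λ u → x u ⊛ coef i u)) L        ≈⟨ K.+-congʳ (K.sym (K.trans (K.*-congˡ (monic m e)) (K.*-identityʳ (x w)))) ⟩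
      x w ⊛ coef i w ⊕ ∑ (off w (λ u → x u ⊛ coef i u)) L  ≈⟨ K.sym (∑-split U m) ⟩
      ∑ (λ u → x u ⊛ coef i u) L                      ≈⟨ eqs m e ⟩
      0#                                         ∎)
      where open ≈-Reasoning

    off-lower : ∀ (x y : Vect) {w i} → w ∈ L → row w ≡ just i → (∀ {u} → u ∈ L → μ u < μ w → x u ≈ y u) →
      ∑ (off w (λ u → x u ⊛ coef i u)) L ≈ ∑ (off w (λ u → y u ⊛ coef i u)) L
    off-lower x y {w} {i} m e h = ∑-cong L λ {u} mu → off-cong {w} {λ u → x u ⊛ coef i u} {λ u → y u ⊛ coef i u} λ ne →
      [ (λ z → K.trans (⊛-0ʳ z) (K.sym (⊛-0ʳ z))) , (λ l → K.*-congʳ (h mu l)) ]′ (lower m e mu ne)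

    solution-unique : ∀ {x y : Vect} → Solution x → Solution y → (∀ {w} → w ∈ L → row w ≡ nothing → x w ≈ y w) → ∀ w → x w ≈ y w
    solution-unique {x} {y} Sx Sy h w = go (suc (μ w)) w ≤-refl
      where
      go : ∀ k w → μ w < k → x w ≈ y w
      go (suc k) w (s≤s l) with _∈?_ _≟W_ w L
      ... | no w∉ = K.trans (proj₁ Sx w w∉) (K.sym (proj₁ Sy w w∉))
      ... | yes m with row w in e
      ...   | nothing = h m e
      ...   | just i  = K.trans (solve-row {x} Sx m e) (K.trans (K.-‿cong (off-lower x y m e λ {u} _ l′ → go k u (<-≤-trans l′ l))) (K.sym (solve-row {y} Sy m e)))

    -- Back substitution. The recursion passes through a sum over all of `L`, so it runs on fuel k.
    -- Fuel above `μ w` suffices (`extend-stable`): then the default 0# only meets vanishing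
    -- coefficients.
    extend : (Word → Carrier) → ℕ → Vect
    extend f zero    w = 0#
    extend f (suc k) w with _∈?_ _≟W_ w L
    ... | no _  = 0#
    ... | yes _ with row w
    ...   | nothing = f w
    ...   | just i  = ⊖ ∑ (off w (λ u → extend f k u ⊛ coef i u)) L

    extend-stable : ∀ f k k′ w → μ w < k → μ w < k′ → extend f k w ≈ extend f k′ w
    extend-stable f (suc k) (suc k′) w (s≤s l) (s≤s l′) with _∈?_ _≟W_ w L
    ... | no _ = K.refl
    ... | yes m with row w in e
    ...   | nothing = K.refl
    ...   | just i  = K.-‿cong (off-lower (extend f k) (extend f k′) m e λ {u} _ l″ → extend-stable f k k′ u (<-≤-trans l″ l) (<-≤-trans l″ l′))

    solution : (Word → Carrier) → Vect
    solution f w = extend f (suc (μ w)) w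

    solution-free : ∀ f {w} → w ∈ L → row w ≡ nothing → solution f w ≈ f w
    solution-free f {w} m e with _∈?_ _≟W_ w L
    ... | no w∉ = ⊥-elim (w∉ m)
    ... | yes _ rewrite e = K.refl

    solution-lead : ∀ f {w i} → w ∈ L → row w ≡ just i → solution f w ≈ ⊖ ∑ (off w (λ u → extend f (μ w) u ⊛ coef i u)) L
    solution-lead f {w} m e with _∈?_ _≟W_ w L
    ... | no w∉ = ⊥-elim (w∉ m)
    ... | yes _ rewrite e = K.refl

    solution-Solution : ∀ f → Solution (solution f)
    solution-Solution f = vanish , eqs
      where
      open ≈-Reasoning
      vanish : ∀ w → w ∉ L → solution f w ≈ 0#
      vanish w w∉ with _∈?_ _≟W_ w L
      ... | no _  = K.refl
      ... | yes m = ⊥-elim (w∉ m)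
      eqs : ∀ {w i} → w ∈ L → row w ≡ just i → ∑ (λ u → solution f u ⊛ coef i u) L ≈ 0#
      eqs {w} {i} m e = begin
        ∑ (λ u → solution f u ⊛ coef i u) L                                ≈⟨ ∑-split U m ⟩
        solution f w ⊛ coef i w ⊕ ∑ (off w (λ u → solution f u ⊛ coef i u)) L   ≈⟨ K.+-cong (K.trans (K.*-congˡ (monic m e)) (K.*-identityʳ _))
                                                                          (off-lower (solution f) (extend f (μ w)) m e λ {u} _ l → extend-stable f (suc (μ u)) (μ w) u ≤-refl l) ⟩
        solution f w ⊕ S                                              ≈⟨ K.+-congʳ (solution-lead f m e) ⟩
        ⊖ S ⊕ S                                                       ≈⟨ K.-‿inverseˡ S ⟩
        0#                                                            ∎
        where S = ∑ (off w (λ u → extend f (μ w) u ⊛ coef i u)) L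

    lincomb-Solution : ∀ {d} (cs : Fin d → Carrier) v → (∀ i → Solution (v i)) → Solution (lincomb cs v)
    lincomb-Solution {zero}  cs v h = (λ _ _ → K.refl) , λ _ _ → ∑-0 L λ _ → K.zeroˡ _
    lincomb-Solution {suc d} cs v h = (λ w w∉ → ⊕-cong-0 (⊛-0ʳ (proj₁ (h fzero) w w∉)) (proj₁ rest w w∉)) , eqs
      where
      open ≈-Reasoning
      cs′ = λ i → cs (fsuc i)
      v′  = λ i → v (fsuc i)
      rest : Solution (lincomb cs′ v′)
      rest = lincomb-Solution cs′ v′ (h ∘ fsuc)
      eqs : ∀ {w i} → w ∈ L → row w ≡ just i → ∑ (λ u → lincomb cs v u ⊛ coef i u) L ≈ 0#
      eqs {w} {i} m e = begin
        ∑ (λ u → lincomb cs v u ⊛ coef i u) L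
          ≈⟨ ∑-cong L (λ {u} _ → K.trans (K.distribʳ (coef i u) _ _) (K.+-congʳ (K.*-assoc (cs fzero) (v fzero u) (coef i u)))) ⟩
        ∑ (λ u → cs fzero ⊛ (v fzero u ⊛ coef i u) ⊕ lincomb cs′ v′ u ⊛ coef i u) L
          ≈⟨ ∑-⊕ L ⟩
        ∑ (λ u → cs fzero ⊛ (v fzero u ⊛ coef i u)) L ⊕ ∑ (λ u → lincomb cs′ v′ u ⊛ coef i u) L
          ≈⟨ ⊕-cong-0 (K.trans (K.sym (∑-⊛ˡ (cs fzero) L)) (⊛-0ʳ (proj₂ (h fzero) m e))) (proj₂ rest m e) ⟩
        0# ∎

    nothing? : ∀ (r : Maybe I) → Dec (r ≡ nothing)
    nothing? nothing  = yes refl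
    nothing? (just _) = no λ ()

    free : List Word
    free = filter (λ w → nothing? (row w)) L

    -- The basis is dual to the free coordinates: each vector is 1 at one free word and 0 at the
    -- others, so the coefficients of a combination are its values at the free words.
    solutions-dim : HasDim Solution (length free)
    solutions-dim = basis , (λ i → solution-Solution (δ-at i)) , independent , spanning
      where
      δ-at : Fin (length free) → Word → Carrier
      δ-at i w = χ (lookup free i ≟W w)
      basis : Fin (length free) → Vect
      basis i = solution (δ-at i)
      free⁻ : ∀ {w} → w ∈ free → w ∈ L × row w ≡ nothing
      free⁻ = ∈-filter⁻ (λ w → nothing? (row w)) {xs = L}
      coordinate : ∀ cs j → lincomb cs basis (lookup free j) ≈ cs j
      coordinate cs j = K.trans (sumFin-single j λ i i≢j → ⊛-0ʳ (K.trans (value i) (χ-no (lookup free i ≟W lookup free j) (i≢j ∘ lookup-injective (Uniq.filter⁺ _ U) i j))))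
        (K.trans (K.*-congˡ (K.trans (value j) (χ-yes (lookup free j ≟W lookup free j) refl))) (K.*-identityʳ (cs j)))
        where
        value : ∀ i → basis i (lookup free j) ≈ δ-at i (lookup free j)
        value i = solution-free (δ-at i) (proj₁ (free⁻ (∈-lookup j))) (proj₂ (free⁻ (∈-lookup j)))
      independent : ∀ cs → (∀ w → lincomb cs basis w ≈ 0#) → ∀ i → cs i ≈ 0#
      independent cs h i = K.trans (K.sym (coordinate cs i)) (h (lookup free i))
      spanning : ∀ x → Solution x → Σ (Fin (length free) → Carrier) λ cs → ∀ w → x w ≈ lincomb cs basis w
      spanning x S = cs , solution-unique S (lincomb-Solution cs basis λ i → solution-Solution (δ-at i)) agree
        where
        cs = λ i → x (lookup free i)
        agree : ∀ {w} → w ∈ L → row w ≡ nothing → x w ≈ lincomb cs basis w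
        agree m e with ∈⇒lookup (∈-filter⁺ (λ w → nothing? (row w)) m e)
        ... | i , refl = K.sym (coordinate cs i)

-- The coproducts in terms of the products

take-length : ∀ {A : Set} (p : List A) {q} → take (length p) (p ++ q) ≡ p
take-length []      = refl
take-length (x ∷ p) = cong (x ∷_) (take-length p)

drop-length : ∀ {A : Set} (p : List A) {q} → drop (length p) (p ++ q) ≡ q
drop-length []      = refl
drop-length (x ∷ p) = drop-length p

∈-cuts⁺ : ∀ {p q : Word} → p ≢ [] → q ≢ [] → length p ∈ cuts (p ++ q)
∈-cuts⁺ {[]}    p≢ q≢ = ⊥-elim (p≢ refl)
∈-cuts⁺ {x ∷ p} {q} p≢ q≢ = ∈-map⁺ suc (∈-upTo⁺ (subst (length p <_) (sym (LP.length-++ p)) (m<m+n (length p) (0<length q≢))))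

∈-cuts⁻ : ∀ {u i} → i ∈ cuts u → ∃₂ λ p q → u ≡ p ++ q × p ≢ [] × q ≢ [] × length p ≡ i
∈-cuts⁻ {u} m with ∈-map⁻ suc m
∈-cuts⁻ {[]}    m | j , m′ , refl with () ← ∈-upTo⁻ {0} m′
∈-cuts⁻ {x ∷ u} m | j , m′ , refl = x ∷ take j u , drop j u , cong (x ∷_) (sym (LP.take++drop≡id j u)) , (λ ()) , drop≢ , cong suc len
  where
  j< : j < length u
  j< = ∈-upTo⁻ m′
  len : length (take j u) ≡ j
  len = trans (LP.length-take j u) (m≤n⇒m⊓n≡m (<⇒≤ j<))
  drop≢ : drop j u ≢ []
  drop≢ e = <⇒≢ (m<n⇒0<n∸m j<) (sym (trans (sym (LP.length-drop j u)) (cong length e)))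

∧-true⁻ : ∀ a {b} → a ∧ b ≡ true → a ≡ true × b ≡ true
∧-true⁻ true e = refl , e

disjointᵇ⇒Disj : ∀ p q → disjointᵇ p q ≡ true → Disj p q
disjointᵇ⇒Disj (x ∷ p) q e (here refl) m′ with () ← trans (sym (proj₁ (∧-true⁻ (not (elemᵇ x q)) e))) (cong not (∈⇒elemᵇ m′))
disjointᵇ⇒Disj (x ∷ p) q e (there m)   m′ = disjointᵇ⇒Disj p q (proj₂ (∧-true⁻ (not (elemᵇ x q)) e)) m m′

Disj⇒disjointᵇ : ∀ p q → Disj p q → disjointᵇ p q ≡ true
Disj⇒disjointᵇ []      q d = refl
Disj⇒disjointᵇ (x ∷ p) q d = cong₂ _∧_ (cong not (∉⇒elemᵇ (d (here refl)))) (Disj⇒disjointᵇ p q (d ∘ there))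

eqWᵇ⇒≡ : ∀ u v → eqWᵇ u v ≡ true → u ≡ v
eqWᵇ⇒≡ u v e with LP.≡-dec _≟_ u v
... | yes eq = eq

≡⇒eqWᵇ : ∀ u v → u ≡ v → eqWᵇ u v ≡ true
≡⇒eqWᵇ u v eq with LP.≡-dec _≟_ u v
... | yes _ = refl
... | no ne = ⊥-elim (ne eq)

max∈ˡ⇒Max< : ∀ {p q} → q ≢ [] → Disj p q → maxW (p ++ q) ∈ p → Max< q p
max∈ˡ⇒Max< {p} {q} q≢ d m = ≤∧≢⇒< (≤-trans (m≤n⊔m (maxW p) (maxW q)) (subst (_≤ maxW p) (maxW-++ p q) (≤maxW m)))
  λ e → d (subst (_∈ p) (trans (maxW-++ p q) (trans (cong (maxW p ⊔_) e) (trans (⊔-idem (maxW p)) (sym e)))) m) (maxW∈ q≢)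

Max<⇒max∈ˡ : ∀ {p q} → p ≢ [] → Max< q p → maxW (p ++ q) ∈ p
Max<⇒max∈ˡ {p} {q} p≢ l = subst (_∈ p) (sym (trans (maxW-++ p q) (m≥n⇒m⊔n≡m (<⇒≤ l)))) (maxW∈ p≢)

Disj⇒≺⊎≻ : ∀ {p q} → p ≢ [] → q ≢ [] → Disj p q → p ≺ q ⊎ p ≻ q
Disj⇒≺⊎≻ {p} {q} p≢ q≢ d with <-cmp (maxW p) (maxW q)
... | tri< l _ _ = inj₂ ((λ {x} → d {x}) , l)
... | tri> _ _ l = inj₁ ((λ {x} → d {x}) , l)
... | tri≈ _ e _ = ⊥-elim (d (maxW∈ p≢) (subst (_∈ q) (sym e) (maxW∈ q≢)))

-- The three products: all cuts with disjoint parts, and those with the maximum on the left or right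
data Kind : Set where
  •ᵏ ≺ᵏ ≻ᵏ : Kind

Rel : Kind → WordRel
Rel •ᵏ   = Disj
Rel ≺ᵏ  = _≺_
Rel ≻ᵏ = _≻_

rel? : ∀ k p q → Dec (Rel k p q)
rel? •ᵏ   = Disj?
rel? ≺ᵏ  = _≺?_
rel? ≻ᵏ = _≻?_

Rel-invariant : ∀ k → Invariant (Rel k)
Rel-invariant •ᵏ   = Disj-invariant
Rel-invariant ≺ᵏ  = ≺-invariant
Rel-invariant ≻ᵏ = ≻-invariant

record Lead (w : Word) (k : Kind) (a b : Word) : Set where
  field
    lead-in    : In (Rel k) w a b
    lead-lower : ∀ {u} → Packed u → In (Rel k) u a b → u ≡ w ⊎ inv u < inv w

open Lead

lead : ∀ {R} k {p q} → Leading R (Rel k) → Packed (p ++ q) → p ≢ [] → q ≢ [] → R p q → Rel k p q → Lead (p ++ q) k (pack p) (pack q)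
lead-in (lead k {p} {q} _ _ p≢ q≢ _ r′) = p , q , refl , p≢ , q≢ , r′ , refl , refl
lead-lower (lead k Le P _ _ r _) Q (p′ , q′ , refl , _ , _ , s , e , e′) = Le P Q e e′ r s

≫⇒Rel : ∀ {p q} → p ≢ [] → q ≢ [] → p ≫ q → Rel •ᵏ p q × Rel ≺ᵏ p q
≫⇒Rel p≢ q≢ h = (λ {x} → proj₁ (≫⇒≺ p≢ q≢ h) {x}) , ≫⇒≺ p≢ q≢ h

-- Pivot words of the equations

Index : Set
Index = Kind × Word × Word

rowPrim rowTPrim : ∀ {w} → Shape w → Maybe Index
rowPrim (reducible (p , q , _))         = just (•ᵏ , pack p , pack q)
rowPrim _                               = nothing
rowTPrim (reducible (p , q , _))        = just (≺ᵏ , pack p , pack q)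
rowTPrim (▹-reducible _ (p , q , _))    = just (≻ᵏ , pack p , pack q)
rowTPrim _                              = nothing

-- The system without equations: all packed words are free, so the whole space is treated like the
-- other two.
rowWQ : ∀ {w} → Shape w → Maybe Index
rowWQ _ = nothing

rowWQ-lead : ∀ {w k a b} → Packed w → (s : Shape w) → rowWQ s ≡ just (k , a , b) → Lead w k a b
rowWQ-lead _ _ ()

rowPrim-lead : ∀ {w k a b} → Packed w → (s : Shape w) → rowPrim s ≡ just (k , a , b) → Lead w k a b
rowPrim-lead P (reducible (p , q , refl , p≢ , q≢ , h , _)) refl = lead {_≫_} •ᵏ (≫-leading {Rel •ᵏ}) P p≢ q≢ h (proj₁ (≫⇒Rel p≢ q≢ h))

rowTPrim-lead : ∀ {w k a b} → Packed w → (s : Shape w) → rowTPrim s ≡ just (k , a , b) → Lead w k a b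
rowTPrim-lead P (reducible (p , q , refl , p≢ , q≢ , h , _))     refl = lead {_≫_} ≺ᵏ (≫-leading {Rel ≺ᵏ}) P p≢ q≢ h (proj₂ (≫⇒Rel p≢ q≢ h))
rowTPrim-lead P (▹-reducible _ (p , q , refl , p≢ , q≢ , h , _)) refl = lead {_▹_} ≻ᵏ (▹-leading {Rel ≻ᵏ} proj₂) P p≢ q≢ h (▹⇒≻ h)

-- `shape` stores some cut with irreducible left part; by uniqueness it is the given one, so the row
-- of w belongs to this very pair.
joined-≫⇒row : ∀ {w a b} → Irr a → b ≢ [] → Joined _≫_ a b w → (s : Shape w) →
  rowPrim s ≡ just (•ᵏ , a , b) × rowTPrim s ≡ just (≺ᵏ , a , b)
joined-≫⇒row a-irr b≢ (p , q , refl , h , refl , refl) = go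
  where
  p-irr : Irr p
  p-irr = Irr-pack≡ (pack-idem p) a-irr
  q≢ : q ≢ []
  q≢ = pack≡[]⁻ (pack-idem q) b≢
  go : (s : Shape (p ++ q)) → rowPrim s ≡ just (•ᵏ , pack p , pack q) × rowTPrim s ≡ just (≺ᵏ , pack p , pack q)
  go (empty e) = ⊥-elim (++≢[]ˡ (proj₁ p-irr) e)
  go (▹-reducible (_ , ¬c) _)   = ⊥-elim (¬c (p , q , refl , proj₁ p-irr , q≢ , h))
  go (▹-irreducible (_ , ¬c) _) = ⊥-elim (¬c (p , q , refl , proj₁ p-irr , q≢ , h))
  go (reducible (p′ , q′ , e , _ , _ , h′ , i′)) with irrCut-unique ≫-cutRel e p-irr i′ h h′
  ... | refl , refl = refl , refl

joined-▹⇒row : ∀ {w a b} → Irr a → Irr b → Joined _▹_ a b w → (s : Shape w) → rowTPrim s ≡ just (≻ᵏ , a , b)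
joined-▹⇒row a-irr b-irr (p , q , refl , h , refl , refl) = go
  where
  p-irr : Irr p
  p-irr = Irr-pack≡ (pack-idem p) a-irr
  q-irr : Irr q
  q-irr = Irr-pack≡ (pack-idem q) b-irr
  go : (s : Shape (p ++ q)) → rowTPrim s ≡ just (≻ᵏ , pack p , pack q)
  go (empty e) = ⊥-elim (++≢[]ˡ (proj₁ p-irr) e)
  go (reducible (p′ , q′ , e , p′≢ , q′≢ , h′ , _)) = ⊥-elim (proj₂ (▹-irr (proj₁ p-irr) h q-irr) (p′ , q′ , e , p′≢ , q′≢ , h′))
  go (▹-irreducible _ ¬c) = ⊥-elim (¬c (p , q , refl , proj₁ p-irr , proj₁ q-irr , h))
  go (▹-reducible _ (p′ , q′ , e , _ , _ , h′ , i′)) with irrCut-unique ▹-cutRel e p-irr i′ h h′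
  ... | refl , refl = refl

rowPrim-free : ∀ {w} → w ≢ [] → (s : Shape w) → (rowPrim s ≡ nothing → Irr w) × (Irr w → rowPrim s ≡ nothing)
rowPrim-free ne (empty e)           = ⊥-elim (ne e)
rowPrim-free ne (reducible (p , q , e , p≢ , q≢ , h , _)) = (λ ()) , λ i → ⊥-elim (proj₂ i (p , q , e , p≢ , q≢ , h))
rowPrim-free ne (▹-reducible i _)   = (λ _ → i) , λ _ → refl
rowPrim-free ne (▹-irreducible i _) = (λ _ → i) , λ _ → refl

rowTPrim-free : ∀ {w} → w ≢ [] → (s : Shape w) → (rowTPrim s ≡ nothing → Irr w × ¬ Cut _▹_ w) × (Irr w × ¬ Cut _▹_ w → rowTPrim s ≡ nothing)
rowTPrim-free ne (empty e)           = ⊥-elim (ne e)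
rowTPrim-free ne (reducible (p , q , e , p≢ , q≢ , h , _))     = (λ ()) , λ i → ⊥-elim (proj₂ (proj₁ i) (p , q , e , p≢ , q≢ , h))
rowTPrim-free ne (▹-reducible _ (p , q , e , p≢ , q≢ , h , _)) = (λ ()) , λ i → ⊥-elim (proj₂ i (p , q , e , p≢ , q≢ , h))
rowTPrim-free ne (▹-irreducible i ¬c) = (λ _ → i , ¬c) , λ _ → refl

-- For any other pair no word of degree n occurs in the product, so its equation holds trivially
-- (`pair-vanish`).
record Fits (n : ℕ) (a b : Word) : Set where
  field
    packedˡ : Packed a
    packedʳ : Packed b
    nonemptyˡ : a ≢ []
    nonemptyʳ : b ≢ []
    lengths : length a + length b ≡ n

open Fits

In-fits : ∀ {R n u a b} → u ∈ PW n → In R u a b → Fits n a b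
packedˡ   (In-fits _ i) = proj₁ (proj₁ (In-packed i))
packedʳ   (In-fits _ i) = proj₂ (proj₁ (In-packed i))
nonemptyˡ (In-fits _ i) = proj₁ (proj₂ (In-packed i))
nonemptyʳ (In-fits _ i) = proj₂ (proj₂ (In-packed i))
lengths   (In-fits {n = n} m i) = trans (In-lengths i) (proj₁ (∈-PW⁻ n m))

module Equations {c ℓ : Level} (K : Field c ℓ) where

  open Sums K

  coef : Index → Word → Carrier
  coef (k , a , b) u = χ (in? (rel? k) u a b)

  -- The length of a fixes the place of the cut, so at most one summand is 1 and the coefficient of
  -- the coproduct is an indicator.
  ∑-cuts : ∀ k (cutᵇ : ℕ → Bool) u a b →
    (∀ p q → u ≡ p ++ q → p ≢ [] → q ≢ [] → (cutᵇ (length p) ≡ true → Rel k p q × pack p ≡ a × pack q ≡ b) × (Rel k p q × pack p ≡ a × pack q ≡ b → cutᵇ (length p) ≡ true)) →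
    ∑ (ind ∘ cutᵇ) (cuts u) ≈ coef (k , a , b) u
  ∑-cuts k cutᵇ u a b reflect with in? (rel? k) u a b
  ... | no ¬in = ∑-0 (cuts u) vanish
    where
    vanish : ∀ {i} → i ∈ cuts u → ind (cutᵇ i) ≈ 0#
    vanish {i} m with cutᵇ i in eq | ∈-cuts⁻ m
    ... | false | _ = K.refl
    ... | true  | p , q , e , p≢ , q≢ , refl = ⊥-elim (¬in (p , q , e , p≢ , q≢ , proj₁ (reflect p q e p≢ q≢) eq))
  ... | yes (p , q , refl , p≢ , q≢ , r) = K.trans (∑-single (Uniq.map⁺ suc-injective (Uniq.upTo⁺ _)) (∈-cuts⁺ p≢ q≢) vanish)
        (K.reflexive (cong ind (proj₂ (reflect p q refl p≢ q≢) r)))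
    where
    vanish : ∀ {i} → i ∈ cuts (p ++ q) → i ≢ length p → ind (cutᵇ i) ≈ 0#
    vanish {i} m ne with cutᵇ i in eq | ∈-cuts⁻ {p ++ q} m
    ... | false | _ = K.refl
    ... | true  | p′ , q′ , e , p′≢ , q′≢ , refl = ⊥-elim (ne (pack≡⇒length≡ (trans (proj₁ (proj₂ (proj₁ (reflect p′ q′ e p′≢ q′≢) eq))) (sym (proj₁ (proj₂ r))))))

  coef≺-χ : ∀ u a b → coef≺ u a b ≈ coef (≺ᵏ , a , b) u
  coef≺-χ u a b = ∑-cuts ≺ᵏ (cut≺ᵇ u a b) u a b reflect
    where
    reflect : ∀ p q → u ≡ p ++ q → p ≢ [] → q ≢ [] →
      (cut≺ᵇ u a b (length p) ≡ true → p ≺ q × pack p ≡ a × pack q ≡ b) × (p ≺ q × pack p ≡ a × pack q ≡ b → cut≺ᵇ u a b (length p) ≡ true)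
    reflect p q refl p≢ q≢ rewrite take-length p {q} | drop-length p {q} = to , from
      where
      to : disjointᵇ p q ∧ elemᵇ (maxW (p ++ q)) p ∧ eqWᵇ (pack p) a ∧ eqWᵇ (pack q) b ≡ true → p ≺ q × pack p ≡ a × pack q ≡ b
      to e with ∧-true⁻ (disjointᵇ p q) e
      ... | d , e₁ with ∧-true⁻ (elemᵇ (maxW (p ++ q)) p) e₁
      ...   | m , e₂ with ∧-true⁻ (eqWᵇ (pack p) a) e₂
      ...     | ea , eb = ((λ {x} → D {x}) , max∈ˡ⇒Max< q≢ D (elemᵇ⇒∈ _ p m)) , eqWᵇ⇒≡ _ _ ea , eqWᵇ⇒≡ _ _ eb
        where
        D : Disj p q
        D = disjointᵇ⇒Disj p q d
      from : p ≺ q × pack p ≡ a × pack q ≡ b → disjointᵇ p q ∧ elemᵇ (maxW (p ++ q)) p ∧ eqWᵇ (pack p) a ∧ eqWᵇ (pack q) b ≡ true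
      from ((d , l) , ea , eb) = cong₂ _∧_ (Disj⇒disjointᵇ p q d) (cong₂ _∧_ (∈⇒elemᵇ (Max<⇒max∈ˡ p≢ l)) (cong₂ _∧_ (≡⇒eqWᵇ _ _ ea) (≡⇒eqWᵇ _ _ eb)))

  coef≻-χ : ∀ u a b → coef≻ u a b ≈ coef (≻ᵏ , a , b) u
  coef≻-χ u a b = ∑-cuts ≻ᵏ (cut≻ᵇ u a b) u a b reflect
    where
    reflect : ∀ p q → u ≡ p ++ q → p ≢ [] → q ≢ [] →
      (cut≻ᵇ u a b (length p) ≡ true → p ≻ q × pack p ≡ a × pack q ≡ b) × (p ≻ q × pack p ≡ a × pack q ≡ b → cut≻ᵇ u a b (length p) ≡ true)
    reflect p q refl p≢ q≢ rewrite take-length p {q} | drop-length p {q} = to , from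
      where
      to : disjointᵇ p q ∧ not (elemᵇ (maxW (p ++ q)) p) ∧ eqWᵇ (pack p) a ∧ eqWᵇ (pack q) b ≡ true → p ≻ q × pack p ≡ a × pack q ≡ b
      to e with ∧-true⁻ (disjointᵇ p q) e
      ... | d , e₁ with ∧-true⁻ (not (elemᵇ (maxW (p ++ q)) p)) e₁
      ...   | m , e₂ with ∧-true⁻ (eqWᵇ (pack p) a) e₂ | Disj⇒≺⊎≻ p≢ q≢ (disjointᵇ⇒Disj p q d)
      ...     | ea , eb | inj₂ r = r , eqWᵇ⇒≡ _ _ ea , eqWᵇ⇒≡ _ _ eb
      ...     | ea , eb | inj₁ (_ , l) with () ← trans (sym m) (cong not (∈⇒elemᵇ (Max<⇒max∈ˡ p≢ l)))
      from : p ≻ q × pack p ≡ a × pack q ≡ b → disjointᵇ p q ∧ not (elemᵇ (maxW (p ++ q)) p) ∧ eqWᵇ (pack p) a ∧ eqWᵇ (pack q) b ≡ true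
      from ((d , l) , ea , eb) = cong₂ _∧_ (Disj⇒disjointᵇ p q d) (cong₂ _∧_ (cong not (∉⇒elemᵇ λ m → <-asym l (max∈ˡ⇒Max< q≢ d m)))
        (cong₂ _∧_ (≡⇒eqWᵇ _ _ ea) (≡⇒eqWᵇ _ _ eb)))

  -- Both kinds would occur at the same cut, whose place the length of a fixes; so they exclude each
  -- other, and no coefficient 2 arises.
  coef-all : ∀ u a b → coef (≺ᵏ , a , b) u ⊕ coef (≻ᵏ , a , b) u ≈ coef (•ᵏ , a , b) u
  coef-all u a b with in? _≺?_ u a b | in? _≻?_ u a b | in? Disj? u a b
  ... | yes (p , q , refl , _ , _ , (_ , l) , ea , _) | yes (p′ , q′ , e , _ , _ , (_ , l′) , ea′ , _) | _
        with ++-cancel-length p q p′ q′ e (pack≡⇒length≡ (trans ea (sym ea′)))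
  ...     | refl , refl = ⊥-elim (<-asym l l′)
  coef-all u a b | yes _ | no _  | yes _ = K.+-identityʳ 1#
  coef-all u a b | no _  | yes _ | yes _ = K.+-identityˡ 1#
  coef-all u a b | no _  | no _  | no _  = K.+-identityˡ 0#
  coef-all u a b | yes (p , q , e , p≢ , q≢ , (d , _) , es) | no _ | no ¬i = ⊥-elim (¬i (p , q , e , p≢ , q≢ , (λ {x} → d {x}) , es))
  coef-all u a b | no _ | yes (p , q , e , p≢ , q≢ , (d , _) , es) | no ¬i = ⊥-elim (¬i (p , q , e , p≢ , q≢ , (λ {x} → d {x}) , es))
  coef-all u a b | no ¬l | no ¬r | yes (p , q , e , p≢ , q≢ , d , es) =
    ⊥-elim ([ (λ r → ¬l (p , q , e , p≢ , q≢ , r , es)) , (λ r → ¬r (p , q , e , p≢ , q≢ , r , es)) ]′ (Disj⇒≺⊎≻ p≢ q≢ d))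

  -- The value of the linear form x on the product of kind k of R_a and R_b
  pair : ℕ → Vect → Kind → Word → Word → Carrier
  pair n x k a b = ∑ (λ u → x u ⊛ coef (k , a , b) u) (PW n)

  Supported : ℕ → Vect → Set ℓ
  Supported n x = ∀ w → w ∉ PW n → x w ≈ 0#

  WQ⇔supported : ∀ n x → (WQ n x → Supported n x) × (Supported n x → WQ n x)
  WQ⇔supported n x = (λ h w w∉ → h w λ pw → w∉ (∈-PW⁺ n (proj₁ pw) (proj₂ packed⇔IsPW pw)))
                       , λ h w ¬pw → h w λ m → ¬pw (isPW (∈-PW⁻ n m))
    where
    isPW : ∀ {w} → length w ≡ n × Packed w → IsPW n w
    isPW (refl , P) = proj₁ packed⇔IsPW P

  Δ-pair : ∀ n x k (coefᵏ : Word → Word → Word → Carrier) → (∀ u a b → coefᵏ u a b ≈ coef (k , a , b) u) → Supported n x →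
    ∀ a b → ∑ (λ u → x u ⊛ coefᵏ u a b) (allWords n n) ≈ pair n x k a b
  Δ-pair n x k coefᵏ h S a b = K.trans (∑-cong (allWords n n) λ {u} _ → K.*-congˡ (h u a b))
    (∑-filter (λ w → LP.≡-dec _≟_ (pack w) w) (allWords n n) λ {u} _ ne →
      ⊛-0ˡ (S u λ m → ne (packed⇒pack≡ (proj₂ (∈-PW⁻ n m)))))

  Δ≺-pair : ∀ n x → Supported n x → ∀ a b → Δ≺ n x a b ≈ pair n x ≺ᵏ a b
  Δ≺-pair n x = Δ-pair n x ≺ᵏ coef≺ coef≺-χ

  Δ≻-pair : ∀ n x → Supported n x → ∀ a b → Δ≻ n x a b ≈ pair n x ≻ᵏ a b
  Δ≻-pair n x = Δ-pair n x ≻ᵏ coef≻ coef≻-χ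

  pair-all : ∀ n x a b → pair n x ≺ᵏ a b ⊕ pair n x ≻ᵏ a b ≈ pair n x •ᵏ a b
  pair-all n x a b = K.trans (K.sym (∑-⊕ (PW n))) (∑-cong (PW n) λ {u} _ →
    K.trans (K.sym (K.distribˡ (x u) _ _)) (K.*-congˡ (coef-all u a b)))

  -- The dendriform identities, paired with x

  ∑-χχ : ∀ {P Q : Word → Set} (P? : ∀ a → Dec (P a)) (Q? : ∀ a → Dec (Q a)) {L} → Unique L → (∀ {a a′} → Q a → Q a′ → a ≡ a′) →
    ((∃ λ a → a ∈ L × P a × Q a) → ∑ (λ a → χ (P? a) ⊛ χ (Q? a)) L ≈ 1#) × (¬ (∃ λ a → a ∈ L × P a × Q a) → ∑ (λ a → χ (P? a) ⊛ χ (Q? a)) L ≈ 0#)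
  ∑-χχ {P} {Q} P? Q? {L} U unique = one , none
    where
    one : (∃ λ a → a ∈ L × P a × Q a) → ∑ (λ a → χ (P? a) ⊛ χ (Q? a)) L ≈ 1#
    one (a , m , p , q) = K.trans (∑-single U m λ {a′} _ ne → ⊛-0ʳ (χ-no (Q? a′) λ q′ → ne (unique q′ q)))
      (K.trans (K.*-cong (χ-yes (P? a) p) (χ-yes (Q? a) q)) (K.*-identityˡ 1#))
    none : ¬ (∃ λ a → a ∈ L × P a × Q a) → ∑ (λ a → χ (P? a) ⊛ χ (Q? a)) L ≈ 0#
    none ¬∃ = ∑-0 L vanish
      where
      vanish : ∀ {a} → a ∈ L → χ (P? a) ⊛ χ (Q? a) ≈ 0#
      vanish {a} m with P? a | Q? a
      ... | no _  | _     = K.zeroˡ _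
      ... | yes _ | no _  = K.zeroʳ _
      ... | yes p | yes q = ⊥-elim (¬∃ (a , m , p , q))

  expand : ∀ n (x : Vect) (g : Word → Carrier) (h : Word → Word → Carrier) L →
    ∑ (λ a → g a ⊛ ∑ (λ u → x u ⊛ h a u) (PW n)) L ≈ ∑ (λ u → x u ⊛ ∑ (λ a → g a ⊛ h a u) L) (PW n)
  expand n x g h L = begin
    ∑ (λ a → g a ⊛ ∑ (λ u → x u ⊛ h a u) (PW n)) L      ≈⟨ ∑-cong L (λ {a} _ → ∑-⊛ˡ (g a) (PW n)) ⟩
    ∑ (λ a → ∑ (λ u → g a ⊛ (x u ⊛ h a u)) (PW n)) L    ≈⟨ ∑-swap (λ a u → g a ⊛ (x u ⊛ h a u)) L (PW n) ⟩
    ∑ (λ u → ∑ (λ a → g a ⊛ (x u ⊛ h a u)) L) (PW n)    ≈⟨ ∑-cong (PW n) (λ {u} _ → K.trans (∑-cong L λ {a} _ → rearrange (g a) (x u) (h a u)) (K.sym (∑-⊛ˡ (x u) L))) ⟩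
    ∑ (λ u → x u ⊛ ∑ (λ a → g a ⊛ h a u) L) (PW n)      ∎
    where
    open ≈-Reasoning
    rearrange : ∀ a b c → a ⊛ (b ⊛ c) ≈ b ⊛ (a ⊛ c)
    rearrange a b c = K.trans (K.sym (K.*-assoc a b c)) (K.trans (K.*-congʳ (K.*-comm a b)) (K.*-assoc b a c))

  -- Both sides are the value of x on the same triple product: at each u both inner sums indicate
  -- whether u has the corresponding cut into three parts.
  pair-assoc : ∀ {k₁ k₂ k₃ k₄} → Assoc (Rel k₁) (Rel k₂) (Rel k₃) (Rel k₄) → ∀ n x a₁ a₂ b →
    ∑ (λ a → coef (k₁ , a₁ , a₂) a ⊛ pair n x k₂ a b) (PW (length a₁ + length a₂)) ≈
    ∑ (λ d → coef (k₃ , a₂ , b) d ⊛ pair n x k₄ a₁ d) (PW (length a₂ + length b))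
  pair-assoc {k₁} {k₂} {k₃} {k₄} A n x a₁ a₂ b =
    K.trans (expand n x (coef (k₁ , a₁ , a₂)) (λ a → coef (k₂ , a , b)) L)
      (K.trans (∑-cong (PW n) λ {u} _ → K.*-congˡ (same u))
        (K.sym (expand n x (coef (k₃ , a₂ , b)) (λ d → coef (k₄ , a₁ , d)) M)))
    where
    L = PW (length a₁ + length a₂)
    M = PW (length a₂ + length b)
    in-PW : ∀ {R u a b} → In R u a b → Packed u → u ∈ PW (length a + length b)
    in-PW {a = a} {b} i P = ∈-PW⁺ (length a + length b) (sym (In-lengths i)) P
    same : ∀ u → ∑ (λ a → coef (k₁ , a₁ , a₂) a ⊛ coef (k₂ , a , b) u) L ≈ ∑ (λ d → coef (k₃ , a₂ , b) d ⊛ coef (k₄ , a₁ , d) u) M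
    same u with ∑-χχ (λ a → in? (rel? k₁) a a₁ a₂) (λ a → in? (rel? k₂) u a b) {L} (PW-unique (length a₁ + length a₂)) In-uniqueˡ
              | ∑-χχ (λ d → in? (rel? k₃) d a₂ b) (λ d → in? (rel? k₄) u a₁ d) {M} (PW-unique (length a₂ + length b)) In-uniqueʳ
              | Any.any? (λ a → in? (rel? k₁) a a₁ a₂ ×-dec in? (rel? k₂) u a b) L
    ... | one , _ | one′ , _ | yes any = K.trans (one (a , m , i , j)) (K.sym (one′ ∃d))
      where
      found = find any
      a = proj₁ found
      m = proj₁ (proj₂ found)
      i = proj₁ (proj₂ (proj₂ found))
      j = proj₂ (proj₂ (proj₂ found))
      ∃d : ∃ λ d → d ∈ M × In (Rel k₃) d a₂ b × In (Rel k₄) u a₁ d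
      ∃d with In-assocʳ A (Rel-invariant k₁) (Rel-invariant k₃) i j
      ... | d , i′ , j′ = d , in-PW i′ (proj₂ (proj₁ (In-packed j′))) , i′ , j′
    ... | _ , none | _ , none′ | no ¬any = K.trans (none λ { (a , m , i , j) → ¬any (lose m (i , j)) })
            (K.sym (none′ λ { (d , m , i , j) → ¬∃ d i j }))
      where
      ¬∃ : ∀ d → In (Rel k₃) d a₂ b → In (Rel k₄) u a₁ d → ⊥
      ¬∃ d i j with In-assocˡ A (Rel-invariant k₁) (Rel-invariant k₃) i j
      ... | a , i′ , j′ = ¬any (lose (in-PW i′ (proj₁ (proj₁ (In-packed j′)))) (i′ , j′))

  pair-vanish : ∀ n x k a b → (Fits n a b → pair n x k a b ≈ 0#) → pair n x k a b ≈ 0#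
  pair-vanish n x k a b h with Any.any? (λ u → in? (rel? k) u a b) (PW n)
  ... | yes any = h (In-fits (proj₁ (proj₂ (find any))) (proj₂ (proj₂ (find any))))
  ... | no ¬any = ∑-0 (PW n) λ {u} m → ⊛-0ʳ (χ-no (in? (rel? k) u a b) λ i → ¬any (lose m i))

  -- In a combination of values F a that vanishes, the values at the words below the leading one
  -- vanish by induction, so the value at the leading word vanishes too.
  isolate : ∀ {a k a₁ a₂} (F : Word → Carrier) → Packed a → Lead a k a₁ a₂ →
    ∑ (λ a′ → coef (k , a₁ , a₂) a′ ⊛ F a′) (PW (length a₁ + length a₂)) ≈ 0# →
    (∀ a′ → inv a′ < inv a → F a′ ≈ 0#) → F a ≈ 0#
  isolate {a} {k} {a₁} {a₂} F P Le sum≈0 ih = begin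
    F a                                    ≈⟨ K.sym (K.trans (K.*-congʳ (χ-yes (in? (rel? k) a a₁ a₂) (lead-in Le))) (K.*-identityˡ (F a))) ⟩
    coef (k , a₁ , a₂) a ⊛ F a             ≈⟨ K.sym (∑-single (PW-unique N) (∈-PW⁺ N (sym (In-lengths (lead-in Le))) P) vanish) ⟩
    ∑ (λ a′ → coef (k , a₁ , a₂) a′ ⊛ F a′) (PW N) ≈⟨ sum≈0 ⟩
    0#                                     ∎
    where
    open ≈-Reasoning
    N = length a₁ + length a₂
    vanish : ∀ {a′} → a′ ∈ PW N → a′ ≢ a → coef (k , a₁ , a₂) a′ ⊛ F a′ ≈ 0#
    vanish {a′} m ne with in? (rel? k) a′ a₁ a₂
    ... | no _  = K.zeroˡ _
    ... | yes i = ⊛-0ʳ ([ (λ e → ⊥-elim (ne e)) , ih a′ ]′ (lead-lower Le (proj₂ (∈-PW⁻ N m)) i))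

  -- A reducible a leads the product of its two parts. The identity moves the second part to the
  -- right argument, leaving the irreducible first part on the left, where `base` applies; induction
  -- on inversions removes the other words of the product.
  reduceˡ : ∀ {k₁ k k₃} → Assoc (Rel k₁) (Rel k) (Rel k₃) (Rel k) → (∀ {p q} → p ≢ [] → q ≢ [] → p ≫ q → Rel k₁ p q) → ∀ n x →
    (∀ a b → Irr a → pair n x k a b ≈ 0#) → ∀ a b → pair n x k a b ≈ 0#
  reduceˡ {k₁} {k} {k₃} A ≫⇒ n x base a b = go (suc (inv a)) a ≤-refl
    where
    go : ∀ N a → inv a < N → pair n x k a b ≈ 0#
    go (suc N) a (s≤s l) = pair-vanish n x k a b λ fits → step fits (shape a)
      where
      step : Fits n a b → Shape a → pair n x k a b ≈ 0#
      step fits (empty e)           = ⊥-elim (nonemptyˡ fits e)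
      step fits (▹-reducible i _)   = base a b i
      step fits (▹-irreducible i _) = base a b i
      step fits (reducible (p , q , e , p≢ , q≢ , h , irr)) =
        isolate {a} {k₁} {pack p} {pack q} (λ a′ → pair n x k a′ b) (packedˡ fits)
          (subst (λ w → Lead w k₁ (pack p) (pack q)) (sym e) (lead {_≫_} k₁ (≫-leading {Rel k₁}) (subst Packed e (packedˡ fits)) p≢ q≢ h (≫⇒ p≢ q≢ h)))
          (K.trans (pair-assoc {k₁} {k} {k₃} {k} A n x (pack p) (pack q) b) (∑-0 (PW (length (pack q) + length b)) λ {d} _ → ⊛-0ʳ (base (pack p) d (Irr-pack irr))))
          λ a′ l′ → go N a′ (<-≤-trans l′ l)

  -- The three linear systems and their solution spaces

  module System (n : ℕ) (row : ∀ {w} → Shape w → Maybe Index)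
    (row-lead : ∀ {w k a b} → Packed w → (s : Shape w) → row s ≡ just (k , a , b) → Lead w k a b) where

    monic : ∀ {w i} → w ∈ PW n → row (shape w) ≡ just i → coef i w ≈ 1#
    monic {w} {k , a , b} m e = χ-yes (in? (rel? k) w a b) (lead-in (row-lead (proj₂ (∈-PW⁻ n m)) (shape w) e))

    lower : ∀ {w i u} → w ∈ PW n → row (shape w) ≡ just i → u ∈ PW n → u ≢ w → coef i u ≈ 0# ⊎ inv u < inv w
    lower {w} {k , a , b} {u} m e mu ne with in? (rel? k) u a b
    ... | no _  = inj₁ K.refl
    ... | yes i = [ (λ eq → ⊥-elim (ne eq)) , inj₂ ]′ (lead-lower (row-lead (proj₂ (∈-PW⁻ n m)) (shape w) e) (proj₂ (∈-PW⁻ n mu)) i)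

    open Triangular (PW n) (PW-unique n) inv (λ w → row (shape w)) coef monic lower public

    free-enumerates : ∀ {Q : Word → Set} → (∀ {w} → length w ≡ n → (row (shape w) ≡ nothing → Q w) × (Q w → row (shape w) ≡ nothing)) →
      Enumerates free (λ w → (length w ≡ n × Packed w) × Q w)
    free-enumerates h = Uniq.filter⁺ _ (PW-unique n)
      , (λ m → let m′ , e = ∈-filter⁻ (λ w → nothing? (row (shape w))) {xs = PW n} m in ∈-PW⁻ n m′ , proj₁ (h (proj₁ (∈-PW⁻ n m′))) e)
      , λ { ((l , P) , q) → ∈-filter⁺ (λ w → nothing? (row (shape w))) (∈-PW⁺ n l P) (proj₂ (h l) q) }

  rowPrim-kind : ∀ {w k a b} (s : Shape w) → rowPrim s ≡ just (k , a , b) → k ≡ •ᵏ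
  rowPrim-kind (reducible _) refl = refl

  module WQSystem (n : ℕ) = System n rowWQ rowWQ-lead
  module PrimSystem (n : ℕ) = System n rowPrim rowPrim-lead
  module TPrimSystem (n : ℕ) = System n rowTPrim rowTPrim-lead

  length≡suc⇒≢[] : ∀ {m} {w : Word} → length w ≡ suc m → w ≢ []
  length≡suc⇒≢[] () refl

  ⊘∈PW : ∀ {n a b} → Fits n a b → a ⊘ b ∈ PW n
  ⊘∈PW {n} {a} {b} fits = ∈-PW⁺ n (trans (length-⊘ a b) (lengths fits)) (⊘-packed a b)

  ▷∈PW : ∀ {n a b} → Fits n a b → a ▷ b ∈ PW n
  ▷∈PW {n} {a} {b} fits = ∈-PW⁺ n (trans (length-▷ a b) (lengths fits)) (▷-packed a b)

  -- Every equation with irreducible left argument is thereby part of the system, as the row of this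
  -- word.
  ⊘-row : ∀ {n a b} → Fits n a b → Irr a → rowPrim (shape (a ⊘ b)) ≡ just (•ᵏ , a , b) × rowTPrim (shape (a ⊘ b)) ≡ just (≺ᵏ , a , b)
  ⊘-row {a = a} {b} fits i = joined-≫⇒row i (nonemptyʳ fits) (⊘-joined (proj₁ i) (packedˡ fits) (packedʳ fits)) (shape (a ⊘ b))

  ▷-row : ∀ {n a b} → Fits n a b → Irr a → Irr b → rowTPrim (shape (a ▷ b)) ≡ just (≻ᵏ , a , b)
  ▷-row {a = a} {b} fits i j = joined-▹⇒row i j (▷-joined (proj₁ i) (proj₁ j) (packedˡ fits) (packedʳ fits)) (shape (a ▷ b))

  WQ-dim : ∀ n → HasDim (WQ n) (length (WQSystem.free n))
  WQ-dim n = HasDim-⇔ (λ {x} S → proj₂ (WQ⇔supported n x) (proj₁ S)) (λ {x} h → proj₁ (WQ⇔supported n x) h , λ {w} {i} _ ()) (WQSystem.solutions-dim n)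

  Prim-dim : ∀ m → HasDim (Prim (suc m)) (length (PrimSystem.free (suc m)))
  Prim-dim m = HasDim-⇔ to from (PrimSystem.solutions-dim n)
    where
    n = suc m
    to : ∀ {x} → PrimSystem.Solution n x → Prim n x
    to {x} (S , eqs) = proj₂ (WQ⇔supported n x) S , λ a b →
        K.trans (K.+-cong (Δ≺-pair n x S a b) (Δ≻-pair n x S a b)) (K.trans (pair-all n x a b) (kill a b))
      where
      kill : ∀ a b → pair n x •ᵏ a b ≈ 0#
      kill = reduceˡ {•ᵏ} {•ᵏ} {•ᵏ} assoc-•••• (λ p≢ q≢ h → proj₁ (≫⇒Rel p≢ q≢ h)) n x λ a b i →
        pair-vanish n x •ᵏ a b λ fits → eqs (⊘∈PW fits) (proj₁ (⊘-row fits i))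
    from : ∀ {x} → Prim n x → PrimSystem.Solution n x
    from {x} (W , Δ≈0) = S , λ { {w} {k , a , b} _ e → kill k a b (rowPrim-kind (shape w) e) }
      where
      S = proj₁ (WQ⇔supported n x) W
      kill : ∀ k a b → k ≡ •ᵏ → pair n x k a b ≈ 0#
      kill _ a b refl = K.trans (K.sym (K.trans (K.+-cong (Δ≺-pair n x S a b) (Δ≻-pair n x S a b)) (pair-all n x a b))) (Δ≈0 a b)

  TPrim-dim : ∀ m → HasDim (TPrim (suc m)) (length (TPrimSystem.free (suc m)))
  TPrim-dim m = HasDim-⇔ to from (TPrimSystem.solutions-dim n)
    where
    n = suc m
    to : ∀ {x} → TPrimSystem.Solution n x → TPrim n x
    to {x} (S , eqs) = proj₂ (WQ⇔supported n x) S , (λ a b → K.trans (Δ≺-pair n x S a b) (kill-left a b)) , λ a b → K.trans (Δ≻-pair n x S a b) (kill-right a b)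
      where
      kill-left : ∀ a b → pair n x ≺ᵏ a b ≈ 0#
      kill-left = reduceˡ {≺ᵏ} {≺ᵏ} {•ᵏ} assoc-≺≺•≺ (λ p≢ q≢ h → proj₂ (≫⇒Rel p≢ q≢ h)) n x λ a b i →
        pair-vanish n x ≺ᵏ a b λ fits → eqs (⊘∈PW fits) (proj₂ (⊘-row fits i))
      kill-right-irr : ∀ a b → Irr a → pair n x ≻ᵏ a b ≈ 0#
      kill-right-irr a b i = go (suc (inv b)) b ≤-refl
        where
        go : ∀ N b → inv b < N → pair n x ≻ᵏ a b ≈ 0#
        go (suc N) b (s≤s l) = pair-vanish n x ≻ᵏ a b λ fits → step fits (shape b)
          where
          irreducible : Fits n a b → Irr b → pair n x ≻ᵏ a b ≈ 0#
          irreducible fits j = eqs (▷∈PW fits) (▷-row fits i j)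
          step : Fits n a b → Shape b → pair n x ≻ᵏ a b ≈ 0#
          step fits (empty e)           = ⊥-elim (nonemptyʳ fits e)
          step fits (▹-reducible j _)   = irreducible fits j
          step fits (▹-irreducible j _) = irreducible fits j
          step fits (reducible (p , q , e , p≢ , q≢ , h , _)) =
            isolate {b} {≺ᵏ} {pack p} {pack q} (pair n x ≻ᵏ a) (packedʳ fits)
              (subst (λ w → Lead w ≺ᵏ (pack p) (pack q)) (sym e) (lead {_≫_} ≺ᵏ (≫-leading {Rel ≺ᵏ}) (subst Packed e (packedʳ fits)) p≢ q≢ h (proj₂ (≫⇒Rel p≢ q≢ h))))
              -- A reducible b leads b₁ ≺ b₂, and a ≻ (b₁ ≺ b₂) = (a ≻ b₁) ≺ b₂ is a sum of
              -- ≺-products, which x already kills.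
              (K.trans (K.sym (pair-assoc {≻ᵏ} {≺ᵏ} {≺ᵏ} {≻ᵏ} assoc-≻≺≺≻ n x a (pack p) (pack q)))
                (∑-0 (PW (length a + length (pack p))) λ {a′} _ → ⊛-0ʳ (kill-left a′ (pack q))))
              λ b′ l′ → go N b′ (<-≤-trans l′ l)
      kill-right : ∀ a b → pair n x ≻ᵏ a b ≈ 0#
      -- With b already arbitrary, (a₁ · a₂) ≻ b = a₁ ≻ (a₂ ≻ b) frees the left argument from
      -- irreducibility.
      kill-right = reduceˡ {•ᵏ} {≻ᵏ} {≻ᵏ} assoc-•≻≻≻ (λ p≢ q≢ h → proj₁ (≫⇒Rel p≢ q≢ h)) n x kill-right-irr
    from : ∀ {x} → TPrim n x → TPrimSystem.Solution n x
    from {x} (W , Δ≺≈0 , Δ≻≈0) = S , λ { {w} {k , a , b} _ e → kill k a b (shape w) e }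
      where
      S = proj₁ (WQ⇔supported n x) W
      kill : ∀ {w} k a b (s : Shape w) → rowTPrim s ≡ just (k , a , b) → pair n x k a b ≈ 0#
      kill ≺ᵏ a b _ _ = K.trans (K.sym (Δ≺-pair n x S a b)) (Δ≺≈0 a b)
      kill ≻ᵏ a b _ _ = K.trans (K.sym (Δ≻-pair n x S a b)) (Δ≻≈0 a b)
      kill •ᵏ a b (reducible _) ()
      kill •ᵏ a b (▹-reducible _ _) ()

  IsZero-dim : HasDim IsZero 0
  IsZero-dim = (λ ()) , (λ ()) , (λ _ _ ()) , λ x h → (λ ()) , h

-- In degree 0 the only word is empty and not irreducible, in agreement with the convention that the
-- primitive spaces vanish there.
no-irr-0 : ∀ {Q : Word → Set} → (∀ {w} → Q w → Irr w) → Enumerates [] (λ w → (length w ≡ 0 × Packed w) × Q w)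
no-irr-0 h = [] , (λ ()) , λ { {[]} (_ , q) → ⊥-elim (proj₁ (h q) refl) }

mainTheorem1 : ∀ {c ℓ : Level} (K : Field c ℓ) (n : ℕ) →
    Σ ℕ (λ d → Lin.HasDim K (Lin.WQ K n) d × HasCard (λ (f : Forest) → RedPackedF f × weightF f ≡ n) d)
    × Σ ℕ (λ d → Lin.HasDim K (Lin.Prim K n) d × HasCard (λ (t : Tree) → RedPackedT t × weightT t ≡ n) d)
    × Σ ℕ (λ d → Lin.HasDim K (Lin.TPrim K n) d × HasCard (λ (t : Tree) → RedPackedT t × weightT t ≡ n × EmptyLeft t) d)
mainTheorem1 K n = wq , prim n , tprim n
  where
  open Equations K
  wq = length (WQSystem.free n) , WQ-dim n , forests-hasCard all-packed
    where
    all-packed : Enumerates (WQSystem.free n) (λ w → length w ≡ n × Packed w)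
    all-packed with WQSystem.free-enumerates n {λ _ → ⊤} (λ _ → (λ _ → tt) , λ _ → refl)
    ... | U , to , from = U , (λ {w} m → proj₁ (to {w} m)) , λ p → from (p , tt)
  prim : ∀ n → Σ ℕ (λ d → Lin.HasDim K (Lin.Prim K n) d × HasCard (λ (t : Tree) → RedPackedT t × weightT t ≡ n) d)
  prim zero    = 0 , IsZero-dim , trees-hasCard (no-irr-0 id)
  prim (suc m) = length (PrimSystem.free (suc m)) , Prim-dim m ,
    trees-hasCard (PrimSystem.free-enumerates (suc m) λ {w} l → rowPrim-free (length≡suc⇒≢[] l) (shape w))
  tprim : ∀ n → Σ ℕ (λ d → Lin.HasDim K (Lin.TPrim K n) d × HasCard (λ (t : Tree) → RedPackedT t × weightT t ≡ n × EmptyLeft t) d)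
  tprim zero    = 0 , IsZero-dim , emptyLeftTrees-hasCard (no-irr-0 proj₁)
  tprim (suc m) = length (TPrimSystem.free (suc m)) , TPrim-dim m ,
    emptyLeftTrees-hasCard (TPrimSystem.free-enumerates (suc m) λ {w} l → rowTPrim-free (length≡suc⇒≢[] l) (shape w))
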